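{- There is a positive constant $C_1$ such that the following holds. Let $m,n$ be integers satisfying $C_1\le n$ and $2n\le m$, let $r>m$ be an integer, and let $\delta=n/m$. Then: 1. If $r\ge n2^{n-1}$ then $\chi^n(m,r)\ge n(\ln(n))^2\,\dfrac{\delta}{C_1(\ln(1/\delta))^2}$. 2. If $r\ge C_1 m$ then $\chi^n(m,r)\ge n(\ln(n))^2\,\dfrac{\delta^2}{C_1(\ln(1/\delta))^2}$.
   Context: Interval notation denotes sets of integers. For a finite set $Y$ of integers ("keys"), a storage function for $Y$ is a strictly order preserving map $f:Y\to[1,m]$ ($x<y$ implies $f(x)<f(y)$); $[1,m]$ is the set of cells of an array of size $m$. The online labeling (array loading) game $G^n(m,r)$, for integers $n\le m<r$, is played by an adversary and a (deterministic) algorithm in $n$ steps. At step $t\in[1,n]$ the adversary selects a key $y^t\in\{1,\dots,r\}\setminus\{y^1,\dots,y^{t-1}\}$, and the algorithm, before seeing later keys, responds with a storage function $f^t$ for the set $Y^t=\{y^1,\dots,y^t\}$. A key $y\in Y^t$ is relocated at step $t$ if $y=y^t$ or $f^t(y)\ne f^{t-1}(y)$; $Rel^t$ is the set of keys relocated at step $t$. The total cost is $\chi^n=\sum_{t=1}^n|Rel^t|$. The algorithm wants to minimize and the adversary to maximize this cost. $\chi^n(m,r)$ denotes the smallest cost that can be achieved by the algorithm against the best adversary, i.e. the minimum over algorithms of the maximum over adversary key sequences of the total cost. -}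

module Defs where

open import Data.Nat as ℕ using (ℕ; zero; suc)
import Data.Nat.Properties as ℕₚ
open import Data.Product using (Σ; Σ-syntax; ∃; ∃-syntax; _×_; _,_; proj₁; proj₂)
open import Data.Sum using (inj₁; inj₂; [_,_]′)
open import Data.Unit using (⊤; tt)
open import Level using (0ℓ)
open import Relation.Nullary using (Dec; yes; no; ¬_; ¬?; contradiction)
open import Relation.Nullary.Decidable using (recompute; _→-dec_; dec⇒maybe)
open import Relation.Unary using (Pred; Decidable)
open import Relation.Binary.PropositionalEquality
  using (_≡_; _≢_; refl; sym; trans; cong; cong₂; subst; subst₂)

module LabelingGame where

  open import Data.Nat using (_+_; _∸_; _≤_; _<_; z≤n; s≤s; _≤?_; _<?_)
  open import Data.Nat.Properties
    using (≤-refl; ≤-trans; ≤-reflexive; <⇒≤; <-trans; <-irrefl; <-≤-trans; m≤n⇒m≤1+n; m≤m+n; m≤n+m;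
           m+n∸n≡m; m∸n+n≡m; +-suc; +-identityʳ; +-assoc; +-monoʳ-≤)
  open import Data.Fin as Fin using (Fin; zero; suc; fromℕ<)
  import Data.Fin.Properties as Finₚ
  open import Data.List as List using (List; []; _∷_)
  import Data.List.Relation.Unary.All as List-All
  open import Data.List.Membership.Propositional using () renaming (_∈_ to _∈ₗ_)
  open import Data.List.Membership.Propositional.Properties
    using (∈-map⁺; ∈-map⁻; ∈-filter⁺; ∈-filter⁻; ∈-allFin; ∈-cartesianProductWith⁺)
  open import Data.List.Relation.Unary.Any using (here)
  open import Data.List.Extrema.Nat using (max; argmin; argmin-sel; argmax-sel; xs≤max; f[argmin]≤f[xs])
  open import Data.Vec as Vec using (Vec; []; _∷_; lookup; count; zip; tail; tabulate)
  open import Data.Vec.Properties using (lookup∘tabulate; count≤n)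
  open import Data.Vec.Relation.Unary.All as All using (All)
  open import Data.Vec.Relation.Unary.AllPairs as AllPairs using ([]; _∷_)
  open import Data.Vec.Relation.Unary.Unique.Propositional using (Unique)

  -- Keys 1,…,r are the elements of Fin r and cells 1,…,m those of Fin m.  A key set
  -- Y^t is given by the vector of its keys, most recent first: y ∷ Y arises from Y when
  -- the adversary selects y.  lookup cells i is the cell in which a storage function
  -- for Y puts the key lookup Y i.
  record StorageFunction (m : ℕ) {r t} (Y : Vec (Fin r) t) : Set where
    constructor storage
    field
      cells  : Vec (Fin m) t
      strict : ∀ i j → lookup Y i Fin.< lookup Y j → lookup cells i Fin.< lookup cells j
  open StorageFunction public

  -- |Rel^t|: the new key, plus the old keys that change cell.
  relocations : ∀ {m t} → Vec (Fin m) t → Vec (Fin m) (suc t) → ℕ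
  relocations old new = suc (count (λ (c , c′) → ¬? (c Finₚ.≟ c′)) (zip old (tail new)))

  -- Irrelevance of the proof arguments makes the response a function of the keys alone.
  Algorithm : (n m r : ℕ) → Set
  Algorithm n m r = ∀ {t} → .(t ≤ n) → (Y : Vec (Fin r) t) → .(Unique Y) → StorageFunction m Y

  module _ {n m r : ℕ} (A : Algorithm n m r) where
    cost : ∀ {t} → .(t ≤ n) → (Y : Vec (Fin r) t) → .(Unique Y) → ℕ
    cost t≤n []      u = 0
    cost t≤n (y ∷ Y) u = cost (<⇒≤ t≤n) Y (AllPairs.tail u)
                       + relocations (cells (A (<⇒≤ t≤n) Y (AllPairs.tail u))) (cells (A t≤n (y ∷ Y) u))

  Achievable : (n m r c : ℕ) → Set
  Achievable n m r c = Σ[ A ∈ Algorithm n m r ] (∀ (Y : Vec (Fin r) n) (u : Unique Y) → cost A ≤-refl Y u ≤ c)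

  IsLeast : (ℕ → Set) → ℕ → Set
  IsLeast P v = P v × (∀ c → P c → v ≤ c)

  -- Existence of the minimax cost, by backward induction.
  module Existence (m r : ℕ) where

    count-mono : ∀ {P Q : Pred (Fin r) 0ℓ} (P? : Decidable P) (Q? : Decidable Q) → (∀ {x} → P x → Q x) →
      ∀ {t} (xs : Vec (Fin r) t) → count P? xs ≤ count Q? xs
    count-mono P? Q? h [] = z≤n
    count-mono P? Q? h (x ∷ xs) with P? x | Q? x
    ... | yes p | yes q = s≤s (count-mono P? Q? h xs)
    ... | yes p | no ¬q = contradiction (h p) ¬q
    ... | no ¬p | yes q = m≤n⇒m≤1+n (count-mono P? Q? h xs)
    ... | no ¬p | no ¬q = count-mono P? Q? h xs

    count-mono-< : ∀ {P Q : Pred (Fin r) 0ℓ} (P? : Decidable P) (Q? : Decidable Q) → (∀ {x} → P x → Q x) →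
      ∀ {t} (xs : Vec (Fin r) t) i → ¬ P (lookup xs i) → Q (lookup xs i) → count P? xs < count Q? xs
    count-mono-< P? Q? h (x ∷ xs) zero ¬p q with P? x | Q? x
    ... | yes p | _     = contradiction p ¬p
    ... | no _  | no ¬q = contradiction q ¬q
    ... | no _  | yes _ = s≤s (count-mono P? Q? h xs)
    count-mono-< P? Q? h (x ∷ xs) (suc i) ¬p q with P? x | Q? x
    ... | yes p | yes _ = s≤s (count-mono-< P? Q? h xs i ¬p q)
    ... | yes p | no ¬q = contradiction (h p) ¬q
    ... | no _  | yes _ = m≤n⇒m≤1+n (count-mono-< P? Q? h xs i ¬p q)
    ... | no _  | no _  = count-mono-< P? Q? h xs i ¬p q

    rank : ∀ {t} → Vec (Fin r) t → Fin r → ℕ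
    rank Y y = count (Finₚ._<? y) Y

    rank-mono : ∀ {t} (Y : Vec (Fin r) t) i j → lookup Y i Fin.< lookup Y j → rank Y (lookup Y i) < rank Y (lookup Y j)
    rank-mono Y i j lt = count-mono-< (Finₚ._<? _) (Finₚ._<? _) (λ p → <-trans p lt) Y i (<-irrefl refl) lt

    rank-bound : ∀ {t} (Y : Vec (Fin r) t) i → rank Y (lookup Y i) < t
    rank-bound Y i = <-≤-trans (count-mono-< {Q = λ _ → ⊤} (Finₚ._<? lookup Y i) (λ _ → yes tt) (λ _ → tt) Y i (<-irrefl refl) tt)
                               (count≤n (λ _ → yes tt) Y)

    default : ∀ {t} → .(t ≤ m) → (Y : Vec (Fin r) t) → StorageFunction m Y
    default {t} t≤m Y = storage (tabulate pos) mono
      where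
      lt : ∀ i → rank Y (lookup Y i) < m
      lt i = <-≤-trans (rank-bound Y i) (recompute (t ≤? m) t≤m)
      pos : Fin t → Fin m
      pos i = fromℕ< (lt i)
      mono : ∀ i j → lookup Y i Fin.< lookup Y j → lookup (tabulate pos) i Fin.< lookup (tabulate pos) j
      mono i j y<y′ = subst₂ Fin._<_ (sym (lookup∘tabulate pos i)) (sym (lookup∘tabulate pos j))
        (subst₂ _<_ (sym (Finₚ.toℕ-fromℕ< (lt i))) (sym (Finₚ.toℕ-fromℕ< (lt j))) (rank-mono Y i j y<y′))

    Valid : ∀ {t} → Vec (Fin r) t → Vec (Fin m) t → Set
    Valid Y f = ∀ i j → lookup Y i Fin.< lookup Y j → lookup f i Fin.< lookup f j

    valid? : ∀ {t} (Y : Vec (Fin r) t) → Decidable (Valid Y)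
    valid? Y f = Finₚ.all? λ i → Finₚ.all? λ j →
      (lookup Y i Finₚ.<? lookup Y j) →-dec (lookup f i Finₚ.<? lookup f j)

    allVecs : ∀ t → List (Vec (Fin m) t)
    allVecs zero    = [] ∷ []
    allVecs (suc t) = List.cartesianProductWith _∷_ (List.allFin m) (allVecs t)

    ∈-allVecs : ∀ {t} (f : Vec (Fin m) t) → f ∈ₗ allVecs t
    ∈-allVecs []      = here refl
    ∈-allVecs (c ∷ f) = ∈-cartesianProductWith⁺ _∷_ (∈-allFin c) (∈-allVecs f)

    candidates : ∀ {t} → Vec (Fin r) t → List (Vec (Fin m) t)
    candidates {t} Y = List.filter (valid? Y) (allVecs t)

    fresh? : ∀ {t} (Y : Vec (Fin r) t) → Decidable (λ y → All (y ≢_) Y)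
    fresh? Y y = All.all? (λ z → ¬? (y Finₚ.≟ z)) Y

    freshKeys : ∀ {t} → Vec (Fin r) t → List (Fin r)
    freshKeys Y = List.filter (fresh? Y) (List.allFin r)

    lookup-fresh : ∀ {t} (Y : Vec (Fin r) t) y → ¬ All (y ≢_) Y → Σ[ i ∈ Fin t ] y ≡ lookup Y i
    lookup-fresh [] y ¬a = contradiction All.[] ¬a
    lookup-fresh (z ∷ Y) y ¬a with y Finₚ.≟ z
    ... | yes y≡z = zero , y≡z
    ... | no y≢z with lookup-fresh Y y (λ a → ¬a (y≢z All.∷ a))
    ...   | i , eq = suc i , eq

    freshKey : ∀ {t} → t < r → (Y : Vec (Fin r) t) → Σ[ y ∈ Fin r ] All (y ≢_) Y
    freshKey {t} t<r Y with Finₚ.any? (fresh? Y)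
    ... | yes p = p
    ... | no ¬p with Finₚ.pigeonhole t<r (λ y → proj₁ (lookup-fresh Y y (λ a → ¬p (y , a))))
    ...   | i , j , i<j , eq = contradiction
      (trans (proj₂ (lookup-fresh Y i _)) (trans (cong (lookup Y) eq) (sym (proj₂ (lookup-fresh Y j _)))))
      (Finₚ.<⇒≢ i<j)

    value  : ∀ k {t} → .(k + t ≤ m) → Vec (Fin r) t → Vec (Fin m) t → ℕ
    move   : ∀ k {t} → .(suc k + t ≤ m) → Vec (Fin r) t → Vec (Fin m) t → Fin r → Vec (Fin m) (suc t) → ℕ
    reply  : ∀ k {t} → .(suc k + t ≤ m) → Vec (Fin r) t → Vec (Fin m) t → Fin r → Vec (Fin m) (suc t)

    shift : ∀ k t → suc k + t ≤ m → k + suc t ≤ m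
    shift k t = subst (_≤ m) (sym (+-suc k t))

    fits : ∀ k t → suc k + t ≤ m → suc t ≤ m
    fits k t p = ≤-trans (s≤s (m≤n+m t k)) p

    value zero    p Y f = 0
    value (suc k) p Y f = max 0 (List.map (λ y → move k p Y f y (reply k p Y f y)) (freshKeys Y))

    move k {t} p Y f y g = relocations f g + value k (shift k t p) (y ∷ Y) g

    reply k {t} p Y f y =
      argmin (move k p Y f y) (cells (default (fits k t p) (y ∷ Y))) (candidates (y ∷ Y))

    reply-valid : ∀ k {t} .(p : suc k + t ≤ m) (Y : Vec (Fin r) t) f y → Valid (y ∷ Y) (reply k p Y f y)
    reply-valid k {t} p Y f y =
      [ (λ eq  → subst (Valid (y ∷ Y)) (sym eq) (strict (default (fits k t p) (y ∷ Y))))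
      , (λ mem → proj₂ (∈-filter⁻ (valid? (y ∷ Y)) {xs = allVecs (suc t)} mem)) ]′
      (argmin-sel (move k p Y f y) (cells (default (fits k t p) (y ∷ Y))) (candidates (y ∷ Y)))

    reply-best : ∀ k {t} .(p : suc k + t ≤ m) (Y : Vec (Fin r) t) f y (g : StorageFunction m (y ∷ Y)) →
      move k p Y f y (reply k p Y f y) ≤ move k p Y f y (cells g)
    reply-best k {t} p Y f y g = List-All.lookup
      (f[argmin]≤f[xs] {f = move k p Y f y} (cells (default (fits k t p) (y ∷ Y))) (candidates (y ∷ Y)))
      (∈-filter⁺ (valid? (y ∷ Y)) (∈-allVecs (cells g)) (strict g))

    value-≥ : ∀ k {t} .(p : suc k + t ≤ m) (Y : Vec (Fin r) t) f y → All (y ≢_) Y →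
      move k p Y f y (reply k p Y f y) ≤ value (suc k) p Y f
    value-≥ k p Y f y fr = List-All.lookup (xs≤max 0 (List.map _ (freshKeys Y)))
      (∈-map⁺ (λ y → move k p Y f y (reply k p Y f y)) (∈-filter⁺ (fresh? Y) (∈-allFin y) fr))

    value-attained : ∀ k {t} .(p : suc k + t ≤ m) → t < r → (Y : Vec (Fin r) t) → ∀ f →
      Σ[ y ∈ Fin r ] (All (y ≢_) Y × value (suc k) p Y f ≤ move k p Y f y (reply k p Y f y))
    value-attained k {t} p t<r Y f = [ none , some ]′ (argmax-sel (λ v → v) 0 (List.map best (freshKeys Y)))
      where
      best : Fin r → ℕ
      best y = move k p Y f y (reply k p Y f y)
      Goal = Σ[ y ∈ Fin r ] (All (y ≢_) Y × value (suc k) p Y f ≤ best y)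
      none : value (suc k) p Y f ≡ 0 → Goal
      none eq = proj₁ (freshKey t<r Y) , proj₂ (freshKey t<r Y) , ≤-trans (≤-reflexive eq) z≤n
      some : value (suc k) p Y f ∈ₗ List.map best (freshKeys Y) → Goal
      some mem = let y , y∈ , eq = ∈-map⁻ best mem in
        y , proj₂ (∈-filter⁻ (fresh? Y) {xs = List.allFin r} y∈) , ≤-reflexive eq

    module _ (n : ℕ) (n≤m : n ≤ m) (m<r : m < r) where

      remaining : ∀ {t} → suc t ≤ n → suc (n ∸ suc t) + t ≤ m
      remaining {t} t<n = subst (_≤ m) (sym (trans (sym (+-suc (n ∸ suc t) t)) (m∸n+n≡m t<n))) n≤m

      play : ∀ {t} → .(t ≤ n) → Vec (Fin r) t → Vec (Fin m) t
      play t≤n []              = []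
      play {suc t} t<n (y ∷ Y) = reply (n ∸ suc t) (remaining t<n) Y (play (<⇒≤ t<n) Y) y

      optimal : Algorithm n m r
      optimal t≤n Y _ = storage (play t≤n Y) (valid t≤n Y)
        where
        valid : ∀ {t} .(t≤n : t ≤ n) (Y : Vec (Fin r) t) → Valid Y (play t≤n Y)
        valid t≤n []              ()
        valid {suc t} t<n (y ∷ Y) = reply-valid (n ∸ suc t) (remaining t<n) Y (play (<⇒≤ t<n) Y) y

      start : n + 0 ≤ m
      start = subst (_≤ m) (sym (+-identityʳ n)) n≤m

      χ₀ : ℕ
      χ₀ = value n start [] []

      bound : ∀ k t → k + t ≡ n → k + t ≤ m
      bound _ _ eq = subst (_≤ m) (sym eq) n≤m

      upper : ∀ k {t} (eq : k + t ≡ n) .(t≤n : t ≤ n) (Y : Vec (Fin r) t) (u : Unique Y) →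
        cost optimal t≤n Y u + value k (bound k t eq) Y (play t≤n Y) ≤ χ₀
      upper k eq t≤n [] [] with trans (sym (+-identityʳ k)) eq
      ... | refl = ≤-refl
      upper k {suc t} eq t<n (y ∷ Y) (fr ∷ u) = go (n ∸ suc t) {remaining t<n} k≡
        where
        k≡ : n ∸ suc t ≡ k
        k≡ = trans (cong (_∸ suc t) (sym eq)) (m+n∸n≡m k (suc t))
        eq′ : suc k + t ≡ n
        eq′ = trans (sym (+-suc k t)) eq
        f = play (<⇒≤ t<n) Y
        go : ∀ k′ .{p : suc k′ + t ≤ m} → k′ ≡ k →
          cost optimal (<⇒≤ t<n) Y u + relocations f (reply k′ p Y f y) + value k (bound k (suc t) eq) (y ∷ Y) (reply k′ p Y f y) ≤ χ₀
        go k′ {p} refl = ≤-trans (≤-reflexive (+-assoc (cost optimal (<⇒≤ t<n) Y u) _ _))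
          (≤-trans (+-monoʳ-≤ (cost optimal (<⇒≤ t<n) Y u) (value-≥ k (bound (suc k) t eq′) Y f y fr))
            (upper (suc k) eq′ (<⇒≤ t<n) Y u))

      chain : ∀ a {v w b c z} → v ≤ w → w ≤ b + c → a + b + c ≤ z → a + v ≤ z
      chain a {b = b} {c} v≤w w≤b+c h =
        ≤-trans (+-monoʳ-≤ a (≤-trans v≤w w≤b+c)) (≤-trans (≤-reflexive (sym (+-assoc a b c))) h)

      lower : (A : Algorithm n m r) → ∀ k {t} (eq : k + t ≡ n) .(t≤n : t ≤ n) (Y : Vec (Fin r) t) (u : Unique Y) →
        Σ[ Z ∈ Vec (Fin r) n ] Σ[ v ∈ Unique Z ]
          cost A t≤n Y u + value k (bound k t eq) Y (cells (A t≤n Y u)) ≤ cost A ≤-refl Z v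
      lower A zero refl t≤n Y u = Y , u , ≤-reflexive (+-identityʳ _)
      lower A (suc k) {t} eq t≤n Y u =
          step (value-attained k (bound (suc k) t eq) (<-≤-trans t<n (≤-trans n≤m (<⇒≤ m<r))) Y f)
        where
        t<n : t < n
        t<n = subst (t <_) eq (s≤s (m≤n+m t k))
        f = cells (A t≤n Y u)
        Goal : Set
        Goal = Σ[ Z ∈ Vec (Fin r) n ] Σ[ v ∈ Unique Z ]
          cost A t≤n Y u + value (suc k) (bound (suc k) t eq) Y f ≤ cost A ≤-refl Z v
        step : Σ[ y ∈ Fin r ] (All (y ≢_) Y × value (suc k) (bound (suc k) t eq) Y f
                 ≤ move k (bound (suc k) t eq) Y f y (reply k (bound (suc k) t eq) Y f y)) → Goal
        step (y , fr , le) = finish (lower A k (trans (+-suc k t) eq) t<n (y ∷ Y) (fr ∷ u))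
          where
          g = A t<n (y ∷ Y) (fr ∷ u)
          finish : Σ[ Z ∈ Vec (Fin r) n ] Σ[ v ∈ Unique Z ]
            cost A t<n (y ∷ Y) (fr ∷ u) + value k (bound k (suc t) (trans (+-suc k t) eq)) (y ∷ Y) (cells g)
              ≤ cost A ≤-refl Z v → Goal
          finish (Z , v , h) = Z , v , chain (cost A t≤n Y u) le
            (reply-best k (bound (suc k) t eq) Y f y g) h

      nil : ∀ {t} (f g : Vec (Fin m) t) → t ≡ 0 → f ≡ g
      nil [] [] refl = refl

      isLeast : IsLeast (Achievable n m r) χ₀
      isLeast = (optimal , λ Y u → ≤-trans (m≤m+n _ _) (upper 0 refl ≤-refl Y u)) , least
        where
        least : ∀ c → Achievable n m r c → χ₀ ≤ c
        least c (A , h) with lower A n (+-identityʳ n) z≤n [] []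
        ... | Z , v , le = ≤-trans (subst (λ f → χ₀ ≤ value n start [] f) (nil [] (cells (A z≤n [] [])) refl) ≤-refl)
              (≤-trans le (h Z v))

  abstract
    minimax : ∀ n m r → n ≤ m → m < r → ∃ (IsLeast (Achievable n m r))
    minimax n m r n≤m m<r = Existence.χ₀ m r n n≤m m<r , Existence.isLeast m r n n≤m m<r

  χ : (n m r : ℕ) → .(n ≤ m) → .(m < r) → ℕ
  χ n m r n≤m m<r = proj₁ (minimax n m r (recompute (n ≤? m) n≤m) (recompute (m <? r) m<r))

  χ-isLeast : ∀ n m r .(n≤m : n ≤ m) .(m<r : m < r) → IsLeast (Achievable n m r) (χ n m r n≤m m<r)
  χ-isLeast n m r n≤m m<r = proj₂ (minimax n m r (recompute (n ≤? m) n≤m) (recompute (m <? r) m<r))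

-- Facts used below to construct ℝ and ln.  They are stated over abstract operations
-- (instantiated to those of ℚ) because the concrete ones unfold during unification.
module OrderedField where

  open import Data.Rational as ℚ using (ℚ; 0ℚ; 1ℚ; ½)
  import Data.Rational.Properties as ℚₚ
  import Algebra.Structures as AS
  import Algebra.Bundles as AB
  import Algebra.Solver.Ring.AlmostCommutativeRing as ACR
  import Algebra.Solver.Ring as RingSolver
  import Data.Maybe
  open import Relation.Binary.Structures using (IsPartialOrder)
  open import Relation.Binary.Bundles using (Poset)

  record Ops : Set₁ where
    constructor mkOps
    infixl 6 _+_
    infixl 7 _*_
    infix 8 -_
    infix 4 _≤_ _<_
    field
      F : Set
      _+_ _*_ : F → F → F
      -_ rec abs : F → F
      _≤_ _<_ : F → F → Set
      num : ℕ → F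
      ⟦_⟧ : ℚ → F
      sum : ℕ → (ℕ → F) → F

  record Laws (O : Ops) : Set where
    open Ops O
    field
      isCommutativeRing : AS.IsCommutativeRing _≡_ _+_ _*_ -_ ⟦ 0ℚ ⟧ ⟦ 1ℚ ⟧
      ⟦⟧-+ : ∀ p q → ⟦ p ℚ.+ q ⟧ ≡ ⟦ p ⟧ + ⟦ q ⟧
      ⟦⟧-* : ∀ p q → ⟦ p ℚ.* q ⟧ ≡ ⟦ p ⟧ * ⟦ q ⟧
      ⟦⟧-- : ∀ p → ⟦ ℚ.- p ⟧ ≡ - ⟦ p ⟧
      isPartialOrder : IsPartialOrder _≡_ _≤_
      <⇒≤′ : ∀ {a b} → a < b → a ≤ b
      <-≤-trans′ : ∀ {a b c} → a < b → b ≤ c → a < c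
      0<½ : ⟦ 0ℚ ⟧ < ⟦ ½ ⟧
      0<1′ : ⟦ 0ℚ ⟧ < ⟦ 1ℚ ⟧
      +-mono-≤′ : ∀ {a b c d} → a ≤ b → c ≤ d → (a + c) ≤ (b + d)
      +-mono-<-≤′ : ∀ {a b c d} → a < b → c ≤ d → (a + c) < (b + d)
      *-monoʳ : ∀ {a b} c → ⟦ 0ℚ ⟧ ≤ c → a ≤ b → (a * c) ≤ (b * c)
      mul-pos : ∀ {a b} → ⟦ 0ℚ ⟧ < a → ⟦ 0ℚ ⟧ < b → ⟦ 0ℚ ⟧ < (a * b)
      rec-inv : ∀ {a} → ⟦ 0ℚ ⟧ < a → (a * rec a) ≡ ⟦ 1ℚ ⟧
      rec-pos : ∀ {a} → ⟦ 0ℚ ⟧ < a → ⟦ 0ℚ ⟧ < rec a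
      abs-+ : ∀ a b → abs (a + b) ≤ (abs a + abs b)
      abs-* : ∀ a b → abs (a * b) ≡ (abs a * abs b)
      abs-neg : ∀ a → abs (- a) ≡ abs a
      abs-≥0 : ∀ a → ⟦ 0ℚ ⟧ ≤ abs a
      abs-id : ∀ {a} → ⟦ 0ℚ ⟧ ≤ a → abs a ≡ a
      num-0 : num 0 ≡ ⟦ 0ℚ ⟧
      num-+ : ∀ a b → num (a ℕ.+ b) ≡ num a + num b
      num-1 : num 1 ≡ ⟦ 1ℚ ⟧
      num-≥0 : ∀ n → ⟦ 0ℚ ⟧ ≤ num n
      archimedean : ∀ q → ∃[ N ] (q ≤ num N)
      sum-0 : ∀ f → sum 0 f ≡ ⟦ 0ℚ ⟧
      sum-suc : ∀ n f → sum (suc n) f ≡ sum n f + f n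

  module Generic (O : Ops) (laws : Laws O) where

    open Ops O
    open Laws laws
    infixl 6 _-_

    _-_ : F → F → F
    a - b = a + - b

    0# 1# ½# : F
    0# = ⟦ 0ℚ ⟧
    1# = ⟦ 1ℚ ⟧
    ½# = ⟦ ½ ⟧

    ring : AB.CommutativeRing _ _
    ring = record { isCommutativeRing = isCommutativeRing }
    open AB.CommutativeRing ring using (*-assoc; *-comm; *-identityˡ; *-identityʳ; +-identityˡ; +-identityʳ; zeroˡ; zeroʳ; -‿inverseʳ; +-assoc; distribʳ)

    acr : ACR.AlmostCommutativeRing _ _
    acr = ACR.fromCommutativeRing ring

    morphism : ACR.AlmostCommutativeRing.rawRing (ACR.fromCommutativeRing ℚₚ.+-*-commutativeRing) ACR.-Raw-AlmostCommutative⟶ acr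
    morphism = record
      { ⟦_⟧ = ⟦_⟧ ; +-homo = ⟦⟧-+ ; *-homo = ⟦⟧-* ; -‿homo = ⟦⟧-- ; 0-homo = refl ; 1-homo = refl }

    open RingSolver _ acr morphism (λ p q → Data.Maybe.map (cong ⟦_⟧) (dec⇒maybe (p ℚₚ.≟ q)))
      using (solve; _:+_; _:*_; _:-_; :-_; _:=_; con)

    poset : Poset _ _ _
    poset = record { isPartialOrder = isPartialOrder }
    open import Relation.Binary.Reasoning.PartialOrder poset
    open Poset poset using () renaming (refl to ≤-refl′; trans to ≤-trans′; reflexive to ≤-reflexive′)

    _⟋#_ : F → F → F
    p ⟋# q = p * rec q
    infixl 7 _⟋#_

    Cauchy# : (ℕ → F) → Set
    Cauchy# s = ∀ ε → 0# < ε → ∃[ N ] (∀ i j → N ℕ.≤ i → N ℕ.≤ j → abs (s i - s j) ≤ ε)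

    lnSum# : F → ℕ → F
    lnSum# x N = sum N (λ i → h * rec (1# + num i * h))
      where h = (x - 1#) ⟋# num N

    num-suc : ∀ n → num (suc n) ≡ 1# + num n
    num-suc n = trans (num-+ 1 n) (cong (_+ num n) num-1)

    num-mono : ∀ {a b} → a ℕ.≤ b → num a ≤ num b
    num-mono {a} {b} a≤b = subst₂ _≤_ (+-identityʳ (num a))
      (trans (sym (num-+ a (b ℕ.∸ a))) (cong num (ℕₚ.m+[n∸m]≡n a≤b)))
      (+-mono-≤′ (≤-refl′ {num a}) (num-≥0 (b ℕ.∸ a)))

    num-pos : ∀ n → 0# < num (suc n)
    num-pos n = <-≤-trans′ 0<1′ (subst (_≤ num (suc n)) num-1 (num-mono (ℕ.s≤s ℕ.z≤n)))

    num-* : ∀ a b → num (a ℕ.* b) ≡ num a * num b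
    num-* zero    b = trans num-0 (sym (trans (cong (_* num b) num-0) (zeroˡ (num b))))
    num-* (suc a) b = trans (num-+ b (a ℕ.* b)) (trans (cong (num b +_) (num-* a b))
      (trans (solve 2 (λ x y → y :+ x :* y := (con 1ℚ :+ x) :* y) refl (num a) (num b))
        (cong (_* num b) (sym (num-suc a)))))

    *-monoˡ : ∀ {a b} c → 0# ≤ c → a ≤ b → c * a ≤ c * b
    *-monoˡ {a} {b} c 0≤c a≤b = subst₂ _≤_ (*-comm a c) (*-comm b c) (*-monoʳ c 0≤c a≤b)

    mul-mono : ∀ {a b c d} → 0# ≤ a → a ≤ b → 0# ≤ c → c ≤ d → a * c ≤ b * d
    mul-mono {b = b} {c = c} 0≤a a≤b 0≤c c≤d =
      ≤-trans′ (*-monoʳ c 0≤c a≤b) (*-monoˡ b (≤-trans′ 0≤a a≤b) c≤d)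

    mul-nonneg : ∀ {a b} → 0# ≤ a → 0# ≤ b → 0# ≤ a * b
    mul-nonneg {a} {b} 0≤a 0≤b = subst (_≤ a * b) (zeroˡ 0#) (mul-mono ≤-refl′ 0≤a ≤-refl′ 0≤b)

    add-pos : ∀ {a b} → 0# < a → 0# ≤ b → 0# < a + b
    add-pos {a} {b} 0<a 0≤b = subst (_< a + b) (+-identityˡ 0#) (+-mono-<-≤′ 0<a 0≤b)

    rec-≥0 : ∀ {a} → 0# < a → 0# ≤ rec a
    rec-≥0 0<a = <⇒≤′ (rec-pos 0<a)

    rec-anti : ∀ {a b} → 0# < a → a ≤ b → rec b ≤ rec a
    rec-anti {a} {b} 0<a a≤b = subst₂ _≤_ l r
        (*-monoʳ (rec a * rec b) (mul-nonneg (rec-≥0 0<a) (rec-≥0 0<b)) a≤b)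
      where
      0<b = <-≤-trans′ 0<a a≤b
      l : a * (rec a * rec b) ≡ rec b
      l = trans (sym (*-assoc a _ _)) (trans (cong (_* rec b) (rec-inv 0<a)) (*-identityˡ _))
      r : b * (rec a * rec b) ≡ rec a
      r = trans (cong (b *_) (*-comm (rec a) (rec b)))
        (trans (sym (*-assoc b _ _)) (trans (cong (_* rec a) (rec-inv 0<b)) (*-identityˡ _)))

    rec-lipschitz : ∀ {c a b} → 0# < c → c ≤ a → c ≤ b →
      abs (rec a - rec b) ≤ abs (a - b) * (rec c * rec c)
    rec-lipschitz {c} {a} {b} 0<c c≤a c≤b = begin
      abs (rec a - rec b)                     ≡⟨ cong abs eq ⟩
      abs (- (a - b) * (rec a * rec b))       ≡⟨ abs-* (- (a - b)) _ ⟩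
      abs (- (a - b)) * abs (rec a * rec b)   ≡⟨ cong₂ _*_ (abs-neg (a - b)) (abs-id (mul-nonneg 0≤ra 0≤rb)) ⟩
      abs (a - b) * (rec a * rec b)           ≤⟨ *-monoˡ (abs (a - b)) (abs-≥0 (a - b))
                                                 (mul-mono 0≤ra (rec-anti 0<c c≤a) 0≤rb (rec-anti 0<c c≤b)) ⟩
      abs (a - b) * (rec c * rec c)           ∎
      where
      0<a = <-≤-trans′ 0<c c≤a
      0<b = <-≤-trans′ 0<c c≤b
      0≤ra = rec-≥0 0<a
      0≤rb = rec-≥0 0<b
      eq : rec a - rec b ≡ - (a - b) * (rec a * rec b)
      eq = sym (trans (solve 4 (λ a b x y → :- (a :- b) :* (x :* y) := (b :* y) :* x :- (a :* x) :* y)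
                   refl a b (rec a) (rec b))
           (cong₂ _-_ (trans (cong (_* rec a) (rec-inv 0<b)) (*-identityˡ _))
                      (trans (cong (_* rec b) (rec-inv 0<a)) (*-identityˡ _))))

    abs-comm : ∀ a b → abs (a - b) ≡ abs (b - a)
    abs-comm a b = trans (cong abs (solve 2 (λ a b → a :- b := :- (b :- a)) refl a b)) (abs-neg (b - a))

    abs-triangle : ∀ a b c → abs (a - c) ≤ abs (a - b) + abs (b - c)
    abs-triangle a b c = subst (λ z → abs z ≤ abs (a - b) + abs (b - c))
      (solve 3 (λ a b c → (a :- b) :+ (b :- c) := a :- c) refl a b c) (abs-+ (a - b) (b - c))

    sum-diff : ∀ n {f g e} → (∀ i → i ℕ.< n → abs (f i - g i) ≤ e) →
               abs (sum n f - sum n g) ≤ num n * e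
    sum-diff zero {f} {g} {e} h = ≤-reflexive′ (trans (cong abs (trans (cong₂ _-_ (sum-0 f) (sum-0 g)) (-‿inverseʳ 0#)))
      (trans (abs-id ≤-refl′) (sym (trans (cong (_* e) num-0) (zeroˡ e)))))
    sum-diff (suc n) {f} {g} {e} h = begin
      abs (sum (suc n) f - sum (suc n) g) ≡⟨ cong abs (cong₂ _-_ (sum-suc n f) (sum-suc n g)) ⟩
      abs ((sum n f + f n) - (sum n g + g n)) ≡⟨ cong abs (solve 4 (λ a b c d → (a :+ b) :- (c :+ d) := (a :- c) :+ (b :- d)) refl (sum n f) (f n) (sum n g) (g n)) ⟩
      abs ((sum n f - sum n g) + (f n - g n)) ≤⟨ abs-+ (sum n f - sum n g) (f n - g n) ⟩
      abs (sum n f - sum n g) + abs (f n - g n) ≤⟨ +-mono-≤′ (sum-diff n (λ i i<n → h i (ℕₚ.m≤n⇒m≤1+n i<n))) (h n ℕₚ.≤-refl) ⟩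
      num n * e + e                               ≡⟨ solve 2 (λ x e → x :* e :+ e := (con 1ℚ :+ x) :* e) refl (num n) e ⟩
      (1# + num n) * e                            ≡⟨ cong (_* e) (sym (num-suc n)) ⟩
      num (suc n) * e                             ∎

    sum-lower : ∀ n {f e} → (∀ i → i ℕ.< n → e ≤ f i) → num n * e ≤ sum n f
    sum-lower zero {f} {e} h = ≤-reflexive′ (trans (cong (_* e) num-0) (trans (zeroˡ e) (sym (sum-0 f))))
    sum-lower (suc n) {f} {e} h = begin
      num (suc n) * e ≡⟨ cong (_* e) (num-suc n) ⟩
      (1# + num n) * e ≡⟨ solve 2 (λ x e → (con 1ℚ :+ x) :* e := x :* e :+ e) refl (num n) e ⟩
      num n * e + e ≤⟨ +-mono-≤′ (sum-lower n (λ i i<n → h i (ℕₚ.m≤n⇒m≤1+n i<n))) (h n ℕₚ.≤-refl) ⟩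
      sum n f + f n ≡⟨ sym (sum-suc n f) ⟩
      sum (suc n) f ∎

    sum-const : ∀ n e → sum n (λ _ → e) ≡ num n * e
    sum-const zero e = trans (sum-0 _) (sym (trans (cong (_* e) num-0) (zeroˡ e)))
    sum-const (suc n) e = trans (sum-suc n _) (trans (cong (_+ e) (sum-const n e))
      (trans (solve 2 (λ x e → x :* e :+ e := (con 1ℚ :+ x) :* e) refl (num n) e) (cong (_* e) (sym (num-suc n)))))

    sum-split : ∀ a b f → sum (a ℕ.+ b) f ≡ sum a f + sum b (λ j → f (a ℕ.+ j))
    sum-split a zero f = trans (cong (λ k → sum k f) (ℕₚ.+-identityʳ a)) (sym (trans (cong (sum a f +_) (sum-0 _)) (+-identityʳ _)))
    sum-split a (suc b) f = trans (cong (λ k → sum k f) (ℕₚ.+-suc a b)) (trans (sum-suc (a ℕ.+ b) f)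
      (trans (cong (_+ f (a ℕ.+ b)) (sum-split a b f)) (trans (+-assoc (sum a f) _ _) (cong (sum a f +_) (sym (sum-suc b _))))))

    sum-blocks : ∀ n M f → sum (n ℕ.* M) f ≡ sum n (λ i → sum M (λ j → f (i ℕ.* M ℕ.+ j)))
    sum-blocks zero M f = trans (sum-0 f) (sym (sum-0 _))
    sum-blocks (suc n) M f = trans (cong (λ k → sum k f) (ℕₚ.+-comm M (n ℕ.* M)))
      (trans (sum-split (n ℕ.* M) M f) (trans (cong (_+ sum M (λ j → f (n ℕ.* M ℕ.+ j))) (sum-blocks n M f))
        (sym (sum-suc n _))))

    const-cauchy : ∀ q → Cauchy# (λ _ → q)
    const-cauchy q ε 0<ε = 0 , λ _ _ _ _ → ≤-trans′ (≤-reflexive′ (trans (cong abs (-‿inverseʳ q)) (abs-id ≤-refl′))) (<⇒≤′ 0<ε)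

    bounded : ∀ s → Cauchy# s → ∃[ B ] (0# < B × ∃[ N ] (∀ i → N ℕ.≤ i → abs (s i) ≤ B))
    bounded s cs with cs 1# 0<1′
    ... | N , h = 1# + abs (s N) , add-pos 0<1′ (abs-≥0 _) , N , λ i N≤i →
      ≤-trans′ (subst (λ z → abs z ≤ abs (s i - s N) + abs (s N))
                (solve 2 (λ a b → (a :- b) :+ b := a) refl (s i) (s N))
                (abs-+ (s i - s N) (s N)))
        (+-mono-≤′ (h i N N≤i ℕₚ.≤-refl) ≤-refl′)

    *-cauchy : ∀ s t → Cauchy# s → Cauchy# t → Cauchy# (λ i → s i * t i)
    *-cauchy s t cs ct ε 0<ε = N , main
      where
      A B : F
      A = proj₁ (bounded s cs)
      B = proj₁ (bounded t ct)
      0<A = proj₁ (proj₂ (bounded s cs))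
      0<B = proj₁ (proj₂ (bounded t ct))
      Nx = proj₁ (proj₂ (proj₂ (bounded s cs)))
      Ny = proj₁ (proj₂ (proj₂ (bounded t ct)))
      hx = proj₂ (proj₂ (proj₂ (bounded s cs)))
      hy = proj₂ (proj₂ (proj₂ (bounded t ct)))
      share : ∀ C → 0# < C → 0# < ε * (½# * rec C)
      share C 0<C = mul-pos 0<ε (mul-pos 0<½ (rec-pos 0<C))
      Mx = proj₁ (cs (ε * (½# * rec B)) (share B 0<B))
      My = proj₁ (ct (ε * (½# * rec A)) (share A 0<A))
      cx = proj₂ (cs (ε * (½# * rec B)) (share B 0<B))
      cy = proj₂ (ct (ε * (½# * rec A)) (share A 0<A))
      N = (Nx ℕ.⊔ Ny) ℕ.⊔ (Mx ℕ.⊔ My)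
      lem : ∀ C → 0# < C → C * (ε * (½# * rec C)) ≡ ε * ½#
      lem C 0<C = trans (solve 4 (λ c e h r → c :* (e :* (h :* r)) := (e :* h) :* (c :* r)) refl C ε ½# (rec C))
        (trans (cong ((ε * ½#) *_) (rec-inv 0<C)) (*-identityʳ _))
      main : ∀ i j → N ℕ.≤ i → N ℕ.≤ j → abs (s i * t i - s j * t j) ≤ ε
      main i j N≤i N≤j = begin
        abs (x₁ * y₁ - x₂ * y₂) ≡⟨ cong abs (solve 4 (λ a b c d → a :* b :- c :* d := a :* (b :- d) :+ d :* (a :- c)) refl x₁ y₁ x₂ y₂) ⟩
        abs (x₁ * (y₁ - y₂) + y₂ * (x₁ - x₂)) ≤⟨ abs-+ (x₁ * (y₁ - y₂)) (y₂ * (x₁ - x₂)) ⟩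
        abs (x₁ * (y₁ - y₂)) + abs (y₂ * (x₁ - x₂)) ≡⟨ cong₂ _+_ (abs-* x₁ (y₁ - y₂)) (abs-* y₂ (x₁ - x₂)) ⟩
        abs x₁ * abs (y₁ - y₂) + abs y₂ * abs (x₁ - x₂)
          ≤⟨ +-mono-≤′ (mul-mono (abs-≥0 x₁) (hx i (ℕₚ.≤-trans a N≤i)) (abs-≥0 (y₁ - y₂)) (cy i j (ℕₚ.≤-trans d N≤i) (ℕₚ.≤-trans d N≤j)))
                      (mul-mono (abs-≥0 y₂) (hy j (ℕₚ.≤-trans b N≤j)) (abs-≥0 (x₁ - x₂)) (cx i j (ℕₚ.≤-trans c N≤i) (ℕₚ.≤-trans c N≤j))) ⟩
        A * (ε * (½# * rec A)) + B * (ε * (½# * rec B)) ≡⟨ cong₂ _+_ (lem A 0<A) (lem B 0<B) ⟩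
        ε * ½# + ε * ½# ≡⟨ solve 2 (λ e h → e :* h :+ e :* h := e :* (h :+ h)) refl ε ½# ⟩
        ε * (½# + ½#) ≡⟨ cong (ε *_) (sym (⟦⟧-+ ½ ½)) ⟩
        ε * 1# ≡⟨ *-identityʳ ε ⟩
        ε ∎
        where
        x₁ = s i
        x₂ = s j
        y₁ = t i
        y₂ = t j
        a : Nx ℕ.≤ N
        a = ℕₚ.≤-trans (ℕₚ.m≤m⊔n Nx Ny) (ℕₚ.m≤m⊔n _ _)
        b : Ny ℕ.≤ N
        b = ℕₚ.≤-trans (ℕₚ.m≤n⊔m Nx Ny) (ℕₚ.m≤m⊔n _ _)
        c : Mx ℕ.≤ N
        c = ℕₚ.≤-trans (ℕₚ.m≤m⊔n Mx My) (ℕₚ.m≤n⊔m (Nx ℕ.⊔ Ny) _)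
        d : My ℕ.≤ N
        d = ℕₚ.≤-trans (ℕₚ.m≤n⊔m Mx My) (ℕₚ.m≤n⊔m (Nx ℕ.⊔ Ny) _)

    rec-cauchy : ∀ s c N → Cauchy# s → 0# < c → (∀ i → N ℕ.≤ i → 0# + c ≤ s i) → Cauchy# (λ i → rec (s i))
    rec-cauchy s c N cs 0<c h ε 0<ε with cs (ε * (c * c)) (mul-pos 0<ε (mul-pos 0<c 0<c))
    ... | M , k = N ℕ.⊔ M , λ i j N≤i N≤j → begin
        abs (rec (s i) - rec (s j))
          ≤⟨ rec-lipschitz 0<c (low i (ℕₚ.≤-trans (ℕₚ.m≤m⊔n N M) N≤i)) (low j (ℕₚ.≤-trans (ℕₚ.m≤m⊔n N M) N≤j)) ⟩
        abs (s i - s j) * (rec c * rec c)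
          ≤⟨ *-monoʳ (rec c * rec c) (mul-nonneg (rec-≥0 0<c) (rec-≥0 0<c))
              (k i j (ℕₚ.≤-trans (ℕₚ.m≤n⊔m N M) N≤i) (ℕₚ.≤-trans (ℕₚ.m≤n⊔m N M) N≤j)) ⟩
        (ε * (c * c)) * (rec c * rec c)
          ≡⟨ solve 3 (λ e c r → (e :* (c :* c)) :* (r :* r) := e :* ((c :* r) :* (c :* r))) refl ε c (rec c) ⟩
        ε * ((c * rec c) * (c * rec c)) ≡⟨ cong (λ z → ε * (z * z)) (rec-inv 0<c) ⟩
        ε * (1# * 1#) ≡⟨ solve 1 (λ e → e :* (con 1ℚ :* con 1ℚ) := e) refl ε ⟩
        ε ∎
      where
      low : ∀ i → N ℕ.≤ i → c ≤ s i
      low i N≤i = subst (_≤ s i) (+-identityˡ c) (h i N≤i)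

    *-pos : ∀ (s t : ℕ → F) a b N M → 0# < a → 0# < b →
      (∀ i → N ℕ.≤ i → 0# + a ≤ s i) → (∀ i → M ℕ.≤ i → 0# + b ≤ t i) →
      ∀ i → N ℕ.⊔ M ℕ.≤ i → 0# + a * b ≤ s i * t i
    *-pos s t a b N M 0<a 0<b h k i NM≤i = subst (_≤ s i * t i) (sym (+-identityˡ (a * b)))
        (mul-mono (<⇒≤′ 0<a) (subst (_≤ s i) (+-identityˡ a) (h i (ℕₚ.≤-trans (ℕₚ.m≤m⊔n N M) NM≤i)))
                  (<⇒≤′ 0<b) (subst (_≤ t i) (+-identityˡ b) (k i (ℕₚ.≤-trans (ℕₚ.m≤n⊔m N M) NM≤i))))

    0≤b-a : ∀ {a b} → a ≤ b → 0# ≤ b - a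
    0≤b-a {a} {b} a≤b = subst (_≤ b - a) (-‿inverseʳ a) (+-mono-≤′ a≤b ≤-refl′)

    frac : ∀ {k N} → k ℕ.≤ suc N → 0# ≤ num k ⟋# num (suc N) × num k ⟋# num (suc N) ≤ 1#
    frac {k} {N} k≤N = mul-nonneg (num-≥0 k) r ,
        ≤-trans′ (*-monoʳ (rec (num (suc N))) r (num-mono k≤N)) (≤-reflexive′ (rec-inv (num-pos N)))
        where r = rec-≥0 (num-pos N)

    point : ∀ x k N → 1# + num k * ((x - 1#) ⟋# num (suc N)) ≡ (1# - num k ⟋# num (suc N)) * 1# + (num k ⟋# num (suc N)) * x
    point x k N = solve 3 (λ x k r → con 1ℚ :+ k :* ((x :- con 1ℚ) :* r) := (con 1ℚ :- k :* r) :* con 1ℚ :+ (k :* r) :* x)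
        refl x (num k) (rec (num (suc N)))

    point-lower : ∀ {x c k N} → k ℕ.≤ suc N → c ≤ 1# → c ≤ x → c ≤ 1# + num k * ((x - 1#) ⟋# num (suc N))
    point-lower {x} {c} {k} {N} k≤N c≤1 c≤x = begin
        c ≡⟨ solve 2 (λ c t → c := (con 1ℚ :- t) :* c :+ t :* c) refl c t ⟩
        (1# - t) * c + t * c ≤⟨ +-mono-≤′ (*-monoˡ (1# - t) (0≤b-a (proj₂ (frac k≤N))) c≤1)
                                         (*-monoˡ t (proj₁ (frac k≤N)) c≤x) ⟩
        (1# - t) * 1# + t * x ≡⟨ sym (point x k N) ⟩
        1# + num k * ((x - 1#) ⟋# num (suc N)) ∎
        where
        t = num k ⟋# num (suc N)

    point-upper : ∀ {x k N} → k ℕ.≤ suc N → 1# ≤ x → 1# + num k * ((x - 1#) ⟋# num (suc N)) ≤ x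
    point-upper {x} {k} {N} k≤N 1≤x = begin
        1# + num k * ((x - 1#) ⟋# num (suc N)) ≡⟨ point x k N ⟩
        (1# - t) * 1# + t * x ≤⟨ +-mono-≤′ (*-monoˡ (1# - t) (0≤b-a (proj₂ (frac k≤N))) 1≤x) ≤-refl′ ⟩
        (1# - t) * x + t * x ≡⟨ solve 2 (λ x t → (con 1ℚ :- t) :* x :+ t :* x := x) refl x t ⟩
        x ∎
        where
        t = num k ⟋# num (suc N)

    module Refine (x c : F) (0<c : 0# < c) (c≤1 : c ≤ 1#) (c≤x : c ≤ x) where
      K D E : F
      K = rec c * rec c
      D = abs (x - 1#)
      E = D * (D * K)

      0≤K : 0# ≤ K
      0≤K = mul-nonneg (rec-≥0 0<c) (rec-≥0 0<c)

      0≤E : 0# ≤ E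
      0≤E = mul-nonneg (abs-≥0 _) (mul-nonneg (abs-≥0 _) 0≤K)

      refine : ∀ N M → abs (lnSum# x (suc N) - lnSum# x (suc N ℕ.* suc M)) ≤ E ⟋# num (suc N)
      refine N M = subst (λ z → abs (lnSum# x (suc N) - z) ≤ E ⟋# num (suc N)) (sym (sum-blocks (suc N) (suc M) g))
          (≤-trans′ (sum-diff (suc N) block) (≤-reflexive′ final))
        where
        L = M ℕ.+ N ℕ.* suc M
        n = num (suc N)
        m = num (suc M)
        rL = rec (num (suc L))
        h = (x - 1#) ⟋# n
        h' = (x - 1#) ⟋# num (suc L)
        f g : ℕ → F
        f i = h * rec (1# + num i * h)
        g k = h' * rec (1# + num k * h')
        mh' : m * h' ≡ h
        mh' = begin-equality
          m * ((x - 1#) * rL) ≡⟨ solve 3 (λ m y r → m :* (y :* r) := y :* (m :* r) :* con 1ℚ) refl m (x - 1#) rL ⟩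
          (x - 1#) * (m * rL) * 1# ≡⟨ cong ((x - 1#) * (m * rL) *_) (sym (rec-inv (num-pos N))) ⟩
          (x - 1#) * (m * rL) * (n * rec n) ≡⟨ solve 5 (λ y m r n s → y :* (m :* r) :* (n :* s) := (y :* s) :* ((n :* m) :* r)) refl (x - 1#) m rL n (rec n) ⟩
          h * ((n * m) * rL) ≡⟨ cong (λ z → h * (z * rL)) (sym (num-* (suc N) (suc M))) ⟩
          h * (num (suc L) * rL) ≡⟨ cong (h *_) (rec-inv (num-pos L)) ⟩
          h * 1# ≡⟨ *-identityʳ h ⟩
          h ∎
        absh : m * abs h' ≡ abs h
        absh = trans (cong (_* abs h') (sym (abs-id (num-≥0 (suc M))))) (trans (sym (abs-* m h')) (cong abs mh'))
        absh≡ : abs h ≡ D ⟋# n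
        absh≡ = trans (abs-* (x - 1#) (rec n)) (cong (D *_) (abs-id (rec-≥0 (num-pos N))))
        e : F
        e = abs h * (abs h * K)
        term : ∀ i → i ℕ.< suc N → ∀ j → j ℕ.< suc M →
          abs (h' * rec (1# + num i * h) - g (i ℕ.* suc M ℕ.+ j)) ≤ abs h' * (abs h * K)
        term i i<N j j<M = begin
          abs (h' * ra - h' * rb) ≡⟨ cong abs (solve 3 (λ h a b → h :* a :- h :* b := h :* (a :- b)) refl h' ra rb) ⟩
          abs (h' * (ra - rb)) ≡⟨ abs-* h' (ra - rb) ⟩
          abs h' * abs (ra - rb) ≤⟨ *-monoˡ (abs h') (abs-≥0 h') (≤-trans′ (rec-lipschitz 0<c lowa lowb)
                                  (*-monoʳ K 0≤K ab)) ⟩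
          abs h' * (abs h * K) ∎
          where
          k = i ℕ.* suc M ℕ.+ j
          a = 1# + num i * h
          b = 1# + num k * h'
          ra = rec a
          rb = rec b
          k≤L : k ℕ.≤ suc L
          k≤L = ℕₚ.≤-trans (ℕₚ.+-monoʳ-≤ (i ℕ.* suc M) (ℕₚ.<⇒≤ j<M))
            (ℕₚ.≤-trans (ℕₚ.≤-reflexive (ℕₚ.+-comm (i ℕ.* suc M) (suc M))) (ℕₚ.*-monoˡ-≤ (suc M) i<N))
          lowa : c ≤ a
          lowa = point-lower (ℕₚ.<⇒≤ i<N) c≤1 c≤x
          lowb : c ≤ b
          lowb = point-lower k≤L c≤1 c≤x
          num-k : num k * h' ≡ num i * h + num j * h'
          num-k = trans (cong (_* h') (trans (num-+ (i ℕ.* suc M) j) (cong (_+ num j) (num-* i (suc M)))))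
            (trans (solve 4 (λ i m j h → (i :* m :+ j) :* h := i :* (m :* h) :+ j :* h) refl (num i) m (num j) h')
              (cong (λ z → num i * z + num j * h') mh'))
          ab : abs (a - b) ≤ abs h
          ab = begin
            abs (a - b) ≡⟨ abs-comm a b ⟩
            abs (b - a) ≡⟨ cong (λ z → abs ((1# + z) - a)) num-k ⟩
            abs ((1# + (num i * h + num j * h')) - (1# + num i * h)) ≡⟨ cong abs (solve 2 (λ p q → (con 1ℚ :+ (p :+ q)) :- (con 1ℚ :+ p) := q) refl (num i * h) (num j * h')) ⟩
            abs (num j * h') ≡⟨ abs-* (num j) h' ⟩
            abs (num j) * abs h' ≡⟨ cong (_* abs h') (abs-id (num-≥0 j)) ⟩
            num j * abs h' ≤⟨ *-monoʳ (abs h') (abs-≥0 h') (num-mono (ℕₚ.<⇒≤ j<M)) ⟩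
            m * abs h' ≡⟨ absh ⟩
            abs h ∎
        block : ∀ i → i ℕ.< suc N → abs (f i - sum (suc M) (λ j → g (i ℕ.* suc M ℕ.+ j))) ≤ e
        block i i<N = begin
          abs (f i - G) ≡⟨ cong (λ z → abs (z - G)) fi ⟩
          abs (sum (suc M) (λ _ → h' * ra) - G) ≤⟨ sum-diff (suc M) (term i i<N) ⟩
          m * (abs h' * (abs h * K)) ≡⟨ sym (*-assoc m (abs h') (abs h * K)) ⟩
          (m * abs h') * (abs h * K) ≡⟨ cong (_* (abs h * K)) absh ⟩
          e ∎
          where
          G = sum (suc M) (λ j → g (i ℕ.* suc M ℕ.+ j))
          ra = rec (1# + num i * h)
          fi : f i ≡ sum (suc M) (λ _ → h' * ra)
          fi = trans (cong (_* ra) (sym mh')) (trans (*-assoc m h' ra) (sym (sum-const (suc M) (h' * ra))))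
        final : n * e ≡ E ⟋# n
        final = trans (cong (λ z → n * (z * (z * K))) absh≡)
          (trans (solve 4 (λ n d r k → n :* ((d :* r) :* ((d :* r) :* k)) := (d :* (d :* k) :* r) :* (n :* r)) refl n D (rec n) K)
            (trans (cong ((D * (D * K) * rec n) *_) (rec-inv (num-pos N))) (*-identityʳ _)))

      lnSum-cauchy : Cauchy# (λ i → lnSum# x (suc i))
      lnSum-cauchy ε 0<ε with archimedean ((E + E) ⟋# ε)
      ... | N , hN = N , λ i j N≤i N≤j → begin
          abs (S (suc i) - S (suc j))
            ≤⟨ abs-triangle _ (S (suc i ℕ.* suc j)) _ ⟩
          abs (S (suc i) - S (suc i ℕ.* suc j)) + abs (S (suc i ℕ.* suc j) - S (suc j))
            ≡⟨ cong (abs (S (suc i) - S (suc i ℕ.* suc j)) +_)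
                 (trans (abs-comm _ (S (suc j))) (cong (λ k → abs (S (suc j) - S k)) (ℕₚ.*-comm (suc i) (suc j)))) ⟩
          abs (S (suc i) - S (suc i ℕ.* suc j)) + abs (S (suc j) - S (suc j ℕ.* suc i))
            ≤⟨ +-mono-≤′ (≤-trans′ (refine i j) (shrink i N≤i)) (≤-trans′ (refine j i) (shrink j N≤j)) ⟩
          E ⟋# s + E ⟋# s ≡⟨ sym (distribʳ (rec s) E E) ⟩
          (E + E) ⟋# s ≡⟨ cong (_⟋# s) (sym EE) ⟩
          ((E + E) ⟋# ε * ε) ⟋# s ≤⟨ *-monoʳ (rec s) (rec-≥0 (num-pos N))
                                   (*-monoʳ ε (<⇒≤′ 0<ε) (≤-trans′ hN (num-mono (ℕₚ.n≤1+n N)))) ⟩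
          (s * ε) ⟋# s ≡⟨ solve 3 (λ s e r → (s :* e) :* r := e :* (s :* r)) refl s ε (rec s) ⟩
          ε * (s ⟋# s) ≡⟨ cong (ε *_) (rec-inv (num-pos N)) ⟩
          ε * 1# ≡⟨ *-identityʳ ε ⟩
          ε ∎
        where
        S = lnSum# x
        s = num (suc N)
        shrink : ∀ i → N ℕ.≤ i → E ⟋# num (suc i) ≤ E ⟋# s
        shrink i N≤i = *-monoˡ E 0≤E (rec-anti (num-pos N) (num-mono (ℕ.s≤s N≤i)))
        EE : (E + E) ⟋# ε * ε ≡ E + E
        EE = trans (*-assoc (E + E) (rec ε) ε) (trans (cong ((E + E) *_) (trans (*-comm (rec ε) ε) (rec-inv 0<ε))) (*-identityʳ _))

    ln-lower : ∀ {x} → 1# < x → ∀ N → 0# + (x - 1#) ⟋# x ≤ lnSum# x (suc N)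
    ln-lower {x} 1<x N = begin
        0# + (x - 1#) * rec x ≡⟨ +-identityˡ _ ⟩
        (x - 1#) * rec x ≡⟨ sym (*-identityʳ _) ⟩
        (x - 1#) * rec x * 1# ≡⟨ cong ((x - 1#) * rec x *_) (sym (rec-inv (num-pos N))) ⟩
        (x - 1#) * rec x * (num (suc N) * rec (num (suc N)))
          ≡⟨ solve 4 (λ y r n s → (y :* r) :* (n :* s) := n :* ((y :* s) :* r)) refl (x - 1#) (rec x) (num (suc N)) (rec (num (suc N))) ⟩
        num (suc N) * (h * rec x)
          ≤⟨ sum-lower (suc N) (λ i i<N → *-monoˡ h (mul-nonneg (0≤b-a 1≤x) (rec-≥0 (num-pos N)))
               (rec-anti (<-≤-trans′ 0<1′ (point-lower (ℕₚ.<⇒≤ i<N) ≤-refl′ 1≤x)) (point-upper (ℕₚ.<⇒≤ i<N) 1≤x))) ⟩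
        lnSum# x (suc N) ∎
      where
      h = (x - 1#) ⟋# num (suc N)
      1≤x = <⇒≤′ 1<x

    ln-lower-pos : ∀ {x} → 1# < x → 0# < (x - 1#) ⟋# x
    ln-lower-pos {x} 1<x = mul-pos (subst (_< x - 1#) (-‿inverseʳ 1#) (+-mono-<-≤′ 1<x ≤-refl′))
      (rec-pos (<-≤-trans′ 0<1′ (<⇒≤′ 1<x)))

module Reals where

  open import Data.Integer as ℤ using (ℤ)
  import Data.Integer.Properties as ℤₚ
  open import Data.Rational hiding (_÷_)
  open import Data.Rational.Properties
  import Data.Rational.Unnormalised as ℚᵘ
  import Data.Rational.Unnormalised.Properties as ℚᵘₚ

  ι : ℕ → ℚ
  ι n = ℤ.+ n / 1

  -- Total inverse and division, with 0 ⁻¹ = 0.  The divisors are positive in lnSum for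
  -- 0 < x and for all but finitely many terms of a quotient of reals.
  infix 9 _⁻¹
  _⁻¹ : ℚ → ℚ
  p ⁻¹ with p ≟ 0ℚ
  ... | yes _  = 0ℚ
  ... | no p≢0 = 1/_ p {{≢-nonZero p≢0}}

  infixl 7 _÷_
  _÷_ : ℚ → ℚ → ℚ
  p ÷ q = p * q ⁻¹

  sumTo : ℕ → (ℕ → ℚ) → ℚ
  sumTo zero    f = 0ℚ
  sumTo (suc n) f = sumTo n f + f n

  Eventually : (ℕ → Set) → Set
  Eventually P = ∃[ N ] (∀ i → N ℕ.≤ i → P i)

  Cauchy : (ℕ → ℚ) → Set
  Cauchy s = ∀ ε → 0ℚ < ε → ∃[ N ] (∀ i j → N ℕ.≤ i → N ℕ.≤ j → ∣ s i - s j ∣ ≤ ε)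

  -- Reals as Cauchy sequences of rationals; two reals are identified when each is ≤ℝ the other.
  record ℝ : Set where
    constructor mkℝ
    field
      seq    : ℕ → ℚ
      cauchy : Cauchy seq
  open ℝ public

  infix 4 _≤ℝ_ _<ℝ_
  _≤ℝ_ _<ℝ_ : ℝ → ℝ → Set
  x ≤ℝ y = ∀ ε → 0ℚ < ε → Eventually (λ i → seq x i ≤ seq y i + ε)
  x <ℝ y = ∃[ ε ] (0ℚ < ε × Eventually (λ i → seq x i + ε ≤ seq y i))

  -- The left Riemann sum of ∫₁ˣ dt/t over N subintervals of equal (signed) length h.
  lnSum : ℚ → ℕ → ℚ
  lnSum x N = sumTo N (λ i → h ÷ (1ℚ + ι i * h))
    where h = (x - 1ℚ) ÷ ι N

  abstract
    ι-+ : ∀ a b → ι (a ℕ.+ b) ≡ ι a + ι b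
    ι-+ a b = toℚᵘ-injective (ℚᵘₚ.≃-trans (toℚᵘ-fromℚᵘ (ℚᵘ.mkℚᵘ (ℤ.+ (a ℕ.+ b)) 0))
       (ℚᵘₚ.≃-sym (ℚᵘₚ.≃-trans (toℚᵘ-homo-+ (ι a) (ι b))
         (ℚᵘₚ.≃-trans (ℚᵘₚ.+-cong (toℚᵘ-fromℚᵘ (ℚᵘ.mkℚᵘ (ℤ.+ a) 0)) (toℚᵘ-fromℚᵘ (ℚᵘ.mkℚᵘ (ℤ.+ b) 0)))
           (ℚᵘ.*≡* (cong (ℤ._* (ℤ.+ 1)) (cong₂ ℤ._+_ (ℤₚ.*-identityʳ (ℤ.+ a)) (ℤₚ.*-identityʳ (ℤ.+ b)))))))))

    archimedean : ∀ q → ∃[ N ] (q ≤ ι N)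
    archimedean q = ℤ.∣ ↥ q ∣ , toℚᵘ-cancel-≤ (ℚᵘₚ.≤-trans (lem q)
        (ℚᵘₚ.≤-reflexive (ℚᵘₚ.≃-sym (toℚᵘ-fromℚᵘ (ℚᵘ.mkℚᵘ (ℤ.+ ℤ.∣ ↥ q ∣) 0)))))
      where
      lem : ∀ q → toℚᵘ q ℚᵘ.≤ ℚᵘ.mkℚᵘ (ℤ.+ ℤ.∣ ↥ q ∣) 0
      lem (mkℚ (ℤ.+ n) d _) = ℚᵘ.*≤* (subst₂ ℤ._≤_ (sym (ℤₚ.*-identityʳ (ℤ.+ n))) (ℤₚ.pos-* n (suc d))
        (ℤ.+≤+ (ℕₚ.m≤m*n n (suc d))))
      lem (mkℚ (ℤ.-[1+ n ]) d _) = ℚᵘ.*≤* (ℤ.-≤+)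

    ⁻¹-inverse : ∀ {a} → 0ℚ < a → a * a ⁻¹ ≡ 1ℚ
    ⁻¹-inverse {a} 0<a with a ≟ 0ℚ
    ... | yes a≡0 = contradiction (sym a≡0) (<⇒≢ 0<a)
    ... | no a≢0  = *-inverseʳ a {{≢-nonZero a≢0}}

    ⁻¹-pos : ∀ {a} → 0ℚ < a → 0ℚ < a ⁻¹
    ⁻¹-pos {a} 0<a with a ≟ 0ℚ
    ... | yes a≡0 = contradiction (sym a≡0) (<⇒≢ 0<a)
    ... | no a≢0  = positive⁻¹ _ {{1/pos⇒pos a {{positive 0<a}}}}

    0<1 : 0ℚ < 1ℚ
    0<1 = positive⁻¹ 1ℚ
    0<½ : 0ℚ < ½
    0<½ = positive⁻¹ ½
    0≤ι : ∀ n → 0ℚ ≤ ι n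
    0≤ι n = nonNegative⁻¹ (ι n) {{normalize-nonNeg n 1}}
    *-monoʳ-≤ : ∀ {a b} c → 0ℚ ≤ c → a ≤ b → a * c ≤ b * c
    *-monoʳ-≤ c 0≤c a≤b = *-monoʳ-≤-nonNeg c {{nonNegative 0≤c}} a≤b
    mul-pos : ∀ {a b} → 0ℚ < a → 0ℚ < b → 0ℚ < a * b
    mul-pos {a} {b} 0<a 0<b = positive⁻¹ (a * b) {{pos*pos⇒pos a {{positive 0<a}} b {{positive 0<b}}}}

  laws : OrderedField.Laws (OrderedField.mkOps ℚ _+_ _*_ -_ _⁻¹ ∣_∣ _≤_ _<_ ι (λ q → q) sumTo)
  laws = record
      { isCommutativeRing = +-*-isCommutativeRing
      ; ⟦⟧-+ = λ _ _ → refl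
      ; ⟦⟧-* = λ _ _ → refl
      ; ⟦⟧-- = λ _ → refl
      ; isPartialOrder = ≤-isPartialOrder
      ; <⇒≤′ = <⇒≤
      ; <-≤-trans′ = <-≤-trans
      ; 0<½ = 0<½
      ; 0<1′ = 0<1
      ; +-mono-≤′ = +-mono-≤
      ; +-mono-<-≤′ = +-mono-<-≤
      ; *-monoʳ = *-monoʳ-≤
      ; mul-pos = mul-pos
      ; rec-inv = ⁻¹-inverse
      ; rec-pos = ⁻¹-pos
      ; abs-+ = ∣p+q∣≤∣p∣+∣q∣
      ; abs-* = ∣p*q∣≡∣p∣*∣q∣
      ; abs-neg = ∣-p∣≡∣p∣
      ; abs-≥0 = 0≤∣p∣
      ; abs-id = 0≤p⇒∣p∣≡p
      ; num-0 = refl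
      ; num-+ = ι-+
      ; num-1 = refl
      ; num-≥0 = 0≤ι
      ; archimedean = archimedean
      ; sum-0 = λ _ → refl
      ; sum-suc = λ _ _ → refl
      }

  module ℚ-Facts = OrderedField.Generic (OrderedField.mkOps ℚ _+_ _*_ -_ _⁻¹ ∣_∣ _≤_ _<_ ι (λ q → q) sumTo) laws

  abstract
    const-cauchy : ∀ q → Cauchy (λ _ → q)
    const-cauchy = ℚ-Facts.const-cauchy

    *-cauchy : ∀ x y → Cauchy (λ i → seq x i * seq y i)
    *-cauchy x y = ℚ-Facts.*-cauchy (seq x) (seq y) (cauchy x) (cauchy y)

    ⁻¹-cauchy : ∀ y → (∃[ ε ] (0ℚ < ε × Eventually (λ i → 0ℚ + ε ≤ seq y i))) → Cauchy (λ i → seq y i ⁻¹)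
    ⁻¹-cauchy y (ε , 0<ε , N , h) = ℚ-Facts.rec-cauchy (seq y) ε N (cauchy y) 0<ε h

    lnSum-cauchy : ∀ x → 0ℚ < x → Cauchy (λ i → lnSum x (suc i))
    lnSum-cauchy x 0<x =
      [ (λ 1≤x → ℚ-Facts.Refine.lnSum-cauchy x 1ℚ 0<1 ≤-refl 1≤x)
      , (λ x≤1 → ℚ-Facts.Refine.lnSum-cauchy x x 0<x x≤1 ≤-refl) ]′ (≤-total 1ℚ x)

  fromℚ : ℚ → ℝ
  fromℚ q = mkℝ (λ _ → q) (const-cauchy q)

  fromℕ : ℕ → ℝ
  fromℕ n = fromℚ (ι n)

  0ℝ : ℝ
  0ℝ = fromℚ 0ℚ

  infixl 7 _*ℝ_ _/ℝ_[_]
  infix 8 _²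
  _*ℝ_ : ℝ → ℝ → ℝ
  x *ℝ y = mkℝ (λ i → seq x i * seq y i) (*-cauchy x y)

  _² : ℝ → ℝ
  x ² = x *ℝ x

  _/ℝ_[_] : (x y : ℝ) → 0ℝ <ℝ y → ℝ
  x /ℝ y [ 0<y ] = x *ℝ mkℝ (λ i → seq y i ⁻¹) (⁻¹-cauchy y 0<y)

  ln : (x : ℚ) → .(0ℚ < x) → ℝ
  ln x 0<x = mkℝ (λ i → lnSum x (suc i)) (lnSum-cauchy x (recompute (0ℚ <? x) 0<x))

  abstract
    *ℝ-pos : ∀ {x y} → 0ℝ <ℝ x → 0ℝ <ℝ y → 0ℝ <ℝ x *ℝ y
    *ℝ-pos {x} {y} (a , 0<a , N , h) (b , 0<b , M , k) =
      a * b , mul-pos 0<a 0<b , N ℕ.⊔ M , ℚ-Facts.*-pos (seq x) (seq y) a b N M 0<a 0<b h k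

    ln-pos : ∀ {x} .(0<x : 0ℚ < x) → 1ℚ < x → 0ℝ <ℝ ln x 0<x
    ln-pos {x} 0<x 1<x = (x - 1ℚ) ÷ x , ℚ-Facts.ln-lower-pos 1<x , 0 , λ i _ → ℚ-Facts.ln-lower 1<x i

    0<x≤n⇒0<n : ∀ x n → 0ℝ <ℝ x → x ≤ℝ fromℕ n → 0 ℕ.< n
    0<x≤n⇒0<n x (suc n) _ _ = ℕ.z<s
    0<x≤n⇒0<n x zero (ε , 0<ε , N , h) x≤0 =
      let η , 0<η , η<ε = <-dense 0<ε
          M , k = x≤0 η 0<η
          i = N ℕ.⊔ M
          le : 0ℚ + ε ≤ 0ℚ + η
          le = ≤-trans (h i (ℕₚ.m≤m⊔n N M)) (k i (ℕₚ.m≤n⊔m N M))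
      in contradiction (<-≤-trans η<ε (subst₂ _≤_ (+-identityˡ ε) (+-identityˡ η) le)) (<-irrefl refl)

    ι-pos : ∀ {n} → 0 ℕ.< n → 0ℚ < ι n
    ι-pos {suc n} _ = ℚ-Facts.num-pos n

    ι-mono-< : ∀ {a b} → a ℕ.< b → ι a < ι b
    ι-mono-< {a} {b} a<b = <-≤-trans
      (subst₂ _<_ (+-identityˡ (ι a)) (sym (ι-+ 1 a)) (+-monoˡ-< (ι a) 0<1)) (ℚ-Facts.num-mono a<b)

  module Density {n m : ℕ} (0<n : 0 ℕ.< n) (2n≤m : 2 ℕ.* n ℕ.≤ m) where
    abstract
      n≤m : n ℕ.≤ m
      n≤m = ℕₚ.≤-trans (ℕₚ.m≤m+n n (n ℕ.+ 0)) 2n≤m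

      n<m : n ℕ.< m
      n<m = ℕₚ.<-≤-trans (ℕₚ.m<m+n n (ℕₚ.<-≤-trans 0<n (ℕₚ.m≤m+n n 0))) 2n≤m

      0<m⁻¹ : 0ℚ < ι m ⁻¹
      0<m⁻¹ = ⁻¹-pos (ι-pos (ℕₚ.<-≤-trans 0<n n≤m))

      0<δ : 0ℚ < ι n ÷ ι m
      0<δ = mul-pos (ι-pos 0<n) 0<m⁻¹

      0<δ⁻¹ : 0ℚ < (ι n ÷ ι m) ⁻¹
      0<δ⁻¹ = ⁻¹-pos 0<δ

      δ<1 : ι n ÷ ι m < 1ℚ
      δ<1 = subst (ι n ÷ ι m <_) (⁻¹-inverse (ι-pos (ℕₚ.<-≤-trans 0<n n≤m)))
        (*-monoˡ-<-pos (ι m ⁻¹) {{positive 0<m⁻¹}} (ι-mono-< n<m))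

      1<δ⁻¹ : 1ℚ < (ι n ÷ ι m) ⁻¹
      1<δ⁻¹ = *-cancelˡ-<-nonNeg (ι n ÷ ι m) {{nonNegative (<⇒≤ 0<δ)}}
        (subst₂ _<_ (sym (*-identityʳ (ι n ÷ ι m))) (sym (⁻¹-inverse 0<δ)) δ<1)

      0<C[ln[1/δ]]² : ∀ C → 0ℝ <ℝ C → 0ℝ <ℝ C *ℝ ln ((ι n ÷ ι m) ⁻¹) 0<δ⁻¹ ²
      0<C[ln[1/δ]]² C 0<C = *ℝ-pos {C} {L ²} 0<C (*ℝ-pos {L} {L} 0<L 0<L)
        where
        L : ℝ
        L = ln ((ι n ÷ ι m) ⁻¹) 0<δ⁻¹
        0<L : 0ℝ <ℝ L
        0<L = ln-pos 0<δ⁻¹ 1<δ⁻¹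

{-# OPTIONS --safe #-}
-- The algorithm may be assumed lazy: carrying out, of each of its moves, only the relocations in
-- the shortest run of keys around the new key that makes room for it costs no more in total.
--
-- The adversary loads half of the keys evenly and then keeps a chain of T nested segments of the
-- order, each with strips of d ranks at its ends that have not been relocated since the segment was
-- chosen.  It inserts every key inside the core of the innermost segment.  A child is the denser
-- half of its parent's core, replaced by a thin strip at one of its ends as long as one is much
-- denser than the whole.  A move that relocates c keys can only eat c ranks from the strips it
-- crosses; a segment whose strips are used up, and everything below it, is chosen afresh.
--
-- Along the chain densities lose only a factor 1 + 1/2T per level.  A segment that has received
-- many insertions since its choice has gained a factor (1 + 1/2T)^J over its parent, and so does
-- each strip; since densities are at most Z, fewer than T/4 such gains fit in the chain.  Hence 3/4 of the
-- segments are active (have received few insertions) at any time, and every insertion raises the potential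
--   Σ min(T u, 2 h G) + 2 d G − 4 h G,   G = 8 H J,
-- by about T per active segment, while relocating c keys lowers it by at most 5 c G.  As the
-- potential stays bounded by the size of the array, n T² / G is a lower bound for the cost,
-- with T of order log n / log(m/n).
--
-- Keys to insert exist when r is large by bisection (Z = 1).  For r ≥ C m one gives the evenly
-- spaced original keys weight Z of order m/n: a segment in which no key is available between
-- consecutive ones has too few original keys to be dense.
--
-- Finally ln is compared with the dyadic logarithm by bounding the Riemann sums that define it
-- between minima of linear functions with slopes of the order 2^−j.
module Submission where

open import Defs

-- Laziness is what lets the strips protect a segment: an arbitrary move could relocate only the end
-- keys of a segment, at cost 2, whereas a run around the inserted key reaches an end only across
-- the strips of that segment and of all segments inside it. The parameters depend on each other as
-- follows. `M` = 2 `T` keeps the loss over the whole chain at most 2, so the gains multiply to at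
-- most 2 `Z N` / `W₀` < 2^`μ`. Since (1 + 1/`M`)^`M` ≥ 2, the exponent `J` = 8 `μ` makes `T`/4
-- gains too many. `H` = 4 `Z` (`J` + 1) makes the two end strips, of at most 2 `h` ranks each with
-- `h` the weight divided by `H`, weigh at most 1/(`J` + 1) of the segment; this turns a core of low
-- density into a strip with a gain of exponent `J`. `G` = 8 `H J` is so large that a segment past
-- the cap of the potential has received enough keys for another such gain. A level divides the
-- weight by at most 4 and a gain by at most 2 `H`, so `W-large` keeps every segment heavy enough
-- for strips of at least `T` ranks.

module SegmentChains where

  open import Data.Nat
  open import Data.Nat.Properties
  open import Data.Nat.DivMod using (m/n*n≤m; m%n<n; m≡m%n+[m/n]*n)
  open import Data.Nat.Tactic.RingSolver using (solve-∀)
  open import Data.List using (List; []; _∷_; length)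
  open import Data.List.Relation.Unary.All using (All; []; _∷_)
  open import Data.Product
  open import Data.Sum using (_⊎_; inj₁; inj₂; [_,_]′)
  open import Function using (case_of_)
  open import Relation.Binary.PropositionalEquality hiding (J)
  open import Relation.Nullary using (Dec; yes; no; ¬_; contradiction)
  open import Relation.Nullary.Decidable using (_×-dec_)

  open ≤-Reasoning

  -- Bernoulli inequalities and relative densities, cleared of denominators.

  bernoulli : ∀ M k → M ^ k * (M + k) ≤ suc M ^ k * M
  bernoulli M zero    = ≤-reflexive (cong (1 *_) (+-identityʳ M))
  bernoulli M (suc k) = begin
      M * M ^ k * (M + suc k)           ≤⟨ m≤m+n _ (M ^ k * k) ⟩
      M * M ^ k * (M + suc k) + M ^ k * k ≡⟨ eq M (M ^ k) k ⟩
      suc M * (M ^ k * (M + k))         ≤⟨ *-monoʳ-≤ (suc M) (bernoulli M k) ⟩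
      suc M * (suc M ^ k * M)           ≡⟨ sym (*-assoc (suc M) (suc M ^ k) M) ⟩
      suc M * suc M ^ k * M             ∎
    where
    eq : ∀ M X k → M * X * (M + suc k) + X * k ≡ suc M * (X * (M + k))
    eq = solve-∀

  -- Bernoulli for the base below one: (1 - 1/(M+1))^k ≥ 1 - k/(M+1), where c = M + 1 - k. It bounds
  -- powers of 1 + 1/M from above.
  bernoulli′ : ∀ M k c → k + c ≡ suc M → suc M ^ k * c ≤ M ^ k * suc M
  bernoulli′ M zero    c refl = ≤-refl
  bernoulli′ M (suc k) c e = begin
      suc M * X * c           ≡⟨ eq₁ M X c ⟩
      X * c + M * (X * c)     ≤⟨ +-monoˡ-≤ (M * (X * c)) (≤-trans (*-monoʳ-≤ X c≤M) (≤-reflexive (*-comm X M))) ⟩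
      M * X + M * (X * c)     ≡⟨ eq₂ M X c ⟩
      M * (X * suc c)         ≤⟨ *-monoʳ-≤ M (bernoulli′ M k (suc c) (trans (+-suc k c) e)) ⟩
      M * (M ^ k * suc M)     ≡⟨ sym (*-assoc M (M ^ k) (suc M)) ⟩
      M * M ^ k * suc M       ∎
    where
    X = suc M ^ k
    c≤M : c ≤ M
    c≤M = s≤s⁻¹ (≤-trans (s≤s (m≤n+m c k)) (≤-reflexive e))
    eq₁ : ∀ M X c → suc M * X * c ≡ X * c + M * (X * c)
    eq₁ = solve-∀
    eq₂ : ∀ M X c → M * X + M * (X * c) ≡ M * (X * suc c)
    eq₂ = solve-∀

  -- Doubling time of (1 + 1/M): at most M steps.
  power-doubles : ∀ M .{{_ : NonZero M}} μ → 2 ^ μ * M ^ (M * μ) ≤ suc M ^ (M * μ)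
  power-doubles M zero    rewrite *-zeroʳ M = ≤-refl
  power-doubles M (suc μ) = begin
      2 * 2 ^ μ * M ^ (M * suc μ)             ≡⟨ cong (2 * 2 ^ μ *_) (split M) ⟩
      2 * 2 ^ μ * (M ^ M * M ^ (M * μ))       ≡⟨ eq (2 ^ μ) (M ^ M) (M ^ (M * μ)) ⟩
      (2 * M ^ M) * (2 ^ μ * M ^ (M * μ))     ≤⟨ *-mono-≤ twice (power-doubles M μ) ⟩
      suc M ^ M * suc M ^ (M * μ)             ≡⟨ sym (split (suc M)) ⟩
      suc M ^ (M * suc μ)                     ∎
    where
    split : ∀ x → x ^ (M * suc μ) ≡ x ^ M * x ^ (M * μ)
    split x = trans (cong (x ^_) (*-suc M μ)) (^-distribˡ-+-* x M (M * μ))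
    eq : ∀ a b c → 2 * a * (b * c) ≡ (2 * b) * (a * c)
    eq = solve-∀
    twice : 2 * M ^ M ≤ suc M ^ M
    twice = *-cancelʳ-≤ (2 * M ^ M) (suc M ^ M) M (≤-trans (≤-reflexive (eq′ (M ^ M) M)) (bernoulli M M))
      where
      eq′ : ∀ a b → 2 * a * b ≡ a * (b + b)
      eq′ = solve-∀

  -- DenseBy X Y w L w′ L′ : the density w′ / L′ is at least Y / X times the density w / L.
  DenseBy : (X Y w L w′ L′ : ℕ) → Set
  DenseBy X Y w L w′ L′ = w * L′ * Y ≤ w′ * L * X

  dense-trans : ∀ {X Y X′ Y′ w L w′ L′ w″ L″} .{{_ : NonZero w′}} .{{_ : NonZero L′}} →
    DenseBy X Y w L w′ L′ → DenseBy X′ Y′ w′ L′ w″ L″ → DenseBy (X * X′) (Y * Y′) w L w″ L″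
  dense-trans {X} {Y} {X′} {Y′} {w} {L} {w′} {L′} {w″} {L″} p q =
    *-cancelʳ-≤ _ _ (w′ * L′) {{m*n≢0 w′ L′}} (begin
      w * L″ * (Y * Y′) * (w′ * L′)          ≡⟨ eq₁ w L″ Y Y′ w′ L′ ⟩
      w * L′ * Y * (w′ * L″ * Y′)            ≤⟨ *-mono-≤ p q ⟩
      w′ * L * X * (w″ * L′ * X′)            ≡⟨ eq₂ w′ L X w″ L′ X′ ⟩
      w″ * L * (X * X′) * (w′ * L′)          ∎)
    where
    eq₁ : ∀ w L″ Y Y′ w′ L′ → w * L″ * (Y * Y′) * (w′ * L′) ≡ w * L′ * Y * (w′ * L″ * Y′)
    eq₁ = solve-∀
    eq₂ : ∀ w′ L X w″ L′ X′ → w′ * L * X * (w″ * L′ * X′) ≡ w″ * L * (X * X′) * (w′ * L′)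
    eq₂ = solve-∀

  dense-cast : ∀ {X Y X′ Y′ w L w′ L′} → X ≡ X′ → Y ≡ Y′ → DenseBy X Y w L w′ L′ → DenseBy X′ Y′ w L w′ L′
  dense-cast refl refl d = d

  -- The density of a union is the mediant of the densities of its parts, so one part is at least as
  -- dense. Applied both to the two end strips of a segment and to the two halves of a core.
  mediant : ∀ {X Y w L u₁ K₁ u₂ K₂} → DenseBy X Y w L (u₁ + u₂) (K₁ + K₂) →
    DenseBy X Y w L u₁ K₁ ⊎ DenseBy X Y w L u₂ K₂
  mediant {X} {Y} {w} {L} {u₁} {K₁} {u₂} {K₂} d
    with w * K₁ * Y ≤? u₁ * L * X | w * K₂ * Y ≤? u₂ * L * X
  ... | yes p | _     = inj₁ p
  ... | no _  | yes q = inj₂ q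
  ... | no ¬p | no ¬q = contradiction d (<⇒≱ (begin-strict
      (u₁ + u₂) * L * X            ≡⟨ eq u₁ u₂ L X ⟩
      u₁ * L * X + u₂ * L * X      <⟨ +-mono-< (≰⇒> ¬p) (≰⇒> ¬q) ⟩
      w * K₁ * Y + w * K₂ * Y      ≡⟨ eq′ w K₁ K₂ Y ⟩
      w * (K₁ + K₂) * Y            ∎))
    where
    eq : ∀ u v L X → (u + v) * L * X ≡ u * L * X + v * L * X
    eq = solve-∀
    eq′ : ∀ w K₁ K₂ Y → w * K₁ * Y + w * K₂ * Y ≡ w * (K₁ + K₂) * Y
    eq′ = solve-∀

  -- If removing a strip of relative weight at most 1/(J+1) lowers the density by more than the
  -- factor M/(M+1), then the strip is denser than the whole by (1+1/M)^J.
  strip-dense : ∀ M J c′ {w ws wc L Ls Lc} .{{_ : NonZero M}} → suc J + c′ ≡ suc M →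
    w ≡ ws + wc → L ≡ Ls + Lc → suc J * ws ≤ w → wc * L * suc M < w * Lc * M →
    DenseBy (M ^ J) (suc M ^ J) w L ws Ls
  strip-dense M J c′ {ws = ws} {wc} {Ls = Ls} {Lc} e refl refl small fail =
    *-cancelʳ-≤ (w * Ls * suc M ^ J) (ws * L * M ^ J) (M * suc c′) {{m*n≢0 M (suc c′)}} (begin
      w * Ls * suc M ^ J * (M * suc c′)        ≡⟨ eq₁ w Ls (suc M ^ J) M c′ ⟩
      (M * w * Ls) * (suc M ^ J * suc c′)      ≤⟨ *-mono-≤ thin (bernoulli′ M J (suc c′) (trans (+-suc J c′) e)) ⟩
      (c′ * ws * L) * (M ^ J * suc M)          ≡⟨ eq₂ c′ ws L (M ^ J) M ⟩
      (ws * L * M ^ J) * (c′ * suc M)          ≤⟨ *-monoʳ-≤ (ws * L * M ^ J) c′-small ⟩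
      ws * L * M ^ J * (M * suc c′)            ∎)
    where
    w = ws + wc
    L = Ls + Lc
    eq₁ : ∀ w Ls Y M c → w * Ls * Y * (M * suc c) ≡ (M * w * Ls) * (Y * suc c)
    eq₁ = solve-∀
    eq₂ : ∀ c ws L X M → (c * ws * L) * (X * suc M) ≡ (ws * L * X) * (c * suc M)
    eq₂ = solve-∀
    c′-small : c′ * suc M ≤ M * suc c′
    c′-small = begin
      c′ * suc M      ≡⟨ *-suc c′ M ⟩
      c′ + c′ * M     ≤⟨ +-monoˡ-≤ (c′ * M) (s≤s⁻¹ (≤-trans (s≤s (m≤n+m c′ J)) (≤-reflexive e))) ⟩
      M + c′ * M      ≡⟨ eq M c′ ⟩
      M * suc c′      ∎
      where
      eq : ∀ M c → M + c * M ≡ M * suc c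
      eq = solve-∀
    -- Adding `small`, multiplied by L, to `fail` shows that the strip is denser than the whole by M
    -- / c′, where c′ = M - J. By `c′-small` and `bernoulli′`, M / c′ ≥ (M+1) / (c′+1) ≥ (1 +
    -- 1/M)^J.
    thin : M * w * Ls ≤ c′ * ws * L
    thin = +-cancelʳ-≤ (suc J * ws * L + w * Lc * M) (M * w * Ls) (c′ * ws * L) (begin
      M * w * Ls + (suc J * ws * L + w * Lc * M)
        ≤⟨ +-monoʳ-≤ (M * w * Ls) (+-monoˡ-≤ (w * Lc * M) (*-monoˡ-≤ L small)) ⟩
      M * w * Ls + (w * L + w * Lc * M)          ≡⟨ e₁ M ws wc Ls Lc ⟩
      suc M * ws * L + wc * L * suc M            ≤⟨ +-monoʳ-≤ (suc M * ws * L) (<⇒≤ fail) ⟩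
      suc M * ws * L + w * Lc * M                ≡⟨ cong (λ z → z * ws * L + w * Lc * M) (sym e) ⟩
      (suc J + c′) * ws * L + w * Lc * M         ≡⟨ e₂ J c′ ws L (w * Lc * M) ⟩
      c′ * ws * L + (suc J * ws * L + w * Lc * M) ∎)
      where
      e₁ : ∀ M ws wc Ls Lc → M * (ws + wc) * Ls + ((ws + wc) * (Ls + Lc) + (ws + wc) * Lc * M)
           ≡ suc M * ws * (Ls + Lc) + wc * (Ls + Lc) * suc M
      e₁ = solve-∀
      e₂ : ∀ J c ws L x → (suc J + c) * ws * L + x ≡ c * ws * L + (suc J * ws * L + x)
      e₂ = solve-∀

  insert-ratio : ∀ {p q} u → p ≤ q → (q + u) * p ≤ (p + u) * q
  insert-ratio {p} {q} u p≤q = begin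
      (q + u) * p      ≡⟨ *-distribʳ-+ p q u ⟩
      q * p + u * p    ≤⟨ +-mono-≤ (≤-reflexive (*-comm q p)) (*-monoʳ-≤ u p≤q) ⟩
      p * q + u * q    ≡⟨ sym (*-distribʳ-+ q p u) ⟩
      (p + u) * q      ∎

  -- Many insertions into a segment much lighter than its parent raise its relative density.
  insert-gain : ∀ T J c {p q} u .{{_ : NonZero c}} → J + c ≡ suc (2 * T) → 5 * J ≤ suc T → 4 * p ≤ 3 * q → 4 * J * p ≤ T * u →
    (q + u) * p * suc (2 * T) ^ J ≤ (p + u) * q * (2 * T) ^ J
  insert-gain T J c {p} {q} u e 5J 4p≤3q long =
    *-cancelʳ-≤ _ _ c (begin
      (q + u) * p * suc M ^ J * c              ≡⟨ *-assoc ((q + u) * p) (suc M ^ J) c ⟩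
      (q + u) * p * (suc M ^ J * c)            ≤⟨ *-monoʳ-≤ ((q + u) * p) (bernoulli′ M J c e) ⟩
      (q + u) * p * (M ^ J * suc M)            ≡⟨ eq₁ ((q + u) * p) (M ^ J) (suc M) ⟩
      (q + u) * p * suc M * M ^ J              ≤⟨ *-monoˡ-≤ (M ^ J) main ⟩
      (p + u) * q * c * M ^ J                  ≡⟨ eq₂ ((p + u) * q) c (M ^ J) ⟩
      (p + u) * q * M ^ J * c                  ∎)
    where
    M = 2 * T
    eq₁ : ∀ a b c → a * (b * c) ≡ a * c * b
    eq₁ = solve-∀
    eq₂ : ∀ a b c → a * b * c ≡ a * c * b
    eq₂ = solve-∀
    -- The slack (p+u) q - (q+u) p = u (q - p) is at least u q / 4, while J (p + u) ≤ (2 T + 1) u /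
    -- 4 by `long` and `5J`; this pays for replacing the factor M + 1 by c = M + 1 - J.
    main : (q + u) * p * suc M ≤ (p + u) * q * c
    main = *-cancelˡ-≤ 4 (+-cancelʳ-≤ (4 * (J * ((p + u) * q))) _ _ (begin
      4 * ((q + u) * p * suc M) + 4 * (J * ((p + u) * q))
        ≡⟨ e₁ p q u J M ⟩
      4 * (q * p * suc M) + u * (4 * p) * suc M + (4 * J * p + 4 * J * u) * q
        ≤⟨ +-monoʳ-≤ (4 * (q * p * suc M) + u * (4 * p) * suc M) (*-monoˡ-≤ q (+-mono-≤ long small)) ⟩
      4 * (q * p * suc M) + u * (4 * p) * suc M + (T * u + suc T * u) * q
        ≡⟨ e₂ p q u T ⟩
      4 * (q * p * suc M) + u * suc M * (4 * p + q)
        ≤⟨ +-monoʳ-≤ (4 * (q * p * suc M)) (*-monoʳ-≤ (u * suc M) (≤-trans (+-monoˡ-≤ q 4p≤3q) (≤-reflexive (e₃ q)))) ⟩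
      4 * (q * p * suc M) + u * suc M * (4 * q)
        ≡⟨ cong (λ z → 4 * (q * p * z) + u * z * (4 * q)) (sym e) ⟩
      4 * (q * p * (J + c)) + u * (J + c) * (4 * q)
        ≡⟨ e₄ p q u J c ⟩
      4 * ((p + u) * q * c) + 4 * (J * ((p + u) * q)) ∎))
      where
      small : 4 * J * u ≤ suc T * u
      small = *-monoˡ-≤ u (≤-trans (*-monoˡ-≤ J (n≤1+n 4)) 5J)
      e₁ : ∀ p q u J M → 4 * ((q + u) * p * suc M) + 4 * (J * ((p + u) * q))
           ≡ 4 * (q * p * suc M) + u * (4 * p) * suc M + (4 * J * p + 4 * J * u) * q
      e₁ = solve-∀
      e₂ : ∀ p q u T → 4 * (q * p * suc (2 * T)) + u * (4 * p) * suc (2 * T) + (T * u + suc T * u) * q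
           ≡ 4 * (q * p * suc (2 * T)) + u * suc (2 * T) * (4 * p + q)
      e₂ = solve-∀
      e₃ : ∀ q → 3 * q + q ≡ 4 * q
      e₃ = solve-∀
      e₄ : ∀ p q u J c → 4 * (q * p * (J + c)) + u * (J + c) * (4 * q)
           ≡ 4 * ((p + u) * q * c) + 4 * (J * ((p + u) * q))
      e₄ = solve-∀

  -- Both segments keep their lengths while the same `u` keys enter them, so their relative density
  -- changes only by the quotient of (p+u)/p and (q+u)/q.
  link-insert : ∀ {X Y K₀ K₁ p q L L′} u .{{_ : NonZero q}} → DenseBy X Y q L p L′ →
    (q + u) * p * K₁ ≤ (p + u) * q * K₀ → DenseBy (X * K₀) (Y * K₁) (q + u) L (p + u) L′
  link-insert {X} {Y} {K₀} {K₁} {p} {q} {L} {L′} u d r = *-cancelʳ-≤ _ _ q (begin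
      (q + u) * L′ * (Y * K₁) * q           ≡⟨ e₁ (q + u) L′ Y K₁ q ⟩
      (q + u) * K₁ * (q * L′ * Y)           ≤⟨ *-monoʳ-≤ ((q + u) * K₁) d ⟩
      (q + u) * K₁ * (p * L * X)            ≡⟨ e₂ (q + u) K₁ p L X ⟩
      ((q + u) * p * K₁) * (L * X)          ≤⟨ *-monoˡ-≤ (L * X) r ⟩
      ((p + u) * q * K₀) * (L * X)          ≡⟨ e₃ (p + u) q K₀ L X ⟩
      (p + u) * L * (X * K₀) * q            ∎)
    where
    e₁ : ∀ a L′ Y K q → a * L′ * (Y * K) * q ≡ a * K * (q * L′ * Y)
    e₁ = solve-∀
    e₂ : ∀ a K p L X → a * K * (p * L * X) ≡ (a * p * K) * (L * X)
    e₂ = solve-∀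
    e₃ : ∀ a q K L X → (a * q * K) * (L * X) ≡ a * L * (X * K) * q
    e₃ = solve-∀

  -- Segments of a configuration and the densities they can reach.

  -- A configuration in terms of ranks: P i is the cell and ω i the total weight up to the key of
  -- rank i.  Both are continued beyond the last rank, so that no bounds on ranks are needed.
  record Config (Z : ℕ) : Set where
    field
      P ω : ℕ → ℕ
      P↑  : ∀ i → P i < P (suc i)
      ω↑  : ∀ i → ω i < ω (suc i)
      ω≤  : ∀ i → ω (suc i) ≤ Z + ω i

    len wt : ℕ → ℕ → ℕ
    len a b = P b ∸ P a
    wt  a b = ω b ∸ ω a

  mono : ∀ {f : ℕ → ℕ} → (∀ i → f i < f (suc i)) → ∀ {a b} → a ≤ b → f a ≤ f b
  mono {f} f↑ {a} a≤b = go (≤⇒≤′ a≤b)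
    where
    go : ∀ {b} → a ≤′ b → f a ≤ f b
    go ≤′-refl       = ≤-refl
    go (≤′-step a≤b) = ≤-trans (go a≤b) (<⇒≤ (f↑ _))

  mono-width : ∀ {f : ℕ → ℕ} → (∀ i → f i < f (suc i)) → ∀ a k → f a + k ≤ f (a + k)
  mono-width {f} f↑ a zero    = ≤-reflexive (trans (+-identityʳ (f a)) (cong f (sym (+-identityʳ a))))
  mono-width {f} f↑ a (suc k) = begin
    f a + suc k    ≡⟨ +-suc (f a) k ⟩
    suc (f a + k)  ≤⟨ s≤s (mono-width f↑ a k) ⟩
    suc (f (a + k)) ≤⟨ f↑ (a + k) ⟩
    f (suc (a + k)) ≡⟨ cong f (sym (+-suc a k)) ⟩
    f (a + suc k)  ∎

  ∸-split : ∀ {x y z} → x ≤ y → y ≤ z → (y ∸ x) + (z ∸ y) ≡ z ∸ x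
  ∸-split {x} {y} {z} x≤y y≤z = +-cancelˡ-≡ x _ _ (begin-equality
    x + ((y ∸ x) + (z ∸ y))  ≡⟨ sym (+-assoc x (y ∸ x) (z ∸ y)) ⟩
    x + (y ∸ x) + (z ∸ y)    ≡⟨ cong (_+ (z ∸ y)) (m+[n∸m]≡n x≤y) ⟩
    y + (z ∸ y)              ≡⟨ m+[n∸m]≡n y≤z ⟩
    z                        ≡⟨ sym (m+[n∸m]≡n (≤-trans x≤y y≤z)) ⟩
    x + (z ∸ x)              ∎)

  module Segments {Z} (C : Config Z) where
    open Config C public

    len-split : ∀ {a b c} → a ≤ b → b ≤ c → len a b + len b c ≡ len a c
    len-split a≤b b≤c = ∸-split (mono P↑ a≤b) (mono P↑ b≤c)

    wt-split : ∀ {a b c} → a ≤ b → b ≤ c → wt a b + wt b c ≡ wt a c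
    wt-split a≤b b≤c = ∸-split (mono ω↑ a≤b) (mono ω↑ b≤c)

    width : ∀ {f : ℕ → ℕ} → (∀ i → f i < f (suc i)) → ∀ a b → b ∸ a ≤ f b ∸ f a
    width {f} f↑ a b with ≤-total a b
    ... | inj₂ b≤a = ≤-trans (≤-reflexive (m≤n⇒m∸n≡0 b≤a)) z≤n
    ... | inj₁ a≤b = m+n≤o⇒n≤o∸m (f a) (≤-trans (mono-width f↑ a (b ∸ a)) (≤-reflexive (cong f (m+[n∸m]≡n a≤b))))
      where
      m+n≤o⇒n≤o∸m : ∀ m {n o} → m + n ≤ o → n ≤ o ∸ m
      m+n≤o⇒n≤o∸m m {n} h = m+n≤o⇒m≤o∸n n (≤-trans (≤-reflexive (+-comm n m)) h)

    width≤len : ∀ a b → b ∸ a ≤ len a b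
    width≤len = width P↑

    width≤wt : ∀ a b → b ∸ a ≤ wt a b
    width≤wt = width ω↑

    wt≤width : ∀ a k → wt a (a + k) ≤ Z * k
    wt≤width a k = m≤n+o⇒m∸n≤o (ω (a + k)) (ω a) (go k)
      where
      go : ∀ k → ω (a + k) ≤ ω a + Z * k
      go zero    = ≤-reflexive (trans (cong ω (+-identityʳ a)) (sym (trans (cong (ω a +_) (*-zeroʳ Z)) (+-identityʳ _))))
      go (suc k) = begin
        ω (a + suc k)          ≡⟨ cong ω (+-suc a k) ⟩
        ω (suc (a + k))        ≤⟨ ω≤ (a + k) ⟩
        Z + ω (a + k)          ≤⟨ +-monoʳ-≤ Z (go k) ⟩
        Z + (ω a + Z * k)      ≡⟨ eq Z (ω a) k ⟩
        ω a + Z * suc k        ∎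
        where
        eq : ∀ Z x k → Z + (x + Z * k) ≡ x + Z * suc k
        eq = solve-∀

    wt≤Z* : ∀ {a b} → a ≤ b → wt a b ≤ Z * (b ∸ a)
    wt≤Z* {a} {b} a≤b = ≤-trans (≤-reflexive (cong (wt a) (sym (m+[n∸m]≡n a≤b)))) (wt≤width a (b ∸ a))

    wt≤Z*len : ∀ {a b} → a ≤ b → wt a b ≤ Z * len a b
    wt≤Z*len {a} {b} a≤b = ≤-trans (wt≤Z* a≤b) (*-monoʳ-≤ Z (width≤len a b))

    len>0 : ∀ {a b} → a < b → 0 < len a b
    len>0 {a} {b} a<b = ≤-trans (m<n⇒0<n∸m a<b) (width≤len a b)

    wt>0 : ∀ {a b} → a < b → 0 < wt a b
    wt>0 {a} {b} a<b = ≤-trans (m<n⇒0<n∸m a<b) (width≤wt a b)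

  -- Z bounds the weight of a key, T is the number of levels, N the length of the array with its
  -- right sentinel, and W₀ the weight of the initial keys.
  record Params : Set where
    field
      Z μ T N W₀ : ℕ

    J : ℕ
    J = 8 * μ
    H : ℕ
    H = 4 * Z * suc J
    G : ℕ
    G = 8 * H * J
    M : ℕ
    M = 2 * T

    field
      Z≥1     : 1 ≤ Z
      μ≥1     : 1 ≤ μ
      T-large : 5 * J ≤ suc T
      W-dense : 2 * Z * N < 2 ^ μ * W₀
      W-large : H * T * (8 * H) ^ T ≤ W₀

  module Levels (par : Params) where
    open Params par

    J≥1 : 1 ≤ J
    J≥1 = ≤-trans μ≥1 (m≤n*m μ 8)

    J≤T : J ≤ T
    J≤T = s≤s⁻¹ (≤-trans (≤-trans (m<m+n J (≤-trans J≥1 (m≤m+n J (3 * J)))) (≤-reflexive refl)) T-large)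

    T≥1 : 1 ≤ T
    T≥1 = ≤-trans J≥1 J≤T

    H≥1 : 1 ≤ H
    H≥1 = *-mono-≤ {1} {4 * Z} {1} {suc J} (≤-trans Z≥1 (m≤n*m Z 4)) (s≤s z≤n)

    instance
      Z≢0 : NonZero Z
      Z≢0 = >-nonZero Z≥1
      T≢0 : NonZero T
      T≢0 = >-nonZero T≥1
      H≢0 : NonZero H
      H≢0 = >-nonZero H≥1
      M≢0 : NonZero M
      M≢0 = m*n≢0 2 T

    -- The quotient `Y i s` / `X i s` is (1 + 1/M)^(J s - i): each of the i levels may lose one
    -- factor 1 + 1/M, each of the s gains contributes J of them.
    X Y : ℕ → ℕ → ℕ
    X i s = suc M ^ i * M ^ (J * s)
    Y i s = M ^ i * suc M ^ (J * s)

    J*suc : ∀ s f → J * (s + f) ≡ J * s + J * f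
    J*suc = *-distribˡ-+ J

    XY-step : ∀ a b i s e f → (a ^ i * b ^ (J * s)) * (a ^ e * b ^ (J * f)) ≡ a ^ (i + e) * b ^ (J * (s + f))
    XY-step a b i s e f = begin-equality
      (a ^ i * b ^ (J * s)) * (a ^ e * b ^ (J * f))     ≡⟨ eq (a ^ i) (b ^ (J * s)) (a ^ e) (b ^ (J * f)) ⟩
      (a ^ i * a ^ e) * (b ^ (J * s) * b ^ (J * f))     ≡⟨ cong₂ _*_ (sym (^-distribˡ-+-* a i e))
                                                             (trans (sym (^-distribˡ-+-* b (J * s) (J * f))) (cong (b ^_) (sym (J*suc s f)))) ⟩
      a ^ (i + e) * b ^ (J * (s + f))                   ∎
      where
      eq : ∀ a b c d → (a * b) * (c * d) ≡ (a * c) * (b * d)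
      eq = solve-∀

    -- By `bernoulli′`, (1 - 1/(M+1))^i is at least (T+1)/(2T+1) > 1/2 for i ≤ T. This is the reason
    -- for M = 2 T.
    pow-bound : ∀ {i} → i ≤ T → suc M ^ i ≤ 2 * M ^ i
    pow-bound {i} i≤T = *-cancelʳ-≤ (suc M ^ i) (2 * M ^ i) (suc T) (begin
      suc M ^ i * suc T           ≤⟨ *-monoʳ-≤ (suc M ^ i) c≥ ⟩
      suc M ^ i * (suc M ∸ i)     ≤⟨ bernoulli′ M i (suc M ∸ i) (m+[n∸m]≡n i≤M) ⟩
      M ^ i * suc M               ≤⟨ *-monoʳ-≤ (M ^ i) (n≤1+n (suc M)) ⟩
      M ^ i * suc (suc M)         ≡⟨ eq (M ^ i) T ⟩
      2 * M ^ i * suc T           ∎)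
      where
      eq : ∀ a T → a * suc (suc (2 * T)) ≡ 2 * a * suc T
      eq = solve-∀
      i≤M : i ≤ suc M
      i≤M = ≤-trans i≤T (≤-trans (m≤m+n T (T + 0)) (n≤1+n M))
      c≥ : suc T ≤ suc M ∸ i
      c≥ = ≤-trans (≤-reflexive (sym (trans (cong (_∸ T) (eq′ T)) (m+n∸n≡m (suc T) T)))) (∸-monoʳ-≤ (suc M) i≤T)
        where
        eq′ : ∀ T → suc (2 * T) ≡ suc T + T
        eq′ = solve-∀

    -- Otherwise J s ≥ 2 μ T = M μ, so by `power-doubles` the gains multiply to at least 2^μ; after
    -- a loss of at most 2 the density would still exceed `Z`, by `W-dense`.
    few-gains : ∀ {i s} → i ≤ T → W₀ * Y i s ≤ Z * N * X i s → 4 * s < T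
    few-gains {i} {s} i≤T d with 4 * s <? T
    ... | yes lt = lt
    ... | no ¬lt = contradiction bad (<⇒≱ W-dense)
      where
      T≤4s = ≮⇒≥ ¬lt
      r = proj₁ (m≤n⇒∃[o]m+o≡n T≤4s)
      Js : J * s ≡ M * μ + 2 * μ * r
      Js = begin-equality
        8 * μ * s                ≡⟨ eq μ s ⟩
        2 * μ * (4 * s)          ≡⟨ cong (2 * μ *_) (sym (proj₂ (m≤n⇒∃[o]m+o≡n T≤4s))) ⟩
        2 * μ * (T + r)          ≡⟨ eq′ μ T r ⟩
        2 * T * μ + 2 * μ * r    ∎
        where
        eq : ∀ μ s → 8 * μ * s ≡ 2 * μ * (4 * s)
        eq = solve-∀
        eq′ : ∀ μ T r → 2 * μ * (T + r) ≡ 2 * T * μ + 2 * μ * r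
        eq′ = solve-∀
      gain : 2 ^ μ * M ^ (J * s) ≤ suc M ^ (J * s)
      gain = begin
        2 ^ μ * M ^ (J * s)                          ≡⟨ cong (λ e → 2 ^ μ * M ^ e) Js ⟩
        2 ^ μ * M ^ (M * μ + 2 * μ * r)              ≡⟨ cong (2 ^ μ *_) (^-distribˡ-+-* M (M * μ) (2 * μ * r)) ⟩
        2 ^ μ * (M ^ (M * μ) * M ^ (2 * μ * r))      ≡⟨ sym (*-assoc (2 ^ μ) (M ^ (M * μ)) (M ^ (2 * μ * r))) ⟩
        2 ^ μ * M ^ (M * μ) * M ^ (2 * μ * r)        ≤⟨ *-mono-≤ (power-doubles M μ) (^-monoˡ-≤ (2 * μ * r) (n≤1+n M)) ⟩
        suc M ^ (M * μ) * suc M ^ (2 * μ * r)        ≡⟨ sym (^-distribˡ-+-* (suc M) (M * μ) (2 * μ * r)) ⟩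
        suc M ^ (M * μ + 2 * μ * r)                  ≡⟨ cong (suc M ^_) (sym Js) ⟩
        suc M ^ (J * s)                              ∎
      A B : ℕ
      A = M ^ i
      B = M ^ (J * s)
      bad : 2 ^ μ * W₀ ≤ 2 * Z * N
      bad = *-cancelʳ-≤ (2 ^ μ * W₀) (2 * Z * N) (A * B) {{m*n≢0 A B {{m^n≢0 M i}} {{m^n≢0 M (J * s)}}}} (begin
        2 ^ μ * W₀ * (A * B)            ≡⟨ e₁ (2 ^ μ) W₀ A B ⟩
        W₀ * (A * (2 ^ μ * B))          ≤⟨ *-monoʳ-≤ W₀ (*-monoʳ-≤ A gain) ⟩
        W₀ * Y i s                      ≤⟨ d ⟩
        Z * N * (suc M ^ i * B)         ≤⟨ *-monoʳ-≤ (Z * N) (*-monoˡ-≤ B (pow-bound i≤T)) ⟩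
        Z * N * (2 * A * B)             ≡⟨ e₂ Z N A B ⟩
        2 * Z * N * (A * B)             ∎)
        where
        e₁ : ∀ t w a b → t * w * (a * b) ≡ w * (a * (t * b))
        e₁ = solve-∀
        e₂ : ∀ Z N a b → Z * N * (2 * a * b) ≡ 2 * Z * N * (a * b)
        e₂ = solve-∀

    size-bound : ∀ {i s} → i ≤ T → s ≤ T → 4 ^ i * (2 * H) ^ s ≤ (8 * H) ^ T
    size-bound {i} {s} i≤T s≤T = begin
      4 ^ i * (2 * H) ^ s      ≤⟨ *-mono-≤ (^-monoʳ-≤ 4 i≤T) (^-monoʳ-≤ (2 * H) {{m*n≢0 2 H}} s≤T) ⟩
      4 ^ T * (2 * H) ^ T      ≡⟨ sym (^-distribʳ-* T 4 (2 * H)) ⟩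
      (4 * (2 * H)) ^ T        ≡⟨ cong (_^ T) (eq H) ⟩
      (8 * H) ^ T              ∎
      where
      eq : ∀ H → 4 * (2 * H) ≡ 8 * H
      eq = solve-∀
      ^-distribʳ-* : ∀ n a b → (a * b) ^ n ≡ a ^ n * b ^ n
      ^-distribʳ-* zero    a b = refl
      ^-distribʳ-* (suc n) a b = trans (cong (a * b *_) (^-distribʳ-* n a b)) (eq′ a b (a ^ n) (b ^ n))
        where
        eq′ : ∀ a b x y → a * b * (x * y) ≡ a * x * (b * y)
        eq′ = solve-∀

    module Static (C : Config Z) where
      open Segments C public

      -- A segment reached after i levels, with s gains of a factor (1+1/M)^J in density on the way.
      record Reached (i s a b : ℕ) : Set where
        constructor reached
        field
          dense : DenseBy (X i s) (Y i s) W₀ N (wt a b) (len a b)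
          heavy : W₀ ≤ wt a b * (4 ^ i * (2 * H) ^ s)
      open Reached public

      reached⇒few : ∀ {i s a b} → i ≤ T → a < b → Reached i s a b → 4 * s < T
      reached⇒few {i} {s} {a} {b} i≤T a<b r = few-gains {i} {s} i≤T (*-cancelʳ-≤ _ _ (len a b) {{>-nonZero (len>0 a<b)}} (begin
        W₀ * Y i s * len a b             ≡⟨ e₁ W₀ (Y i s) (len a b) ⟩
        W₀ * len a b * Y i s             ≤⟨ dense r ⟩
        wt a b * N * X i s               ≤⟨ *-monoˡ-≤ (X i s) (*-monoˡ-≤ N (wt≤Z*len (<⇒≤ a<b))) ⟩
        Z * len a b * N * X i s          ≡⟨ e₂ Z (len a b) N (X i s) ⟩
        Z * N * X i s * len a b          ∎))
        where
        e₁ : ∀ w y l → w * y * l ≡ w * l * y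
        e₁ = solve-∀
        e₂ : ∀ z l n x → z * l * n * x ≡ z * n * x * l
        e₂ = solve-∀

      -- This weight makes every strip at least `T` ranks long; that length later pays for the term
      -- `T` of an active level that is thrown away.
      reached⇒wt : ∀ {i s a b} → i ≤ T → a < b → Reached i s a b → H * T ≤ wt a b
      reached⇒wt {i} {s} {a} {b} i≤T a<b r = *-cancelʳ-≤ (H * T) (wt a b) ((8 * H) ^ T) {{m^n≢0 (8 * H) T {{m*n≢0 8 H}}}} (begin
        H * T * (8 * H) ^ T                 ≤⟨ W-large ⟩
        W₀                                  ≤⟨ heavy r ⟩
        wt a b * (4 ^ i * (2 * H) ^ s)      ≤⟨ *-monoʳ-≤ (wt a b) (size-bound i≤T s≤T) ⟩
        wt a b * (8 * H) ^ T                ∎)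
        where
        s≤T : s ≤ T
        s≤T = ≤-trans (m≤n*m s 4) (<⇒≤ (reached⇒few i≤T a<b r))

      reached-trans : ∀ {i s e f a b a′ b′} → a < b → Reached i s a b →
        DenseBy (X e f) (Y e f) (wt a b) (len a b) (wt a′ b′) (len a′ b′) →
        wt a b ≤ wt a′ b′ * (4 ^ e * (2 * H) ^ f) → Reached (i + e) (s + f) a′ b′
      reached-trans {i} {s} {e} {f} {a} {b} {a′} {b′} a<b r d w = reached
        (dense-cast {X i s * X e f} {Y i s * Y e f} {X (i + e) (s + f)} {Y (i + e) (s + f)} {W₀} {N} {wt a′ b′} {len a′ b′}
           (XY-step (suc M) M i s e f) (XY-step M (suc M) i s e f)
           (dense-trans {X i s} {Y i s} {X e f} {Y e f} {W₀} {N} {wt a b} {len a b} {wt a′ b′} {len a′ b′} {{>-nonZero (wt>0 a<b)}} {{>-nonZero (len>0 a<b)}} (dense r) d))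
        (begin
          W₀                                                        ≤⟨ heavy r ⟩
          wt a b * (4 ^ i * (2 * H) ^ s)                            ≤⟨ *-monoˡ-≤ (4 ^ i * (2 * H) ^ s) w ⟩
          wt a′ b′ * (4 ^ e * (2 * H) ^ f) * (4 ^ i * (2 * H) ^ s)  ≡⟨ eq (wt a′ b′) (4 ^ e) ((2 * H) ^ f) (4 ^ i) ((2 * H) ^ s) ⟩
          wt a′ b′ * ((4 ^ i * 4 ^ e) * ((2 * H) ^ s * (2 * H) ^ f)) ≡⟨ cong (wt a′ b′ *_) (sym (cong₂ _*_ (^-distribˡ-+-* 4 i e) (^-distribˡ-+-* (2 * H) s f))) ⟩
          wt a′ b′ * (4 ^ (i + e) * (2 * H) ^ (s + f))              ∎)
        where
        eq : ∀ w a b c d → w * (a * b) * (c * d) ≡ w * ((c * a) * (d * b))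
        eq = solve-∀

      CoreDense : (a b d : ℕ) → Set
      CoreDense a b d = ∀ c → c + d ≡ b → DenseBy (suc M) M (wt a b) (len a b) (wt (a + d) c) (len (a + d) c)

      -- Demanded at once for all widths to which the strips may shrink, so that the core keeps its
      -- density when a run eats into the strips.
      Regular : (a b h d : ℕ) → Set
      Regular a b h d = ∀ d′ → h ≤ d′ → d′ ≤ d → CoreDense a b d′

      room : ∀ {a b h} → a ≤ b → h * H ≤ wt a b → 4 * suc J * h ≤ b ∸ a
      room {a} {b} {h} a≤b hH = *-cancelˡ-≤ Z (begin
        Z * (4 * suc J * h)    ≡⟨ eq Z (suc J) h ⟩
        h * (4 * Z * suc J)    ≤⟨ hH ⟩
        wt a b                 ≤⟨ wt≤Z* a≤b ⟩
        Z * (b ∸ a)            ∎)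
        where
        eq : ∀ Z Q h → Z * (4 * Q * h) ≡ h * (4 * Z * Q)
        eq = solve-∀

      room₂ : ∀ {a b h d} → a ≤ b → h * H ≤ wt a b → d ≤ 2 * h → a + (d + d) ≤ b
      room₂ {a} {b} {h} {d} a≤b hH d≤2h = ≤-trans (+-monoʳ-≤ a (begin
          d + d             ≤⟨ +-mono-≤ d≤2h d≤2h ⟩
          2 * h + 2 * h     ≡⟨ eq h ⟩
          4 * 1 * h         ≤⟨ *-monoˡ-≤ h (*-monoʳ-≤ 4 {1} {suc J} (s≤s z≤n)) ⟩
          4 * suc J * h     ≤⟨ room a≤b hH ⟩
          b ∸ a             ∎)) (≤-reflexive (m+[n∸m]≡n a≤b))
        where
        eq : ∀ h → 2 * h + 2 * h ≡ 4 * 1 * h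
        eq = solve-∀

      core≤ : ∀ {a b c d} → a + (d + d) ≤ b → c + d ≡ b → a + d ≤ c
      core≤ {a} {b} {c} {d} r refl = +-cancelʳ-≤ d (a + d) c (≤-trans (≤-reflexive (+-assoc a d d)) r)

      strips : ∀ {a b c d} → a + d ≤ c → c + d ≡ b →
        wt a b ≡ (wt a (a + d) + wt c b) + wt (a + d) c × len a b ≡ (len a (a + d) + len c b) + len (a + d) c
      strips {a} {b} {c} {d} ad≤c refl = three wt-split , three len-split
        where
        three : ∀ {f : ℕ → ℕ → ℕ} → (∀ {a b c} → a ≤ b → b ≤ c → f a b + f b c ≡ f a c) →
          f a b ≡ (f a (a + d) + f c b) + f (a + d) c
        three {f} split = begin-equality
          f a b                                  ≡⟨ sym (split (≤-trans (m≤m+n a d) ad≤c) (m≤m+n c d)) ⟩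
          f a c + f c b                          ≡⟨ cong (_+ f c b) (sym (split (m≤m+n a d) ad≤c)) ⟩
          f a (a + d) + f (a + d) c + f c b      ≡⟨ +-assoc (f a (a + d)) (f (a + d) c) (f c b) ⟩
          f a (a + d) + (f (a + d) c + f c b)    ≡⟨ cong (f a (a + d) +_) (+-comm (f (a + d) c) (f c b)) ⟩
          f a (a + d) + (f c b + f (a + d) c)    ≡⟨ sym (+-assoc (f a (a + d)) (f c b) (f (a + d) c)) ⟩
          f a (a + d) + f c b + f (a + d) c      ∎

      strips-light : ∀ {a b c d h} → c + d ≡ b → d ≤ 2 * h → h * H ≤ wt a b → suc J * (wt a (a + d) + wt c b) ≤ wt a b
      strips-light {a} {b} {c} {d} {h} refl d≤2h hH = begin
        suc J * (wt a (a + d) + wt c (c + d))  ≤⟨ *-monoʳ-≤ (suc J) (+-mono-≤ (wt≤width a d) (wt≤width c d)) ⟩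
        suc J * (Z * d + Z * d)                ≡⟨ eq (suc J) Z d ⟩
        suc J * (2 * Z) * d                    ≤⟨ *-monoʳ-≤ (suc J * (2 * Z)) d≤2h ⟩
        suc J * (2 * Z) * (2 * h)              ≡⟨ eq′ (suc J) Z h ⟩
        h * (4 * Z * suc J)                    ≤⟨ hH ⟩
        wt a b                                 ∎
        where
        eq : ∀ Q Z d → Q * (Z * d + Z * d) ≡ Q * (2 * Z) * d
        eq = solve-∀
        eq′ : ∀ Q Z h → Q * (2 * Z) * (2 * h) ≡ h * (4 * Z * Q)
        eq′ = solve-∀

  -- Finding regular segments by passing to denser strips.

  module Build (par : Params) (C : Config (Params.Z par)) where
    open Params par
    open Levels par
    open Static C

    -- The least strip width tolerated for a segment: its strips start with twice as many ranks, and
    -- it is given up once fewer than this many remain.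
    half : ℕ → ℕ → ℕ
    half a b = wt a b / H

    half*H≤ : ∀ a b → half a b * H ≤ wt a b
    half*H≤ a b = m/n*n≤m (wt a b) H

    <half*H : ∀ a b → wt a b < suc (half a b) * H
    <half*H a b = begin-strict
      wt a b                           ≡⟨ m≡m%n+[m/n]*n (wt a b) H ⟩
      wt a b % H + wt a b / H * H      <⟨ +-monoˡ-< (wt a b / H * H) (m%n<n (wt a b) H) ⟩
      H + wt a b / H * H               ∎

    half≥T : ∀ a b → H * T ≤ wt a b → T ≤ half a b
    half≥T a b h = s≤s⁻¹ (*-cancelʳ-< H T (suc (half a b)) (≤-<-trans (≤-trans (≤-reflexive (*-comm T H)) h) (<half*H a b)))

    record Dense (i s a b : ℕ) : Set where
      constructor mkDense
      field
        a′ b′ f  : ℕ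
        a≤a′     : a ≤ a′
        a′<b′    : a′ < b′
        b′≤b     : b′ ≤ b
        regular  : Regular a′ b′ (half a′ b′) (2 * half a′ b′)
        attained : Reached i (s + f) a′ b′
        denser   : DenseBy (X 0 f) (Y 0 f) (wt a b) (len a b) (wt a′ b′) (len a′ b′)
        heavier  : wt a b ≤ wt a′ b′ * (2 * H) ^ f
        lighter  : wt a′ b′ ≤ wt a b

    DenseBy-refl : ∀ w L → DenseBy (X 0 0) (Y 0 0) w L w L
    DenseBy-refl w L = ≤-reflexive (cong (w * L *_) (trans (cong (λ e → 1 * suc M ^ e) (*-zeroʳ J)) (sym (cong (λ e → 1 * M ^ e) (*-zeroʳ J)))))

    -- A segment that is not regular has a denser strip at one of its ends; this must stop since
    -- the density is bounded.
    densify : ∀ fuel {i s a b} → i ≤ T → a < b → b ∸ a ≤ fuel → Reached i s a b → Dense i s a b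
    densify zero {a = a} {b} i≤T a<b le r = contradiction (≤-trans (m<n⇒0<n∸m a<b) le) λ ()
    densify (suc fuel) {i} {s} {a} {b} i≤T a<b le r = decide (anyUpTo? bad? (suc (2 * h)))
      where
      h = half a b
      hH = half*H≤ a b
      wt-large : H * T ≤ wt a b
      wt-large = reached⇒wt i≤T a<b r
      Bad : ℕ → Set
      Bad d = h ≤ d × wt (a + d) (b ∸ d) * len a b * suc M < wt a b * len (a + d) (b ∸ d) * M
      bad? : ∀ d → Dec (Bad d)
      bad? d = (h ≤? d) ×-dec (_ <? _)
      h≥1 : 1 ≤ h
      h≥1 = ≤-trans T≥1 (half≥T a b wt-large)
      decide : Dec (∃ λ d → d < suc (2 * h) × Bad d) → Dense i s a b
      decide (no ¬bad) = mkDense a b 0 ≤-refl a<b ≤-refl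
        (λ { d h≤d d≤2h c refl → ≮⇒≥ (λ lt → ¬bad (d , s≤s d≤2h , h≤d ,
               subst (λ c → wt (a + d) c * len a b * suc M < wt a b * len (a + d) c * M) (sym (m+n∸n≡m c d)) lt)) })
        (subst (λ s → Reached i s a b) (sym (+-identityʳ s)) r)
        (DenseBy-refl (wt a b) (len a b)) (≤-reflexive (sym (*-identityʳ _))) ≤-refl
      decide (yes (d , s≤s d≤2h , h≤d , fail)) = [ strip a (a + d) ≤-refl (m<m+n a d≥1) (≤-trans ad≤c c≤b) (m+n∸m≡n a d)
                                                 , strip c b (≤-trans (m≤m+n a d) ad≤c) c<b ≤-refl b∸c ]′ (mediant {M ^ J} {suc M ^ J} {wt a b} {len a b} {wt a (a + d)} {len a (a + d)} {wt c b} {len c b} gain)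
        where
        c = b ∸ d
        d≥1 : 1 ≤ d
        d≥1 = ≤-trans h≥1 h≤d
        d≤b : d ≤ b
        d≤b = ≤-trans (≤-trans (m≤m+n d d) (m≤n+m (d + d) a)) (room₂ {h = h} (<⇒≤ a<b) hH d≤2h)
        cd≡b : c + d ≡ b
        cd≡b = m∸n+n≡m d≤b
        c≤b : c ≤ b
        c≤b = m∸n≤m b d
        c<b : c < b
        c<b = <-≤-trans (m<m+n c d≥1) (≤-reflexive cd≡b)
        b∸c : b ∸ c ≡ d
        b∸c = trans (cong (_∸ c) (sym cd≡b)) (m+n∸m≡n c d)
        ad≤c : a + d ≤ c
        ad≤c = core≤ (room₂ {h = h} (<⇒≤ a<b) hH d≤2h) cd≡b
        c′ = M ∸ J
        J≤M : J ≤ M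
        J≤M = ≤-trans J≤T (m≤m+n T (T + 0))
        gain : DenseBy (M ^ J) (suc M ^ J) (wt a b) (len a b) (wt a (a + d) + wt c b) (len a (a + d) + len c b)
        gain = strip-dense M J c′ (cong suc (m+[n∸m]≡n J≤M)) (proj₁ (strips ad≤c cd≡b)) (proj₂ (strips ad≤c cd≡b))
          (strips-light {h = h} cd≡b d≤2h hH) fail
        -- A strip of d ≥ h ranks weighs at least h, and the whole weighs less than (h+1) H ≤ 2 h H;
        -- so a gain costs at most a factor 2 H of weight.
        wt-strip : ∀ x y → y ∸ x ≡ d → wt a b ≤ wt x y * (2 * H)
        wt-strip x y eq = begin
          wt a b               ≤⟨ <⇒≤ (<half*H a b) ⟩
          suc h * H            ≤⟨ *-monoˡ-≤ H (≤-trans (+-monoˡ-≤ h h≥1) (≤-reflexive (cong (h +_) (sym (+-identityʳ h))))) ⟩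
          2 * h * H            ≤⟨ *-monoˡ-≤ H (*-monoʳ-≤ 2 (≤-trans h≤d (≤-trans (≤-reflexive (sym eq)) (width≤wt x y)))) ⟩
          2 * wt x y * H       ≡⟨ e (wt x y) H ⟩
          wt x y * (2 * H)     ∎
          where
          e : ∀ w H → 2 * w * H ≡ w * (2 * H)
          e = solve-∀
        strip : ∀ x y → a ≤ x → x < y → y ≤ b → y ∸ x ≡ d → DenseBy (M ^ J) (suc M ^ J) (wt a b) (len a b) (wt x y) (len x y) → Dense i s a b
        strip x y a≤x x<y y≤b eq g = extend (densify fuel i≤T x<y short r₁)
          where
          g₁ : DenseBy (X 0 1) (Y 0 1) (wt a b) (len a b) (wt x y) (len x y)
          g₁ = dense-cast {X = M ^ J} {suc M ^ J} {X 0 1} {Y 0 1} {wt a b} {len a b} {wt x y} {len x y} (one M) (one (suc M)) g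
            where
            one : ∀ z → z ^ J ≡ 1 * z ^ (J * 1)
            one z = trans (cong (z ^_) (sym (*-identityʳ J))) (sym (*-identityˡ _))
          r₁ : Reached i (s + 1) x y
          r₁ = subst (λ i → Reached i (s + 1) x y) (+-identityʳ i)
            (reached-trans {i} {s} {0} {1} a<b r g₁ (≤-trans (wt-strip x y eq) (≤-reflexive (e (wt x y) (2 * H)))))
            where
            e : ∀ w H → w * H ≡ w * (1 * (H * 1))
            e = solve-∀
          short : y ∸ x ≤ fuel
          short = s≤s⁻¹ (<-≤-trans (≤-<-trans (≤-reflexive eq) d<) le)
            where
            d< : d < b ∸ a
            d< = m+n≤o⇒m≤o∸n (suc d) (≤-trans (≤-trans (+-monoˡ-≤ a (≤-trans (+-monoˡ-≤ d d≥1) ≤-refl)) (≤-reflexive (+-comm (d + d) a))) (room₂ {h = h} (<⇒≤ a<b) hH d≤2h))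
          extend : Dense i (s + 1) x y → Dense i s a b
          extend D = mkDense a′ b′ (suc f) (≤-trans a≤x a≤a′) a′<b′ (≤-trans b′≤b y≤b) regular
              (subst (λ s → Reached i s a′ b′) (+-assoc s 1 f) attained)
              (dense-cast {X 0 1 * X 0 f} {Y 0 1 * Y 0 f} {X 0 (suc f)} {Y 0 (suc f)} {wt a b} {len a b} {wt a′ b′} {len a′ b′} (XY-step (suc M) M 0 1 0 f) (XY-step M (suc M) 0 1 0 f)
                (dense-trans {X 0 1} {Y 0 1} {X 0 f} {Y 0 f} {wt a b} {len a b} {wt x y} {len x y} {wt a′ b′} {len a′ b′} {{>-nonZero (wt>0 x<y)}} {{>-nonZero (len>0 x<y)}} g₁ denser))
              (begin
                wt a b                                ≤⟨ wt-strip x y eq ⟩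
                wt x y * (2 * H)                      ≤⟨ *-monoˡ-≤ (2 * H) heavier ⟩
                wt a′ b′ * (2 * H) ^ f * (2 * H)      ≡⟨ e (wt a′ b′) ((2 * H) ^ f) (2 * H) ⟩
                wt a′ b′ * (2 * H * (2 * H) ^ f)      ∎)
              (≤-trans lighter (≤-trans (m≤n+m (wt x y) (wt a x + wt y b)) (≤-reflexive (whole a≤x (<⇒≤ x<y) y≤b))))
            where
            open Dense D
            e : ∀ w p H → w * p * H ≡ w * (H * p)
            e = solve-∀
            whole : ∀ {a x y b} → a ≤ x → x ≤ y → y ≤ b → wt a x + wt y b + wt x y ≡ wt a b
            whole {a} {x} {y} {b} p q r = begin-equality
              wt a x + wt y b + wt x y      ≡⟨ +-assoc (wt a x) (wt y b) (wt x y) ⟩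
              wt a x + (wt y b + wt x y)    ≡⟨ cong (wt a x +_) (trans (+-comm (wt y b) (wt x y)) (wt-split q r)) ⟩
              wt a x + wt x b               ≡⟨ wt-split p (≤-trans q r) ⟩
              wt a b                        ∎

  -- The chain of nested segments and its invariants.

  -- A segment of the chain, between the keys of ranks a and b.  The d ranks at either end have
  -- not been touched since its creation, u keys have been inserted since then, p and q are the
  -- weights of the segment and of its parent at that time, and f is the number of strips taken
  -- by densify.
  record Level : Set where
    constructor mkLevel
    field a b d h u p q f : ℕ

  -- Discrete intermediate value principle. It yields the weighted median of a core and, later,
  -- dyadic logarithms.
  crossing : ∀ {D : ℕ → Set} → (∀ k → Dec (D k)) → ∀ k → D 0 → ¬ D k → ∃ λ j → j < k × D j × ¬ D (suc j)
  crossing D? zero    d₀ ¬d = contradiction d₀ ¬d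
  crossing D? (suc k) d₀ ¬d with D? k
  ... | yes d = k , ≤-refl , d , ¬d
  ... | no ¬d′ = case crossing D? k d₀ ¬d′ of λ where (j , j<k , dj , ¬dj) → j , m≤n⇒m≤1+n j<k , dj , ¬dj

  module Activity (par : Params) where
    open Params par

    -- Active means that one more insertion stays below the cap 2 h G of the potential and is
    -- therefore rewarded in full.
    active : Level → ℕ
    active ℓ with T * suc (Level.u ℓ) ≤? 2 * Level.h ℓ * G
    ... | yes _ = 1
    ... | no  _ = 0

    idle : Level → ℕ
    idle ℓ with T * suc (Level.u ℓ) ≤? 2 * Level.h ℓ * G
    ... | yes _ = 0
    ... | no  _ = 1

    active+idle : ∀ ℓ → active ℓ + idle ℓ ≡ 1
    active+idle ℓ with T * suc (Level.u ℓ) ≤? 2 * Level.h ℓ * G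
    ... | yes _ = refl
    ... | no  _ = refl

  module Chains (par : Params) (C : Config (Params.Z par)) where
    open Params par
    open Levels par
    open Static C
    open Build par C
    open Activity par

    -- Every key goes into the core of the innermost segment, so a level and its parent have
    -- received the same `u` keys since the level was created: `p` and `q` determine both present
    -- weights. The lengths in `link` are the present ones, because the end keys have not moved.
    record LevelOK (pa pb pd : ℕ) (ℓ : Level) : Set where
      open Level ℓ
      field
        left    : pa + pd ≤ a
        a<b     : a < b
        right   : b + pd ≤ pb
        wt-own  : wt a b ≡ p + u
        wt-par  : wt pa pb ≡ q + u
        lighter : 4 * p ≤ 3 * q
        heavier : q ≤ p * (4 ^ 1 * (2 * H) ^ f)
        link    : DenseBy (X 1 f) (Y 1 f) q (len pa pb) p (len a b)
        h-low   : h * H ≤ p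
        h-high  : p < suc h * H
        T≤h     : T ≤ h
        h≤d     : h ≤ d
        d≤2h    : d ≤ 2 * h
        regular : Regular a b h d

    data Valid (pa pb pd : ℕ) : List Level → Set where
      []  : Valid pa pb pd []
      _∷_ : ∀ {ℓ ls} → LevelOK pa pb pd ℓ → Valid (Level.a ℓ) (Level.b ℓ) (Level.d ℓ) ls → Valid pa pb pd (ℓ ∷ ls)

    Core : (a b d : ℕ) → Set
    Core a b d = (∀ c → c + d ≡ b → a + d < c) × (∀ c → c + d ≡ b → 3 * wt a b ≤ 4 * wt (a + d) c) × CoreDense a b d

    module _ {pa pb pd ℓ} (ok : LevelOK pa pb pd ℓ) where
      open Level ℓ
      open LevelOK ok

      h≥1 : 1 ≤ h
      h≥1 = ≤-trans T≥1 T≤h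

      p>0 : 0 < p
      p>0 = ≤-trans (*-mono-≤ h≥1 H≥1) h-low

      q>0 : 0 < q
      q>0 = n≢0⇒n>0 λ { refl → contradiction (≤-trans (m≤n*m p 4) lighter) (<⇒≱ p>0) }

      hH≤wt : h * H ≤ wt a b
      hH≤wt = ≤-trans h-low (≤-trans (m≤m+n p u) (≤-reflexive (sym wt-own)))

      level-core : ∀ {e} → h ≤ e → e ≤ d → Core a b e
      level-core {e} h≤e e≤d = inside , heavy′ , regular e h≤e e≤d
        where
        e≤2h : e ≤ 2 * h
        e≤2h = ≤-trans e≤d d≤2h
        inside : ∀ c → c + e ≡ b → a + e < c
        inside c refl = +-cancelʳ-< e (a + e) c (begin-strict
          a + e + e                ≡⟨ +-assoc a e e ⟩
          a + (e + e)              ≤⟨ +-monoʳ-≤ a (≤-trans (+-mono-≤ e≤2h e≤2h) (≤-reflexive (eq h))) ⟩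
          a + 4 * h                <⟨ +-monoʳ-< a (<-≤-trans (*-monoˡ-< h {{>-nonZero h≥1}} {4} {4 * suc J} (*-monoʳ-< 4 (s≤s J≥1)))
                                        (room (<⇒≤ a<b) hH≤wt)) ⟩
          a + (c + e ∸ a)          ≡⟨ m+[n∸m]≡n (<⇒≤ a<b) ⟩
          c + e                    ∎)
          where
          eq : ∀ h → 2 * h + 2 * h ≡ 4 * h
          eq = solve-∀
        heavy′ : ∀ c → c + e ≡ b → 3 * wt a b ≤ 4 * wt (a + e) c
        heavy′ c eq = +-cancelʳ-≤ (4 * ws) (3 * wt a b) (4 * wt (a + e) c) (begin
          3 * wt a b + 4 * ws              ≤⟨ +-monoʳ-≤ (3 * wt a b) (*-monoˡ-≤ ws (s≤s (≤-trans 3≤8 (*-monoʳ-≤ 8 μ≥1)))) ⟩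
          3 * wt a b + suc J * ws          ≤⟨ +-monoʳ-≤ (3 * wt a b) (strips-light {h = h} eq e≤2h hH≤wt) ⟩
          3 * wt a b + wt a b              ≡⟨ e₁ (wt a b) ⟩
          4 * wt a b                       ≡⟨ cong (4 *_) (proj₁ (strips (<⇒≤ (inside c eq)) eq)) ⟩
          4 * (ws + wt (a + e) c)          ≡⟨ e₂ ws (wt (a + e) c) ⟩
          4 * wt (a + e) c + 4 * ws        ∎)
          where
          ws = wt a (a + e) + wt c b
          3≤8 : 3 ≤ 8
          3≤8 = s≤s (s≤s (s≤s z≤n))
          e₁ : ∀ w → 3 * w + w ≡ 4 * w
          e₁ = solve-∀
          e₂ : ∀ w v → 4 * (w + v) ≡ 4 * v + 4 * w
          e₂ = solve-∀

      p≤q : p ≤ q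
      p≤q = *-cancelˡ-≤ 4 (≤-trans lighter (*-monoˡ-≤ q (n≤1+n 3)))

      advance-by : ∀ {i s} x → pa < pb → Reached i s pa pb → (q + u) * p * Y 0 x ≤ (p + u) * q * X 0 x →
        Reached (i + 1) (s + (f + x)) a b
      advance-by {i} {s} x pa<pb r gain = reached-trans pa<pb r dns hvy
        where
        dns : DenseBy (X 1 (f + x)) (Y 1 (f + x)) (wt pa pb) (len pa pb) (wt a b) (len a b)
        dns = subst₂ (λ v w → DenseBy (X 1 (f + x)) (Y 1 (f + x)) v (len pa pb) w (len a b)) (sym wt-par) (sym wt-own)
          (dense-cast {X 1 f * X 0 x} {Y 1 f * Y 0 x} {X 1 (f + x)} {Y 1 (f + x)} {q + u} {len pa pb} {p + u} {len a b}
             (XY-step (suc M) M 1 f 0 x) (XY-step M (suc M) 1 f 0 x)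
             (link-insert {X 1 f} {Y 1 f} {X 0 x} {Y 0 x} {p} {q} {len pa pb} {len a b} u {{>-nonZero q>0}} link gain))
        hvy : wt pa pb ≤ wt a b * (4 ^ 1 * (2 * H) ^ (f + x))
        hvy = begin
          wt pa pb                                       ≡⟨ wt-par ⟩
          q + u                                          ≤⟨ +-mono-≤ heavier (m≤m*n u (4 ^ 1 * (2 * H) ^ f) {{nz}}) ⟩
          p * (4 ^ 1 * (2 * H) ^ f) + u * (4 ^ 1 * (2 * H) ^ f) ≡⟨ sym (*-distribʳ-+ (4 ^ 1 * (2 * H) ^ f) p u) ⟩
          (p + u) * (4 ^ 1 * (2 * H) ^ f)                ≤⟨ *-monoʳ-≤ (p + u) (*-monoʳ-≤ (4 ^ 1) (^-monoʳ-≤ (2 * H) {{2H}} (m≤m+n f x))) ⟩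
          (p + u) * (4 ^ 1 * (2 * H) ^ (f + x))          ≡⟨ cong (_* (4 ^ 1 * (2 * H) ^ (f + x))) (sym wt-own) ⟩
          wt a b * (4 ^ 1 * (2 * H) ^ (f + x))           ∎
          where
          2H = m*n≢0 2 H
          nz = m*n≢0 (4 ^ 1) ((2 * H) ^ f) {{_}} {{m^n≢0 (2 * H) f {{2H}}}}

      advance : ∀ {i s} → pa < pb → Reached i s pa pb → Reached (i + 1) (s + (f + 0)) a b
      advance pa<pb r = advance-by 0 pa<pb r (begin
        (q + u) * p * Y 0 0   ≡⟨ cong ((q + u) * p *_) Y≡1 ⟩
        (q + u) * p * 1       ≤⟨ *-monoˡ-≤ 1 (insert-ratio u p≤q) ⟩
        (p + u) * q * 1       ≡⟨ cong ((p + u) * q *_) (sym X≡1) ⟩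
        (p + u) * q * X 0 0   ∎)
        where
        X≡1 : X 0 0 ≡ 1
        X≡1 = cong (λ e → 1 * M ^ e) (*-zeroʳ J)
        Y≡1 : Y 0 0 ≡ 1
        Y≡1 = cong (λ e → 1 * suc M ^ e) (*-zeroʳ J)

      -- Not active means T (u+1) > 2 h G. As T ≤ h G, this leaves T u ≥ h G = 8 J H h, which is at
      -- least 4 J p because p < (h+1) H ≤ 2 h H. That is the hypothesis `insert-gain` asks for and
      -- the origin of `G` and of the cap.
      advance-idle : ∀ {i s} → pa < pb → Reached i s pa pb → Reached (i + 1) (s + (f + idle ℓ)) a b
      advance-idle pa<pb r with T * suc u ≤? 2 * h * G
      ... | yes _ = advance pa<pb r
      ... | no ¬act = advance-by 1 pa<pb r (subst₂ (λ y x → (q + u) * p * y ≤ (p + u) * q * x) (one (suc M)) (one M)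
              (insert-gain T J (suc M ∸ J) {p} {q} u {{>-nonZero (m<n⇒0<n∸m (s≤s J≤M))}} (m+[n∸m]≡n (m≤n⇒m≤1+n J≤M)) T-large lighter long))
        where
        J≤M : J ≤ M
        J≤M = ≤-trans J≤T (m≤m+n T (T + 0))
        one : ∀ z → z ^ J ≡ 1 * z ^ (J * 1)
        one z = trans (cong (z ^_) (sym (*-identityʳ J))) (sym (*-identityˡ _))
        long : 4 * J * p ≤ T * u
        long = ≤-trans (begin
            4 * J * p              ≤⟨ *-monoʳ-≤ (4 * J) (<⇒≤ h-high) ⟩
            4 * J * (suc h * H)    ≤⟨ *-monoʳ-≤ (4 * J) (*-monoˡ-≤ H (≤-trans (+-monoˡ-≤ h h≥1) (≤-reflexive (cong (h +_) (sym (+-identityʳ h)))))) ⟩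
            4 * J * (2 * h * H)    ≡⟨ e J h H ⟩
            h * (8 * H * J)        ∎)
          (+-cancelʳ-≤ (h * G) (h * G) (T * u) (begin
            h * G + h * G          ≡⟨ e′ h G ⟩
            2 * h * G              ≤⟨ <⇒≤ (≰⇒> ¬act) ⟩
            T * suc u              ≡⟨ trans (*-suc T u) (+-comm T (T * u)) ⟩
            T * u + T              ≤⟨ +-monoʳ-≤ (T * u) (≤-trans T≤h (m≤m*n h G {{m*n≢0 (8 * H) J {{m*n≢0 8 H}} {{>-nonZero J≥1}}}})) ⟩
            T * u + h * G          ∎))
          where
          e : ∀ J h H → 4 * J * (2 * h * H) ≡ h * (8 * H * J)
          e = solve-∀
          e′ : ∀ h G → h * G + h * G ≡ 2 * h * G
          e′ = solve-∀

    Fresh : Level → Set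
    Fresh ℓ = Level.u ℓ ≡ 0 × Level.d ℓ ≡ 2 * Level.h ℓ

    -- The core, at least 3/4 of the parent by weight, is cut at its weighted median; each half then
    -- has between 1/4 and 3/4 of the weight of the parent. One of them is dense enough by `mediant`
    -- and is handed to `densify`.
    child : ∀ {i s pa pb pd} c → c + pd ≡ pb → suc i ≤ T → pa < pb → Reached i s pa pb → Core pa pb pd →
      Σ[ ℓ ∈ Level ] (LevelOK pa pb pd ℓ × Fresh ℓ)
    child {i} {s} {pa} {pb} {pd} y y≡ i<T pa<pb r (in′ , hv , dn) = split (crossing (λ k → _ ≤? _) (y ∸ x) base top)
      where
      x = pa + pd
      W = wt pa pb
      L = len pa pb
      wc = wt x y
      x<y : x < y
      x<y = in′ y y≡
      wt-self : ∀ k → wt k k ≡ 0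
      wt-self k = n∸n≡0 (ω k)
      base : 2 * wt x (x + 0) ≤ wc
      base = ≤-trans (≤-reflexive (cong (2 *_) (trans (cong (wt x) (+-identityʳ x)) (wt-self x)))) z≤n
      top : ¬ 2 * wt x (x + (y ∸ x)) ≤ wc
      top le = contradiction (≤-trans (≤-reflexive (cong (λ z → 2 * wt x z) (sym (m+[n∸m]≡n (<⇒≤ x<y))))) le)
        (<⇒≱ (m<m+n wc (≤-trans (wt>0 x<y) (≤-reflexive (sym (+-identityʳ wc))))))
      -- The cut misses the exact median by at most one key, of weight at most `Z`; this bound
      -- absorbs the error.
      8Z≤W : 8 * Z ≤ W
      8Z≤W = ≤-trans (≤-trans (≤-trans (≤-reflexive (e Z)) (*-monoʳ-≤ (4 * Z) (s≤s J≥1))) (m≤m*n H T)) (reached⇒wt (<⇒≤ i<T) pa<pb r)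
        where
        e : ∀ Z → 8 * Z ≡ 4 * Z * 2
        e = solve-∀
      wc≤W : wc ≤ W
      wc≤W = subst (λ z → wc ≤ wt pa z) y≡ (≤-trans (≤-trans (m≤n+m wc (wt pa x)) (≤-reflexive (wt-split (m≤m+n pa pd) (<⇒≤ x<y))))
               (≤-trans (m≤m+n (wt pa y) (wt y (y + pd))) (≤-reflexive (wt-split (≤-trans (m≤m+n pa pd) (<⇒≤ x<y)) (m≤m+n y pd)))))
      Piece : ℕ → ℕ → Set
      Piece a b = DenseBy (suc M) M W L (wt a b) (len a b)
      finish : ∀ a b → a < b → x ≤ a → b ≤ y → W ≤ 4 * wt a b → 4 * wt a b ≤ 3 * W → Piece a b → Σ[ ℓ ∈ Level ] (LevelOK pa pb pd ℓ × Fresh ℓ)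
      finish a b a<b x≤a b≤y hvy lgt pc = build (densify (b ∸ a) (≤-trans (≤-reflexive (+-comm i 1)) i<T) a<b ≤-refl r₁)
        where
        d₁ : DenseBy (X 1 0) (Y 1 0) W L (wt a b) (len a b)
        d₁ = dense-cast {suc M} {M} {X 1 0} {Y 1 0} {W} {L} {wt a b} {len a b} (one (suc M) M) (one M (suc M)) pc
          where
          one : ∀ u v → u ≡ u ^ 1 * v ^ (J * 0)
          one u v = sym (trans (cong₂ _*_ (*-identityʳ u) (cong (v ^_) (*-zeroʳ J))) (*-identityʳ u))
        r₁ : Reached (i + 1) (s + 0) a b
        r₁ = reached-trans pa<pb r d₁ (≤-trans hvy (≤-reflexive (*-comm 4 (wt a b))))
        build : Dense (i + 1) (s + 0) a b → Σ[ ℓ ∈ Level ] (LevelOK pa pb pd ℓ × Fresh ℓ)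
        build D = mkLevel a′ b′ (2 * half a′ b′) (half a′ b′) 0 (wt a′ b′) W f , record
          { left = ≤-trans x≤a a≤a′
          ; a<b = a′<b′
          ; right = ≤-trans (+-monoˡ-≤ pd (≤-trans b′≤b b≤y)) (≤-reflexive y≡)
          ; wt-own = sym (+-identityʳ _)
          ; wt-par = sym (+-identityʳ _)
          ; lighter = ≤-trans (*-monoʳ-≤ 4 lighter) lgt
          ; heavier = begin
              W                                       ≤⟨ hvy ⟩
              4 * wt a b                              ≤⟨ *-monoʳ-≤ 4 heavier ⟩
              4 * (wt a′ b′ * (2 * H) ^ f)            ≡⟨ e (wt a′ b′) ((2 * H) ^ f) ⟩
              wt a′ b′ * (4 ^ 1 * (2 * H) ^ f)        ∎
          ; link = dense-cast {X 1 0 * X 0 f} {Y 1 0 * Y 0 f} {X 1 f} {Y 1 f} {W} {L} {wt a′ b′} {len a′ b′} (XY-step (suc M) M 1 0 0 f) (XY-step M (suc M) 1 0 0 f)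
                (dense-trans {X 1 0} {Y 1 0} {X 0 f} {Y 0 f} {W} {L} {wt a b} {len a b} {wt a′ b′} {len a′ b′} {{>-nonZero (wt>0 a<b)}} {{>-nonZero (len>0 a<b)}} d₁ denser)
          ; h-low = half*H≤ a′ b′
          ; h-high = <half*H a′ b′
          ; T≤h = half≥T a′ b′ (reached⇒wt (≤-trans (≤-reflexive (+-comm i 1)) i<T) a′<b′ attained)
          ; h≤d = m≤m+n (half a′ b′) (half a′ b′ + 0)
          ; d≤2h = ≤-refl
          ; regular = regular
          } , refl , refl
          where
          open Dense D
          e : ∀ w p → 4 * (w * p) ≡ w * (4 ^ 1 * p)
          e = solve-∀
      split : (∃ λ j → j < y ∸ x × 2 * wt x (x + j) ≤ wc × ¬ 2 * wt x (x + suc j) ≤ wc) → Σ[ ℓ ∈ Level ] (LevelOK pa pb pd ℓ × Fresh ℓ)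
      split (j , j< , lo , ¬hi) = [ finish x z x<z ≤-refl (<⇒≤ z<y) left-heavy left-light , finish z y z<y x≤z ≤-refl right-heavy right-light ]′
          (mediant {suc M} {M} {W} {L} {wl} {len x z} {wr} {len z y} whole)
        where
        z = x + j
        wl = wt x z
        wr = wt z y
        x≤z : x ≤ z
        x≤z = m≤m+n x j
        z<y : z < y
        z<y = <-≤-trans (+-monoʳ-< x j<) (≤-reflexive (m+[n∸m]≡n (<⇒≤ x<y)))
        whole : DenseBy (suc M) M W L (wl + wr) (len x z + len z y)
        whole = subst₂ (DenseBy (suc M) M W L) (sym (wt-split x≤z (<⇒≤ z<y))) (sym (len-split x≤z (<⇒≤ z<y))) (dn y y≡)
        sum : wl + wr ≡ wc
        sum = wt-split x≤z (<⇒≤ z<y)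
        next : wc ≤ 2 * (Z + wl)
        next = ≤-trans (<⇒≤ (≰⇒> ¬hi)) (*-monoʳ-≤ 2 (≤-trans (∸-monoˡ-≤ (ω x) (≤-trans (≤-reflexive (cong ω (+-suc x j))) (ω≤ z)))
          (≤-reflexive (+-∸-assoc Z (mono ω↑ x≤z)))))
        left-heavy : W ≤ 4 * wl
        left-heavy = *-cancelˡ-≤ 2 (+-cancelʳ-≤ W (2 * W) (2 * (4 * wl)) (begin
          2 * W + W                   ≡⟨ e₁ W ⟩
          3 * W                       ≤⟨ hv y y≡ ⟩
          4 * wc                      ≤⟨ *-monoʳ-≤ 4 next ⟩
          4 * (2 * (Z + wl))          ≡⟨ e₂ Z wl ⟩
          2 * (4 * wl) + 8 * Z        ≤⟨ +-monoʳ-≤ (2 * (4 * wl)) 8Z≤W ⟩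
          2 * (4 * wl) + W            ∎))
          where
          e₁ : ∀ W → 2 * W + W ≡ 3 * W
          e₁ = solve-∀
          e₂ : ∀ Z w → 4 * (2 * (Z + w)) ≡ 2 * (4 * w) + 8 * Z
          e₂ = solve-∀
        left-light : 4 * wl ≤ 3 * W
        left-light = begin
          4 * wl          ≡⟨ e wl ⟩
          2 * (2 * wl)    ≤⟨ *-monoʳ-≤ 2 lo ⟩
          2 * wc          ≤⟨ *-mono-≤ (n≤1+n 2) wc≤W ⟩
          3 * W           ∎
          where
          e : ∀ w → 4 * w ≡ 2 * (2 * w)
          e = solve-∀
        x<z : x < z
        x<z = ≤∧≢⇒< x≤z λ x≡z → contradiction (≤-trans left-heavy (≤-reflexive (cong (4 *_) (trans (cong (wt x) (sym x≡z)) (wt-self x)))))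
          (<⇒≱ (wt>0 pa<pb))
        right-heavy : W ≤ 4 * wr
        right-heavy = *-cancelˡ-≤ 2 (+-cancelˡ-≤ (4 * (2 * wl)) (2 * W) (2 * (4 * wr)) (begin
          4 * (2 * wl) + 2 * W              ≤⟨ +-monoʳ-≤ (4 * (2 * wl)) (≤-trans (*-monoˡ-≤ W (n≤1+n 2)) (hv y y≡)) ⟩
          4 * (2 * wl) + 4 * wc             ≤⟨ +-monoˡ-≤ (4 * wc) (*-monoʳ-≤ 4 lo) ⟩
          4 * wc + 4 * wc                   ≡⟨ cong (λ w → 4 * w + 4 * w) (sym sum) ⟩
          4 * (wl + wr) + 4 * (wl + wr)     ≡⟨ e wl wr ⟩
          4 * (2 * wl) + 2 * (4 * wr)       ∎))
          where
          e : ∀ l r → 4 * (l + r) + 4 * (l + r) ≡ 4 * (2 * l) + 2 * (4 * r)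
          e = solve-∀
        right-light : 4 * wr ≤ 3 * W
        right-light = +-cancelˡ-≤ (4 * wl) (4 * wr) (3 * W) (begin
          4 * wl + 4 * wr             ≡⟨ sym (*-distribˡ-+ 4 wl wr) ⟩
          4 * (wl + wr)               ≡⟨ cong (4 *_) sum ⟩
          4 * wc                      ≡⟨ e₁ wc ⟩
          2 * wc + 2 * wc             ≤⟨ +-mono-≤ (*-monoʳ-≤ 2 next) (*-monoʳ-≤ 2 wc≤W) ⟩
          2 * (2 * (Z + wl)) + 2 * W  ≡⟨ e₂ Z wl W ⟩
          4 * wl + (4 * Z + 2 * W)    ≤⟨ +-monoʳ-≤ (4 * wl) (+-monoˡ-≤ (2 * W) (≤-trans (*-monoˡ-≤ Z 4≤8) 8Z≤W)) ⟩
          4 * wl + (W + 2 * W)        ≡⟨ cong (4 * wl +_) refl ⟩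
          4 * wl + 3 * W              ∎)
          where
          4≤8 : 4 ≤ 8
          4≤8 = s≤s (s≤s (s≤s (s≤s z≤n)))
          e₁ : ∀ w → 4 * w ≡ 2 * w + 2 * w
          e₁ = solve-∀
          e₂ : ∀ Z w W → 2 * (2 * (Z + w)) + 2 * W ≡ 4 * w + (4 * Z + 2 * W)
          e₂ = solve-∀

    fresh-chain : ∀ r {i s pa pb pd} → i + r ≡ T → pd ≤ pb → pa < pb → Reached i s pa pb → Core pa pb pd →
      Σ[ ls ∈ List Level ] (Valid pa pb pd ls × length ls ≡ r × All Fresh ls)
    fresh-chain zero    _ _ _ _ _ = [] , [] , refl , []
    fresh-chain (suc r) {i} {s} {pa} {pb} {pd} e pd≤pb pa<pb reach core = extend (child (pb ∸ pd) (m∸n+n≡m pd≤pb) i<T pa<pb reach core)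
      where
      i<T : suc i ≤ T
      i<T = ≤-trans (m≤m+n (suc i) r) (≤-reflexive (trans (sym (+-suc i r)) e))
      extend : Σ[ ℓ ∈ Level ] (LevelOK pa pb pd ℓ × Fresh ℓ) → Σ[ ls ∈ List Level ] (Valid pa pb pd ls × length ls ≡ suc r × All Fresh ls)
      extend (ℓ , ok , fr) = attach (fresh-chain r {i + 1} {s + (f + 0)} {a} {b} {d} (trans (+-assoc i 1 r) e) d≤b (LevelOK.a<b ok) (advance ok pa<pb reach) (level-core ok (LevelOK.h≤d ok) ≤-refl))
        where
        open Level ℓ
        d≤b : d ≤ b
        d≤b = ≤-trans (≤-trans (m≤m+n d d) (m≤n+m (d + d) a)) (room₂ {h = h} (<⇒≤ (LevelOK.a<b ok)) (hH≤wt ok) (LevelOK.d≤2h ok))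
        attach : Σ[ ls ∈ List Level ] (Valid a b d ls × length ls ≡ r × All Fresh ls) → Σ[ ls ∈ List Level ] (Valid pa pb pd ls × length ls ≡ suc r × All Fresh ls)
        attach (ls , v , len≡ , frs) = ℓ ∷ ls , ok ∷ v , cong suc len≡ , fr ∷ frs

  -- The gap between the keys of ranks g and g + 1 lies in the core of the last segment.
  Deep : (g pa pb pd : ℕ) → List Level → Set
  Deep g pa pb pd []       = pa + pd ≤ g × g + pd < pb
  Deep g pa pb pd (ℓ ∷ ls) = Deep g (Level.a ℓ) (Level.b ℓ) (Level.d ℓ) ls

  -- The potential and its change in one move.

  module Potential (par : Params) where
    open Params par
    open Levels par
    open Activity par

    total : (Level → ℕ) → List Level → ℕ
    total v []       = 0
    total v (ℓ ∷ ls) = v ℓ + total v ls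

    -- The potential of a level is the difference `up` - `base`, kept as two naturals to avoid
    -- subtraction. It is 0 for a fresh level; thanks to the cap it is at most 0 once d has shrunk
    -- to h, so giving up an exhausted level loses nothing.
    up base : Level → ℕ
    up ℓ   = (T * Level.u ℓ ⊓ (2 * Level.h ℓ * G)) + 2 * Level.d ℓ * G
    base ℓ = 4 * Level.h ℓ * G

    G≥1 : 1 ≤ G
    G≥1 = *-mono-≤ {1} {8 * H} {1} {J} (≤-trans H≥1 (m≤n*m H 8)) J≥1

    active≤1 : ∀ ℓ → active ℓ ≤ 1
    active≤1 ℓ = ≤-trans (m≤m+n (active ℓ) (idle ℓ)) (≤-reflexive (active+idle ℓ))

    up-grows : ∀ T u K {act} → (act ≡ 1 → T * suc u ≤ K) → act ≤ 1 → (T * u ⊓ K) + T * act ≤ T * suc u ⊓ K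
    up-grows T u K {zero}  _ _ = ≤-trans (≤-reflexive (trans (cong ((T * u ⊓ K) +_) (*-zeroʳ T)) (+-identityʳ _)))
      (⊓-monoˡ-≤ K (*-monoʳ-≤ T (n≤1+n u)))
    up-grows T u K {suc zero} h _ = begin
      (T * u ⊓ K) + T * 1   ≤⟨ +-mono-≤ (m⊓n≤m (T * u) K) (≤-reflexive (*-identityʳ T)) ⟩
      T * u + T             ≡⟨ trans (+-comm (T * u) T) (sym (*-suc T u)) ⟩
      T * suc u             ≤⟨ ⊓-glb ≤-refl (h refl) ⟩
      T * suc u ⊓ K         ∎
    up-grows T u K {suc (suc _)} _ (s≤s ())

    active⇒ : ∀ ℓ → active ℓ ≡ 1 → T * suc (Level.u ℓ) ≤ 2 * Level.h ℓ * G
    active⇒ ℓ e with T * suc (Level.u ℓ) ≤? 2 * Level.h ℓ * G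
    ... | yes p = p
    active⇒ ℓ () | no _

    fresh-up : ∀ {ls} → All (λ ℓ → Level.u ℓ ≡ 0 × Level.d ℓ ≡ 2 * Level.h ℓ) ls → total up ls ≡ total base ls
    fresh-up [] = refl
    fresh-up {ℓ ∷ ls} ((u≡0 , d≡2h) ∷ fr) = cong₂ _+_ one (fresh-up fr)
      where
      K = 2 * Level.h ℓ * G
      eq : ∀ h G → 2 * (2 * h) * G ≡ 4 * h * G
      eq = solve-∀
      one : up ℓ ≡ base ℓ
      one = begin-equality
        (T * Level.u ℓ ⊓ K) + 2 * Level.d ℓ * G     ≡⟨ cong (λ u → (T * u ⊓ K) + 2 * Level.d ℓ * G) u≡0 ⟩
        (T * 0 ⊓ K) + 2 * Level.d ℓ * G             ≡⟨ cong (λ z → (z ⊓ K) + 2 * Level.d ℓ * G) (*-zeroʳ T) ⟩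
        2 * Level.d ℓ * G                           ≡⟨ cong (λ d → 2 * d * G) d≡2h ⟩
        2 * (2 * Level.h ℓ) * G                     ≡⟨ eq (Level.h ℓ) G ⟩
        base ℓ                                      ∎

  module Depth (par : Params) (C : Config (Params.Z par)) where
    open Potential par
    open Chains par C

    -- The strips of nested segments are disjoint and all lie between the gap and the ends of the
    -- outermost one. Hence a run around the gap that leaves a segment is at least as long as all
    -- strips on one side of the gap together.
    deep-dist : ∀ {g pa pb pd ls} → Valid pa pb pd ls → Deep g pa pb pd ls → pa + pd + total Level.d ls ≤ g × g + pd + total Level.d ls < pb
    deep-dist {g} {pa} {pb} {pd} [] (l , r) = ≤-trans (≤-reflexive (+-identityʳ _)) l , ≤-trans (s≤s (≤-reflexive (+-identityʳ _))) r
    deep-dist {g} {pa} {pb} {pd} {ℓ ∷ ls} (ok ∷ v) dp with deep-dist v dp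
    ... | l , r = ≤-trans (≤-trans (+-monoˡ-≤ (Level.d ℓ + total Level.d ls) (LevelOK.left ok)) (≤-reflexive (sym (+-assoc (Level.a ℓ) (Level.d ℓ) (total Level.d ls))))) l
                , ≤-trans (≤-trans (s≤s (≤-reflexive (e g pd (Level.d ℓ) (total Level.d ls)))) (+-monoˡ-≤ pd r)) (LevelOK.right ok)
      where
      e : ∀ g pd d t → g + pd + (d + t) ≡ g + d + t + pd
      e = solve-∀

  -- The hypotheses describe one lazy insertion above rank `g`: ranks up to `lo` keep their cells,
  -- ranks from `lo + c` on keep them under an index raised by one, and `c` counts the relocated
  -- keys including the new one.
  module Step (par : Params) (C C′ : Config (Params.Z par)) (g lo c : ℕ) (lo≤g : lo ≤ g) (g<hi : g < lo + c)
    (P-low : ∀ i → i ≤ lo → Config.P C′ i ≡ Config.P C i) (P-high : ∀ i → lo + c ≤ i → Config.P C′ (suc i) ≡ Config.P C i)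
    (ω-low : ∀ i → i ≤ g → Config.ω C′ i ≡ Config.ω C i) (ω-high : ∀ i → g < i → Config.ω C′ (suc i) ≡ suc (Config.ω C i)) where

    open Params par
    open Levels par
    open Activity par
    open Potential par
    module Old = Static C
    module New = Static C′
    module OldC = Chains par C
    module NewC = Chains par C′
    open Depth par C
    open Level using (a; b; d; h; u; p; q; f)

    hi : ℕ
    hi = lo + c

    new-wt : ∀ {x y} → x ≤ lo → hi ≤ y → New.wt x (suc y) ≡ suc (Old.wt x y)
    new-wt {x} {y} x≤lo hi≤y = trans (cong₂ _∸_ (ω-high y (<-≤-trans g<hi hi≤y)) (ω-low x (≤-trans x≤lo lo≤g)))
      (+-∸-assoc 1 (mono Old.ω↑ (≤-trans x≤lo (≤-trans (m≤m+n lo c) hi≤y))))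

    new-len : ∀ {x y} → x ≤ lo → hi ≤ y → New.len x (suc y) ≡ Old.len x y
    new-len {x} {y} x≤lo hi≤y = cong₂ _∸_ (P-high y hi≤y) (P-low x x≤lo)

    new-reached : ∀ {i s x y} → x ≤ lo → hi ≤ y → Old.Reached i s x y → New.Reached i s x (suc y)
    new-reached {i} {s} {x} {y} x≤lo hi≤y r = New.reached
      (begin
        W₀ * New.len x (suc y) * Y i s    ≡⟨ cong (λ l → W₀ * l * Y i s) (new-len x≤lo hi≤y) ⟩
        W₀ * Old.len x y * Y i s          ≤⟨ Old.Reached.dense r ⟩
        Old.wt x y * N * X i s            ≤⟨ *-monoˡ-≤ (X i s) (*-monoˡ-≤ N wt≤) ⟩
        New.wt x (suc y) * N * X i s      ∎)
      (≤-trans (Old.Reached.heavy r) (*-monoˡ-≤ (4 ^ i * (2 * H) ^ s) wt≤))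
      where
      wt≤ : Old.wt x y ≤ New.wt x (suc y)
      wt≤ = ≤-trans (n≤1+n _) (≤-reflexive (sym (new-wt x≤lo hi≤y)))

    -- One key of weight 1 enters both the segment and its core, and the core is not longer, so the
    -- relative density of the core cannot drop.
    new-coreDense : ∀ {x y e} → x + e ≤ lo → hi + e ≤ y → Old.CoreDense x y e → New.CoreDense x (suc y) e
    new-coreDense {x} {y} {e} xe≤lo hi+e≤y dn zero eq = contradiction (≤-trans (≤-trans (s≤s (m≤n+m e hi)) (s≤s hi+e≤y)) (≤-reflexive (sym eq))) (<-irrefl refl)
    new-coreDense {x} {y} {e} xe≤lo hi+e≤y dn (suc z) eq = begin
        New.wt x (suc y) * New.len (x + e) (suc z) * M   ≡⟨ cong₂ (λ v l → v * l * M) (new-wt x≤lo hi≤y) (new-len xe≤lo hi≤z) ⟩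
        suc w * k * M                                    ≡⟨ e₁ w k M ⟩
        w * k * M + k * M                                ≤⟨ +-mono-≤ (dn z z+e) (*-mono-≤ k≤l (n≤1+n M)) ⟩
        v * l * suc M + l * suc M                        ≡⟨ e₂ v l M ⟩
        suc v * l * suc M                                ≡⟨ cong₂ (λ v l → v * l * suc M) (sym (new-wt xe≤lo hi≤z)) (sym (new-len x≤lo hi≤y)) ⟩
        New.wt (x + e) (suc z) * New.len x (suc y) * suc M ∎
      where
      z+e : z + e ≡ y
      z+e = suc-injective eq
      hi≤z : hi ≤ z
      hi≤z = +-cancelʳ-≤ e hi z (≤-trans hi+e≤y (≤-reflexive (sym z+e)))
      x≤lo : x ≤ lo
      x≤lo = ≤-trans (m≤m+n x e) xe≤lo
      hi≤y : hi ≤ y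
      hi≤y = ≤-trans (m≤m+n hi e) hi+e≤y
      w = Old.wt x y
      l = Old.len x y
      v = Old.wt (x + e) z
      k = Old.len (x + e) z
      k≤l : k ≤ l
      k≤l = ∸-mono (mono Old.P↑ (≤-trans (m≤m+n z e) (≤-reflexive z+e))) (mono Old.P↑ (m≤m+n x e))
      e₁ : ∀ w k M → suc w * k * M ≡ w * k * M + k * M
      e₁ = solve-∀
      e₂ : ∀ v l M → v * l * suc M + l * suc M ≡ suc v * l * suc M
      e₂ = solve-∀

    new-core : ∀ {x y e} → x + e ≤ lo → hi + e ≤ y → OldC.Core x y e → NewC.Core x (suc y) e
    new-core {x} {y} {e} xe≤lo hi+e≤y (in′ , hv , dn) = inside , heavy′ , new-coreDense xe≤lo hi+e≤y dn
      where
      pred-eq : ∀ z → suc z + e ≡ suc y → z + e ≡ y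
      pred-eq z eq = suc-injective eq
      hi≤ : ∀ z → z + e ≡ y → hi ≤ z
      hi≤ z refl = +-cancelʳ-≤ e hi z hi+e≤y
      e<suc : e < suc y
      e<suc = s≤s (≤-trans (m≤n+m e hi) hi+e≤y)
      inside : ∀ z → z + e ≡ suc y → x + e < z
      inside zero    eq = contradiction e<suc (<-irrefl eq)
      inside (suc z) eq = m≤n⇒m≤1+n (in′ z (pred-eq z eq))
      heavy′ : ∀ z → z + e ≡ suc y → 3 * New.wt x (suc y) ≤ 4 * New.wt (x + e) z
      heavy′ zero    eq = contradiction e<suc (<-irrefl eq)
      heavy′ (suc z) eq = begin
        3 * New.wt x (suc y)          ≡⟨ cong (3 *_) (new-wt (≤-trans (m≤m+n x e) xe≤lo) (≤-trans (m≤m+n hi e) hi+e≤y)) ⟩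
        3 * suc (Old.wt x y)          ≡⟨ *-suc 3 (Old.wt x y) ⟩
        3 + 3 * Old.wt x y            ≤⟨ +-mono-≤ (n≤1+n 3) (hv z (pred-eq z eq)) ⟩
        4 + 4 * Old.wt (x + e) z      ≡⟨ sym (*-suc 4 (Old.wt (x + e) z)) ⟩
        4 * suc (Old.wt (x + e) z)    ≡⟨ cong (4 *_) (sym (new-wt xe≤lo (hi≤ z (pred-eq z eq)))) ⟩
        4 * New.wt (x + e) (suc z)    ∎

    -- The level after an insertion that leaves e ranks at either end untouched.
    grow : ℕ → Level → Level
    grow e ℓ = mkLevel (a ℓ) (suc (b ℓ)) e (h ℓ) (suc (u ℓ)) (p ℓ) (q ℓ) (f ℓ)

    grow-ok : ∀ {pa pb pd ℓ} e → OldC.LevelOK pa pb pd ℓ → h ℓ ≤ e → e ≤ d ℓ → a ℓ + e ≤ lo → hi + e ≤ b ℓ →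
      NewC.LevelOK pa (suc pb) pd (grow e ℓ)
    grow-ok {pa} {pb} {pd} {ℓ} e ok h≤e e≤d ae≤lo hie≤b = record
      { left = ok.left
      ; a<b = m≤n⇒m≤1+n ok.a<b
      ; right = s≤s ok.right
      ; wt-own = trans (new-wt a≤lo hi≤b) (trans (cong suc ok.wt-own) (sym (+-suc (p ℓ) (u ℓ))))
      ; wt-par = trans (new-wt (≤-trans (≤-trans (m≤m+n pa pd) ok.left) a≤lo) hi≤pb) (trans (cong suc ok.wt-par) (sym (+-suc (q ℓ) (u ℓ))))
      ; lighter = ok.lighter
      ; heavier = ok.heavier
      ; link = subst₂ (λ l k → DenseBy (X 1 (f ℓ)) (Y 1 (f ℓ)) (q ℓ) l (p ℓ) k) (sym (new-len (≤-trans (≤-trans (m≤m+n pa pd) ok.left) a≤lo) hi≤pb)) (sym (new-len a≤lo hi≤b)) ok.link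
      ; h-low = ok.h-low
      ; h-high = ok.h-high
      ; T≤h = ok.T≤h
      ; h≤d = h≤e
      ; d≤2h = ≤-trans e≤d ok.d≤2h
      ; regular = λ e′ h≤e′ e′≤e → new-coreDense (≤-trans (+-monoʳ-≤ (a ℓ) e′≤e) ae≤lo) (≤-trans (+-monoʳ-≤ hi e′≤e) hie≤b)
                    (ok.regular e′ h≤e′ (≤-trans e′≤e e≤d))
      }
      where
      module ok = OldC.LevelOK ok
      a≤lo : a ℓ ≤ lo
      a≤lo = ≤-trans (m≤m+n (a ℓ) e) ae≤lo
      hi≤b : hi ≤ b ℓ
      hi≤b = ≤-trans (m≤m+n hi e) hie≤b
      hi≤pb : hi ≤ pb
      hi≤pb = ≤-trans hi≤b (≤-trans (m≤m+n (b ℓ) pd) ok.right)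

    -- Of 5 c G, 2 c G belong to the level whose strips are eaten and 3 c G to the levels discarded
    -- below it. The single `T` is the reward of a level that is itself replaced; at most one level
    -- per move loses it in this way.
    Progress : List Level → List Level → Set
    Progress ls ls′ = total up ls + total base ls′ + T * total active ls ≤ total up ls′ + total base ls + 5 * c * G + T

    data Outcome (pa pb pd : ℕ) (ls : List Level) : Set where
      kept     : pa + pd ≤ lo → hi + pd ≤ pb → ∀ ls′ → NewC.Valid pa (suc pb) pd ls′ → length ls′ ≡ length ls → Progress ls ls′ → Outcome pa pb pd ls
      violated : total d ls ≤ c → Outcome pa pb pd ls

    d≥T : ∀ {pa pb pd ℓ} → OldC.LevelOK pa pb pd ℓ → T ≤ d ℓ
    d≥T ok = ≤-trans (OldC.LevelOK.T≤h ok) (OldC.LevelOK.h≤d ok)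

    -- A level holds potential at most 2 d G, since its cap is below `base`, and its reward `T` is
    -- at most d G because T ≤ d.
    discard : ∀ {pa pb pd ls} → OldC.Valid pa pb pd ls → total up ls + T * total active ls ≤ total base ls + 3 * total d ls * G
    discard OldC.[] = ≤-reflexive (trans (*-zeroʳ T) refl)
    discard {ls = ℓ ∷ ls} (ok OldC.∷ v) = begin
      up ℓ + total up ls + T * (active ℓ + total active ls)       ≡⟨ e₁ (up ℓ) (total up ls) T (active ℓ) (total active ls) ⟩
      (up ℓ + T * active ℓ) + (total up ls + T * total active ls) ≤⟨ +-mono-≤ one (discard v) ⟩
      (base ℓ + 3 * d ℓ * G) + (total base ls + 3 * total d ls * G) ≡⟨ e₂ (base ℓ) (total base ls) (d ℓ) (total d ls) G ⟩
      base ℓ + total base ls + 3 * (d ℓ + total d ls) * G         ∎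
      where
      e₁ : ∀ a b T x y → a + b + T * (x + y) ≡ (a + T * x) + (b + T * y)
      e₁ = solve-∀
      e₂ : ∀ a b x y G → (a + 3 * x * G) + (b + 3 * y * G) ≡ a + b + 3 * (x + y) * G
      e₂ = solve-∀
      one : up ℓ + T * active ℓ ≤ base ℓ + 3 * d ℓ * G
      one = begin
        up ℓ + T * active ℓ                     ≤⟨ +-mono-≤ (+-monoˡ-≤ (2 * d ℓ * G) (m⊓n≤n (T * u ℓ) (2 * h ℓ * G)))
                                                    (≤-trans (*-monoʳ-≤ T (active≤1 ℓ)) (≤-trans (≤-reflexive (*-identityʳ T)) (≤-trans (d≥T ok) (m≤m*n (d ℓ) G {{>-nonZero G≥1}})))) ⟩
        2 * h ℓ * G + 2 * d ℓ * G + d ℓ * G     ≤⟨ +-monoˡ-≤ (d ℓ * G) (+-monoˡ-≤ (2 * d ℓ * G) (*-monoˡ-≤ G (*-monoˡ-≤ (h ℓ) (s≤s (s≤s (z≤n {2})))))) ⟩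
        base ℓ + 2 * d ℓ * G + d ℓ * G          ≡⟨ e₃ (base ℓ) (d ℓ) G ⟩
        base ℓ + 3 * d ℓ * G                    ∎
        where
        e₃ : ∀ b d G → b + 2 * d * G + d * G ≡ b + 3 * d * G
        e₃ = solve-∀

    replaced : ∀ {pa pb pd ls ls′} → OldC.Valid pa pb pd ls → total d ls ≤ c → total up ls′ ≡ total base ls′ →
      total up ls + total base ls′ + T * total active ls ≤ total up ls′ + total base ls + 3 * c * G
    replaced {ls = ls} {ls′} v t≤c fr = begin
      total up ls + total base ls′ + T * total active ls      ≡⟨ e₁ (total up ls) (total base ls′) (T * total active ls) ⟩
      total base ls′ + (total up ls + T * total active ls)    ≤⟨ +-mono-≤ (≤-reflexive (sym fr)) (≤-trans (discard v) (+-monoʳ-≤ (total base ls) (*-monoˡ-≤ G (*-monoʳ-≤ 3 t≤c)))) ⟩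
      total up ls′ + (total base ls + 3 * c * G)              ≡⟨ sym (+-assoc (total up ls′) (total base ls) (3 * c * G)) ⟩
      total up ls′ + total base ls + 3 * c * G                ∎
      where
      e₁ : ∀ x y z → x + y + z ≡ y + (x + z)
      e₁ = solve-∀

    grow-up : ∀ {pa pb pd} ℓ e k → OldC.LevelOK pa pb pd ℓ → d ℓ ≤ e + k →
      up ℓ + base (grow e ℓ) + T * active ℓ ≤ up (grow e ℓ) + base ℓ + 2 * k * G
    grow-up ℓ e k ok d≤ = begin
      (m + 2 * d ℓ * G) + base ℓ + T * active ℓ       ≡⟨ e₁ m (2 * d ℓ * G) (base ℓ) (T * active ℓ) ⟩
      (m + T * active ℓ) + 2 * d ℓ * G + base ℓ       ≤⟨ +-monoˡ-≤ (base ℓ) (+-mono-≤ (up-grows T (u ℓ) (2 * h ℓ * G) (active⇒ ℓ) (active≤1 ℓ)) (*-monoˡ-≤ G (*-monoʳ-≤ 2 d≤))) ⟩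
      m′ + 2 * (e + k) * G + base ℓ                   ≡⟨ e₂ m′ e k G (base ℓ) ⟩
      m′ + 2 * e * G + base ℓ + 2 * k * G             ∎
      where
      m  = T * u ℓ ⊓ (2 * h ℓ * G)
      m′ = T * suc (u ℓ) ⊓ (2 * h ℓ * G)
      e₁ : ∀ m d b t → (m + d) + b + t ≡ (m + t) + d + b
      e₁ = solve-∀
      e₂ : ∀ m e k G b → m + 2 * (e + k) * G + b ≡ m + 2 * e * G + b + 2 * k * G
      e₂ = solve-∀

    -- Recursion from the outside inwards: the outcome for the levels below decides whether a level
    -- merely counts the insertion, gives up `c` ranks of its strips, or is replaced together with
    -- everything below it.
    process : ∀ {pa pb pd i s} ls → OldC.Valid pa pb pd ls → i + length ls ≡ T → pa < pb → Old.Reached i s pa pb → OldC.Core pa pb pd →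
      Deep g pa pb pd ls → pa ≤ lo → hi ≤ pb → Outcome pa pb pd ls
    -- Nothing has to be kept below the last level, so the run is treated as having crossed it; thus
    -- `c` ranks are charged to the strips of the last level itself.
    process [] v _ _ _ _ _ _ _ = violated z≤n
    process {pa} {pb} {pd} {i} {s} (ℓ ∷ ls) (ok OldC.∷ v) e pa<pb r core dp pa≤lo hi≤pb with a ℓ ≤? lo | hi ≤? b ℓ
    ... | no a≰lo | _ = violated (+-cancelˡ-≤ lo (d ℓ + total d ls) c (<⇒≤ (begin-strict
            lo + (d ℓ + total d ls)      <⟨ +-monoˡ-< (d ℓ + total d ls) (≰⇒> a≰lo) ⟩
            a ℓ + (d ℓ + total d ls)     ≡⟨ sym (+-assoc (a ℓ) (d ℓ) (total d ls)) ⟩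
            a ℓ + d ℓ + total d ls       ≤⟨ proj₁ (deep-dist v dp) ⟩
            g                            <⟨ g<hi ⟩
            lo + c                       ∎)))
    ... | yes _ | no hi≰b = violated (+-cancelˡ-≤ lo (d ℓ + total d ls) c (<⇒≤ (begin-strict
            lo + (d ℓ + total d ls)      ≤⟨ +-monoˡ-≤ (d ℓ + total d ls) lo≤g ⟩
            g + (d ℓ + total d ls)       ≡⟨ sym (+-assoc g (d ℓ) (total d ls)) ⟩
            g + d ℓ + total d ls         <⟨ proj₂ (deep-dist v dp) ⟩
            b ℓ                          <⟨ ≰⇒> hi≰b ⟩
            lo + c                       ∎)))
    ... | yes a≤lo | yes hi≤b = below (process ls v eᵢ a<b r₁ (OldC.level-core ok h≤d ≤-refl) dp a≤lo hi≤b)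
      where
      open OldC.LevelOK ok using (left; right; a<b; h≤d)
      r₁ : Old.Reached (i + 1) (s + (f ℓ + 0)) (a ℓ) (b ℓ)
      r₁ = OldC.advance ok pa<pb r
      eᵢ : i + 1 + length ls ≡ T
      eᵢ = trans (cong (_+ length ls) (+-comm i 1)) (trans (sym (+-suc i (length ls))) e)
      pl : pa + pd ≤ lo
      pl = ≤-trans left a≤lo
      ph : hi + pd ≤ pb
      ph = ≤-trans (+-monoˡ-≤ pd hi≤b) right
      below : Outcome (a ℓ) (b ℓ) (d ℓ) ls → Outcome pa pb pd (ℓ ∷ ls)
      below (kept ad≤lo hid≤b ls′ v′ len≡ prog) = kept pl ph (grow (d ℓ) ℓ ∷ ls′)
        (grow-ok (d ℓ) ok h≤d ≤-refl ad≤lo hid≤b NewC.∷ v′) (cong suc len≡) (begin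
          (up ℓ + U) + (base ℓ + B′) + T * (active ℓ + A)        ≡⟨ e₁ (up ℓ) U (base ℓ) B′ T (active ℓ) A ⟩
          (up ℓ + base ℓ + T * active ℓ) + (U + B′ + T * A)      ≤⟨ +-mono-≤ (grow-up ℓ (d ℓ) 0 ok (m≤m+n (d ℓ) 0)) prog ⟩
          (up ℓ₁ + base ℓ + 2 * 0 * G) + (U′ + B + 5 * c * G + T) ≡⟨ e₂ (up ℓ₁) (base ℓ) U′ B (5 * c * G) T ⟩
          (up ℓ₁ + U′) + (base ℓ + B) + 5 * c * G + T            ∎)
        where
        ℓ₁ = grow (d ℓ) ℓ
        U  = total up ls
        U′ = total up ls′
        B  = total base ls
        B′ = total base ls′
        A  = total active ls
        e₁ : ∀ x U y B T a A → (x + U) + (y + B) + T * (a + A) ≡ (x + y + T * a) + (U + B + T * A)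
        e₁ = solve-∀
        e₂ : ∀ x y U B z T → (x + y + 0) + (U + B + z + T) ≡ (x + U) + (y + B) + z + T
        e₂ = solve-∀
      below (violated t≤c) with h ℓ ≤? d ℓ ∸ c
      ... | yes h≤d′ = rebuild (NewC.fresh-chain (length ls) eᵢ (≤-trans (m≤n+m d′ hi) (m≤n⇒m≤1+n hi+d′≤b)) (m≤n⇒m≤1+n a<b) (new-reached a≤lo hi≤b r₁)
                          (new-core a+d′≤lo hi+d′≤b (OldC.level-core ok h≤d′ (m∸n≤m (d ℓ) c))))
        where
        d′ = d ℓ ∸ c
        a+d≤g : a ℓ + d ℓ ≤ g
        a+d≤g = ≤-trans (m≤m+n (a ℓ + d ℓ) (total d ls)) (proj₁ (deep-dist v dp))
        g+d<b : g + d ℓ < b ℓ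
        g+d<b = ≤-<-trans (m≤m+n (g + d ℓ) (total d ls)) (proj₂ (deep-dist v dp))
        c≤d : c ≤ d ℓ
        c≤d = <⇒≤ (m∸n≢0⇒n<m λ z → contradiction (≤-trans (OldC.h≥1 ok) (≤-trans h≤d′ (≤-reflexive z))) λ ())
        -- The gap lies beyond both strips and the run around it spans `c` ranks, so it eats at most
        -- `c` from either strip.
        a+d′≤lo : a ℓ + d′ ≤ lo
        a+d′≤lo = +-cancelʳ-≤ c (a ℓ + d′) lo (≤-trans (≤-reflexive (trans (+-assoc (a ℓ) d′ c) (cong (a ℓ +_) (m∸n+n≡m c≤d)))) (≤-trans a+d≤g (<⇒≤ g<hi)))
        hi+d′≤b : hi + d′ ≤ b ℓ
        hi+d′≤b = ≤-trans (≤-reflexive (trans (+-assoc lo c d′) (cong (lo +_) (m+[n∸m]≡n c≤d)))) (≤-trans (+-monoˡ-≤ (d ℓ) lo≤g) (<⇒≤ g+d<b))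
        rebuild : Σ[ ls′ ∈ List Level ] (NewC.Valid (a ℓ) (suc (b ℓ)) d′ ls′ × length ls′ ≡ length ls × All NewC.Fresh ls′) → Outcome pa pb pd (ℓ ∷ ls)
        rebuild (ls′ , v′ , len≡ , fr) = kept pl ph (grow d′ ℓ ∷ ls′)
          (grow-ok d′ ok h≤d′ (m∸n≤m (d ℓ) c) a+d′≤lo hi+d′≤b NewC.∷ v′) (cong suc len≡) (≤-trans (begin
          (up ℓ + U) + (base ℓ + B′) + T * (active ℓ + A)        ≡⟨ e₁ (up ℓ) U (base ℓ) B′ T (active ℓ) A ⟩
          (up ℓ + base ℓ + T * active ℓ) + (U + B′ + T * A)      ≤⟨ +-mono-≤ (grow-up ℓ d′ c ok (≤-reflexive (sym (m∸n+n≡m c≤d)))) (replaced {ls′ = ls′} v t≤c (fresh-up fr)) ⟩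
          (up ℓ₁ + base ℓ + 2 * c * G) + (U′ + B + 3 * c * G)    ≡⟨ e₂ (up ℓ₁) (base ℓ) U′ B c G ⟩
          (up ℓ₁ + U′) + (base ℓ + B) + 5 * c * G                ∎) (m≤m+n _ T))
          where
          ℓ₁ = grow d′ ℓ
          U  = total up ls
          U′ = total up ls′
          B  = total base ls
          B′ = total base ls′
          A  = total active ls
          e₁ : ∀ x U y B T a A → (x + U) + (y + B) + T * (a + A) ≡ (x + y + T * a) + (U + B + T * A)
          e₁ = solve-∀
          e₂ : ∀ x y U B c G → (x + y + 2 * c * G) + (U + B + 3 * c * G) ≡ (x + U) + (y + B) + 5 * c * G
          e₂ = solve-∀
      ... | no h≰d′ = rebuild (NewC.fresh-chain (suc (length ls)) e (≤-trans (m≤n+m pd hi) (m≤n⇒m≤1+n ph)) (m≤n⇒m≤1+n pa<pb) (new-reached pa≤lo hi≤pb r) (new-core pl ph core))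
        where
        d≤h+c : d ℓ ≤ h ℓ + c
        d≤h+c = m∸n≤o⇒m≤n+o (<⇒≤ (≰⇒> h≰d′))
          where
          m∸n≤o⇒m≤n+o : d ℓ ∸ c ≤ h ℓ → d ℓ ≤ h ℓ + c
          m∸n≤o⇒m≤n+o le = ≤-trans (m≤n+m∸n (d ℓ) c) (≤-trans (+-monoʳ-≤ c le) (≤-reflexive (+-comm c (h ℓ))))
        rebuild : Σ[ ls′ ∈ List Level ] (NewC.Valid pa (suc pb) pd ls′ × length ls′ ≡ suc (length ls) × All NewC.Fresh ls′) → Outcome pa pb pd (ℓ ∷ ls)
        rebuild (ls′ , v′ , len≡ , fr) = kept pl ph ls′ v′ len≡ (begin
          (up ℓ + U) + B′ + T * (active ℓ + A)                   ≡⟨ e₁ (up ℓ) U B′ T (active ℓ) A ⟩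
          (up ℓ + T * active ℓ) + (U + B′ + T * A)               ≤⟨ +-mono-≤ dead (replaced {ls′ = ls′} v t≤c (fresh-up fr)) ⟩
          (base ℓ + 2 * c * G + T) + (U′ + B + 3 * c * G)        ≡⟨ e₂ (base ℓ) U′ B c G T ⟩
          U′ + (base ℓ + B) + 5 * c * G + T                      ∎)
          where
          U  = total up ls
          U′ = total up ls′
          B  = total base ls
          B′ = total base ls′
          A  = total active ls
          e₁ : ∀ x U B T a A → (x + U) + B + T * (a + A) ≡ (x + T * a) + (U + B + T * A)
          e₁ = solve-∀
          e₂ : ∀ y U B c G T → (y + 2 * c * G + T) + (U + B + 3 * c * G) ≡ U + (y + B) + 5 * c * G + T
          e₂ = solve-∀
          -- Fewer than h ranks would remain, so d ≤ h + c, and the cap leaves the level a potential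
          -- of at most 2 c G to lose.
          dead : up ℓ + T * active ℓ ≤ base ℓ + 2 * c * G + T
          dead = begin
            up ℓ + T * active ℓ                    ≤⟨ +-mono-≤ (+-mono-≤ (m⊓n≤n (T * u ℓ) (2 * h ℓ * G)) (*-monoˡ-≤ G (*-monoʳ-≤ 2 d≤h+c)))
                                                        (≤-trans (*-monoʳ-≤ T (active≤1 ℓ)) (≤-reflexive (*-identityʳ T))) ⟩
            2 * h ℓ * G + 2 * (h ℓ + c) * G + T    ≡⟨ e₃ (h ℓ) c G T ⟩
            base ℓ + 2 * c * G + T                 ∎
            where
            e₃ : ∀ h c G T → 2 * h * G + 2 * (h + c) * G + T ≡ 4 * h * G + 2 * c * G + T
            e₃ = solve-∀

    step : ∀ {e} ls → OldC.Valid 0 e 0 ls → length ls ≡ T → 0 < e → Old.Reached 0 0 0 e → OldC.Core 0 e 0 → Deep g 0 e 0 ls → hi ≤ e →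
      Σ[ ls′ ∈ List Level ] (NewC.Valid 0 (suc e) 0 ls′ × length ls′ ≡ T × Progress ls ls′)
    step {e} ls v len≡ 0<e r core dp hi≤e = finish (process ls v len≡ 0<e r core dp z≤n hi≤e)
      where
      Goal : Set
      Goal = Σ[ ls′ ∈ List Level ] (NewC.Valid 0 (suc e) 0 ls′ × length ls′ ≡ T × Progress ls ls′)
      finish : Outcome 0 e 0 ls → Goal
      finish (kept _ _ ls′ v′ len′ prog) = ls′ , v′ , trans len′ len≡ , prog
      finish (violated t≤c) = rebuild (NewC.fresh-chain T refl z≤n (s≤s z≤n) (new-reached z≤n hi≤e r) (new-core z≤n (≤-trans (≤-reflexive (+-identityʳ hi)) hi≤e) core))
        where
        rebuild : Σ[ ls′ ∈ List Level ] (NewC.Valid 0 (suc e) 0 ls′ × length ls′ ≡ T × All NewC.Fresh ls′) → Goal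
        rebuild (ls′ , v′ , len′ , fr) = ls′ , v′ , len′ , ≤-trans (replaced {ls′ = ls′} v t≤c (fresh-up fr))
          (≤-trans (+-monoʳ-≤ (total up ls′ + total base ls) (*-monoˡ-≤ G (*-monoˡ-≤ c (s≤s (s≤s (s≤s (z≤n {2}))))))) (m≤m+n _ T))

  -- The innermost segment: where to insert, and how many levels are active.

  module Bottom (par : Params) (C : Config (Params.Z par)) where
    open Params par
    open Levels par
    open Activity par
    open Potential par
    open Static C
    open Chains par C
    open Depth par C

    gains : Level → ℕ
    gains ℓ = Level.f ℓ + idle ℓ

    record Lowest (i s pa pb pd : ℕ) (ls : List Level) : Set where
      constructor lowest
      field
        a b d     : ℕ
        a<b       : a < b
        b≤pb      : b ≤ pb
        attained  : Reached (i + length ls) (s + total gains ls) a b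
        core      : Core a b d
        d≤b       : d ≤ b
        deep      : ∀ {g} → a + d ≤ g → g + d < b → Deep g pa pb pd ls

    descend : ∀ {i s pa pb pd ls} → Valid pa pb pd ls → pa < pb → pd ≤ pb → Reached i s pa pb → Core pa pb pd → Lowest i s pa pb pd ls
    descend {i} {s} {pa} {pb} {pd} [] pa<pb pd≤pb r core = lowest pa pb pd pa<pb ≤-refl
      (subst₂ (λ i s → Reached i s pa pb) (sym (+-identityʳ i)) (sym (+-identityʳ s)) r) core pd≤pb _,_
    descend {i} {s} {pa} {pb} {pd} {ℓ ∷ ls} (ok ∷ v) pa<pb pd≤pb r core = lift (descend v (LevelOK.a<b ok) d≤b (advance-idle ok pa<pb r) (level-core ok (LevelOK.h≤d ok) ≤-refl))
      where
      open Level ℓ using (a; b; d; h)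
      d≤b : d ≤ b
      d≤b = ≤-trans (≤-trans (m≤m+n d d) (m≤n+m (d + d) a)) (room₂ {h = h} (<⇒≤ (LevelOK.a<b ok)) (hH≤wt ok) (LevelOK.d≤2h ok))
      lift : Lowest (i + 1) (s + gains ℓ) a b d ls → Lowest i s pa pb pd (ℓ ∷ ls)
      lift lw = lowest L.a L.b L.d L.a<b (≤-trans L.b≤pb (≤-trans (m≤m+n b pd) (LevelOK.right ok)))
        (subst₂ (λ i s → Reached i s L.a L.b) (+-assoc i 1 (length ls)) (+-assoc s (gains ℓ) (total gains ls)) L.attained) L.core L.d≤b L.deep
        where module L = Lowest lw

    total-active : ∀ ls → total active ls + total idle ls ≡ length ls
    total-active []       = refl
    total-active (ℓ ∷ ls) = trans (e (active ℓ) (total active ls) (idle ℓ) (total idle ls)) (cong₂ _+_ (active+idle ℓ) (total-active ls))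
      where
      e : ∀ a A i I → a + A + (i + I) ≡ (a + i) + (A + I)
      e = solve-∀

    idle≤gains : ∀ ls → total idle ls ≤ total gains ls
    idle≤gains []       = z≤n
    idle≤gains (ℓ ∷ ls) = +-mono-≤ (m≤n+m (idle ℓ) (Level.f ℓ)) (idle≤gains ls)

    record Target (e : ℕ) (ls : List Level) : Set where
      field
        x y      : ℕ
        x<y      : x < y
        y≤e      : y ≤ e
        deep     : ∀ {g} → x ≤ g → g < y → Deep g 0 e 0 ls
        dense    : W₀ * len x y ≤ 3 * N * wt x y
        heavy    : 3 * (H * T) ≤ 4 * wt x y
        busy     : 3 * T < 4 * total active ls

    -- Every idle level is a gain, so `few-gains` at the innermost segment leaves more than 3/4 of
    -- the levels active. The factor 3 in `dense` is 2 for the whole chain times (2T+1)/2T ≤ 3/2 for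
    -- passing to the last core.
    target : ∀ {e ls} → Valid 0 e 0 ls → length ls ≡ T → 0 < e → Reached 0 0 0 e → Core 0 e 0 → Target e ls
    target {e} {ls} v len≡ 0<e r core = locate (descend v 0<e z≤n r core)
      where
      locate : Lowest 0 0 0 e 0 ls → Target e ls
      locate (lowest a b d a<b b≤e att (in′ , hv , dn) d≤b dp) = record
        { x = a + d ; y = c ; x<y = in′ c c≡ ; y≤e = ≤-trans (m∸n≤m b d) b≤e
        ; deep = λ {g} x≤g g<y → dp x≤g (<-≤-trans (+-monoˡ-< d g<y) (≤-reflexive c≡))
        ; dense = dense′ ; heavy = ≤-trans (*-monoʳ-≤ 3 (reached⇒wt ≤-refl a<b att′)) (hv c c≡)
        ; busy = busy′ }
        where
        c = b ∸ d
        c≡ : c + d ≡ b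
        c≡ = m∸n+n≡m d≤b
        s = total gains ls
        att′ : Reached T s a b
        att′ = subst (λ i → Reached i s a b) len≡ att
        few : 4 * s < T
        few = reached⇒few ≤-refl a<b att′
        busy′ : 3 * T < 4 * total active ls
        busy′ = +-cancelʳ-< T (3 * T) (4 * total active ls) (begin-strict
          3 * T + T                                     ≡⟨ e₁ T ⟩
          4 * T                                         ≡⟨ cong (4 *_) (trans (sym len≡) (sym (total-active ls))) ⟩
          4 * (total active ls + total idle ls)         ≡⟨ *-distribˡ-+ 4 (total active ls) (total idle ls) ⟩
          4 * total active ls + 4 * total idle ls       ≤⟨ +-monoʳ-≤ (4 * total active ls) (*-monoʳ-≤ 4 (idle≤gains ls)) ⟩
          4 * total active ls + 4 * s                   <⟨ +-monoʳ-< (4 * total active ls) few ⟩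
          4 * total active ls + T                       ∎)
          where
          e₁ : ∀ T → 3 * T + T ≡ 4 * T
          e₁ = solve-∀
        w = wt a b
        l = len a b
        wc = wt (a + d) c
        lc = len (a + d) c
        X≤2Y : X T s ≤ 2 * Y T s
        X≤2Y = begin
          suc M ^ T * M ^ (J * s)            ≤⟨ *-mono-≤ (pow-bound {T} ≤-refl) (^-monoˡ-≤ (J * s) (n≤1+n M)) ⟩
          2 * M ^ T * suc M ^ (J * s)        ≡⟨ *-assoc 2 (M ^ T) (suc M ^ (J * s)) ⟩
          2 * Y T s                          ∎
        W₀l : W₀ * l ≤ 2 * (w * N)
        W₀l = *-cancelʳ-≤ (W₀ * l) (2 * (w * N)) (Y T s) {{m*n≢0 (M ^ T) (suc M ^ (J * s)) {{m^n≢0 M T}} {{m^n≢0 (suc M) (J * s)}}}} (begin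
          W₀ * l * Y T s           ≤⟨ Reached.dense att′ ⟩
          w * N * X T s            ≤⟨ *-monoʳ-≤ (w * N) X≤2Y ⟩
          w * N * (2 * Y T s)      ≡⟨ e₁ (w * N) (Y T s) ⟩
          2 * (w * N) * Y T s      ∎)
          where
          e₁ : ∀ a y → a * (2 * y) ≡ 2 * a * y
          e₁ = solve-∀
        dense′ : W₀ * lc ≤ 3 * N * wc
        dense′ = *-cancelʳ-≤ (W₀ * lc) (3 * N * wc) (w * M) {{m*n≢0 w M {{>-nonZero (wt>0 a<b)}}}} (begin
          W₀ * lc * (w * M)              ≡⟨ e₁ W₀ lc w M ⟩
          W₀ * (w * lc * M)              ≤⟨ *-monoʳ-≤ W₀ (dn c c≡) ⟩
          W₀ * (wc * l * suc M)          ≡⟨ e₂ W₀ wc l (suc M) ⟩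
          W₀ * l * (wc * suc M)          ≤⟨ *-monoˡ-≤ (wc * suc M) W₀l ⟩
          2 * (w * N) * (wc * suc M)     ≡⟨ e₃ w N wc T ⟩
          N * wc * w * (2 + 4 * T)       ≤⟨ *-monoʳ-≤ (N * wc * w) (≤-trans (+-monoˡ-≤ (4 * T) (*-monoʳ-≤ 2 T≥1)) (≤-reflexive (e₄ T))) ⟩
          N * wc * w * (3 * M)           ≡⟨ e₅ N wc w M ⟩
          3 * N * wc * (w * M)           ∎)
          where
          e₁ : ∀ W l w M → W * l * (w * M) ≡ W * (w * l * M)
          e₁ = solve-∀
          e₂ : ∀ W v l M → W * (v * l * M) ≡ W * l * (v * M)
          e₂ = solve-∀
          e₃ : ∀ w N v T → 2 * (w * N) * (v * suc (2 * T)) ≡ N * v * w * (2 + 4 * T)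
          e₃ = solve-∀
          e₄ : ∀ T → 2 * T + 4 * T ≡ 3 * (2 * T)
          e₄ = solve-∀
          e₅ : ∀ N v w M → N * v * w * (3 * M) ≡ 3 * N * v * (w * M)
          e₅ = solve-∀

    up≤ : ∀ {pa pb pd ls} → Valid pa pb pd ls → total up ls ≤ total base ls + 2 * G * total Level.d ls
    up≤ [] = z≤n
    up≤ {ls = ℓ ∷ ls} (ok ∷ v) = begin
      up ℓ + total up ls                                            ≤⟨ +-mono-≤ (+-monoˡ-≤ (2 * d * G) (m⊓n≤n (T * u) (2 * h * G))) (up≤ v) ⟩
      (2 * h * G + 2 * d * G) + (total base ls + 2 * G * total Level.d ls) ≤⟨ +-monoˡ-≤ (total base ls + 2 * G * total Level.d ls) (+-monoˡ-≤ (2 * d * G) (*-monoˡ-≤ G (*-monoˡ-≤ h (s≤s (s≤s (z≤n {2})))))) ⟩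
      (base ℓ + 2 * d * G) + (total base ls + 2 * G * total Level.d ls)    ≡⟨ e (base ℓ) d G (total base ls) (total Level.d ls) ⟩
      base ℓ + total base ls + 2 * G * (d + total Level.d ls)       ∎
      where
      open Level ℓ
      e : ∀ b d G B D → (b + 2 * d * G) + (B + 2 * G * D) ≡ b + B + 2 * G * (d + D)
      e = solve-∀

  n<2^n : ∀ n → n < 2 ^ n
  n<2^n zero    = z<s
  n<2^n (suc n) = begin-strict
    suc n            <⟨ s≤s (n<2^n n) ⟩
    1 + 2 ^ n        ≤⟨ +-monoˡ-≤ (2 ^ n) (m^n>0 2 n) ⟩
    2 ^ n + 2 ^ n    ≡⟨ cong (2 ^ n +_) (sym (+-identityʳ (2 ^ n))) ⟩
    2 ^ suc n        ∎

-- Arrays sorted by rank, and the reduction to lazy play.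

module LazyPlay where

  open import Data.Nat
  open import Data.Nat.Properties
  open import Data.Bool using (Bool; true; false; _∧_; if_then_else_)
  open import Data.Bool.Properties using (∧-zeroʳ)
  open import Data.Fin as Fin using (Fin; toℕ; fromℕ<)
  import Data.Fin.Properties as Finₚ
  open import Data.Product hiding (zip)
  open import Data.Sum using (_⊎_; inj₁; inj₂)
  open import Data.Vec using (Vec; []; _∷_; lookup; count; zip; head; tail)
  open import Data.Vec.Relation.Unary.All using (All; []; _∷_)
  open import Function using (_∘_)
  open import Relation.Binary.Definitions using (tri<; tri≈; tri>)
  open import Relation.Binary.PropositionalEquality
  open import Relation.Nullary using (Dec; yes; no; ¬_; ¬?; contradiction; does)
  open import Relation.Nullary.Decidable using (dec-true; dec-false)
  open LabelingGame using (StorageFunction; cells; strict; relocations)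

  -- The entry at position k, counted from 1 so that the junk value 0 occurs only beyond the end.
  nth : ∀ {m t} → Vec (Fin m) t → ℕ → ℕ
  nth []       _       = 0
  nth (x ∷ xs) zero    = suc (toℕ x)
  nth (x ∷ xs) (suc k) = nth xs k

  nth-lookup : ∀ {m t} (xs : Vec (Fin m) t) j → nth xs (toℕ j) ≡ suc (toℕ (lookup xs j))
  nth-lookup (x ∷ xs) Fin.zero    = refl
  nth-lookup (x ∷ xs) (Fin.suc j) = nth-lookup xs j

  nth-fromℕ< : ∀ {m t} (xs : Vec (Fin m) t) {k} (k<t : k < t) → nth xs k ≡ suc (toℕ (lookup xs (fromℕ< k<t)))
  nth-fromℕ< xs k<t = trans (cong (nth xs) (sym (Finₚ.toℕ-fromℕ< k<t))) (nth-lookup xs (fromℕ< k<t))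

  nth≤ : ∀ {m t} (xs : Vec (Fin m) t) k → nth xs k ≤ m
  nth≤ []       k       = z≤n
  nth≤ (x ∷ xs) zero    = Finₚ.toℕ<n x
  nth≤ (x ∷ xs) (suc k) = nth≤ xs k

  ins : {A : Set} → ℕ → A → (ℕ → A) → ℕ → A
  ins zero    v s zero    = v
  ins zero    v s (suc i) = s i
  ins (suc p) v s zero    = s zero
  ins (suc p) v s (suc i) = ins p v (s ∘ suc) i

  module _ {A : Set} where
    ins-low : ∀ {p i} (v : A) s → i < p → ins p v s i ≡ s i
    ins-low {suc p} {zero}  v s i<p       = refl
    ins-low {suc p} {suc i} v s (s≤s i<p) = ins-low v (s ∘ suc) i<p

    ins-at : ∀ p (v : A) s → ins p v s p ≡ v
    ins-at zero    v s = refl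
    ins-at (suc p) v s = ins-at p v (s ∘ suc)

    ins-high : ∀ {p i} (v : A) s → p ≤ i → ins p v s (suc i) ≡ s i
    ins-high {zero}          v s p≤i       = refl
    ins-high {suc p} {suc i} v s (s≤s p≤i) = ins-high v (s ∘ suc) p≤i

  data Place (p : ℕ) : ℕ → Set where
    low  : ∀ {i} → i < p → Place p i
    at   : Place p p
    high : ∀ {i} → p ≤ i → Place p (suc i)

  place : ∀ p i → Place p i
  place zero    zero    = at
  place zero    (suc i) = high z≤n
  place (suc p) zero    = low z<s
  place (suc p) (suc i) with place p i
  ... | low i<p  = low (s≤s i<p)
  ... | at       = at
  ... | high p≤i = high (s≤s p≤i)

  neq : ∀ {m} → Fin m → Fin m → ℕ
  neq c c′ = if does (c Finₚ.≟ c′) then 0 else 1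

  diff : ∀ {m t} → Vec (Fin m) t → Vec (Fin m) t → ℕ
  diff []       []       = 0
  diff (x ∷ xs) (y ∷ ys) = neq x y + diff xs ys

  relocations-diff : ∀ {m t} (old : Vec (Fin m) t) new → relocations old new ≡ suc (diff old (tail new))
  relocations-diff old (c ∷ new) = cong suc (go old new)
    where
    go : ∀ {m t} (xs ys : Vec (Fin m) t) → count (λ (c , c′) → ¬? (c Finₚ.≟ c′)) (zip xs ys) ≡ diff xs ys
    go []       []       = refl
    go (x ∷ xs) (y ∷ ys) with x Finₚ.≟ y
    ... | yes _ = go xs ys
    ... | no  _ = cong suc (go xs ys)

  neq-refl : ∀ {m} (c : Fin m) → neq c c ≡ 0
  neq-refl c with c Finₚ.≟ c
  ... | yes _  = refl
  ... | no c≢c = contradiction refl c≢c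

  neq-≢ : ∀ {m} {c c′ : Fin m} → c ≢ c′ → neq c c′ ≡ 1
  neq-≢ {c = c} {c′} c≢c′ with c Finₚ.≟ c′
  ... | yes c≡c′ = contradiction c≡c′ c≢c′
  ... | no  _    = refl

  neq-triangle : ∀ {m} (x y z : Fin m) → neq x z ≤ neq x y + neq y z
  neq-triangle x y z with x Finₚ.≟ z | x Finₚ.≟ y | y Finₚ.≟ z
  ... | yes _  | _        | _        = z≤n
  ... | no  _  | no  _    | _        = s≤s z≤n
  ... | no  _  | yes _    | no  _    = s≤s z≤n
  ... | no x≢z | yes refl | yes refl = contradiction refl x≢z

  diff-refl : ∀ {m t} (xs : Vec (Fin m) t) → diff xs xs ≡ 0
  diff-refl []       = refl
  diff-refl (x ∷ xs) = cong₂ _+_ (neq-refl x) (diff-refl xs)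

  mix : ∀ {r m t} → (ℕ → Bool) → Vec (Fin r) t → Vec (Fin m) t → Vec (Fin m) t → Vec (Fin m) t
  mix β []      []       []       = []
  mix β (y ∷ Y) (c ∷ cs) (d ∷ ds) = (if β (suc (toℕ y)) then d else c) ∷ mix β Y cs ds

  nth-mix-true : ∀ {r m t} β (Y : Vec (Fin r) t) (cs ds : Vec (Fin m) t) k → β (nth Y k) ≡ true → nth (mix β Y cs ds) k ≡ nth ds k
  nth-mix-true β []      []       []       k       e = refl
  nth-mix-true β (y ∷ Y) (c ∷ cs) (d ∷ ds) zero    e rewrite e = refl
  nth-mix-true β (y ∷ Y) (c ∷ cs) (d ∷ ds) (suc k) e = nth-mix-true β Y cs ds k e

  nth-mix-false : ∀ {r m t} β (Y : Vec (Fin r) t) (cs ds : Vec (Fin m) t) k → β (nth Y k) ≡ false → nth (mix β Y cs ds) k ≡ nth cs k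
  nth-mix-false β []      []       []       k       e = refl
  nth-mix-false β (y ∷ Y) (c ∷ cs) (d ∷ ds) zero    e rewrite e = refl
  nth-mix-false β (y ∷ Y) (c ∷ cs) (d ∷ ds) (suc k) e = nth-mix-false β Y cs ds k e

  -- Each entry of the mixture agrees with one of its two sources, so passing through it adds
  -- nothing to their distance; the rest is the triangle inequality.
  mix-triangle : ∀ {r m t} β (Y : Vec (Fin r) t) (cs as ds : Vec (Fin m) t) →
    diff cs (mix β Y cs ds) + diff (mix β Y cs ds) ds ≤ diff cs as + diff as ds
  mix-triangle β []      []       []       []       = z≤n
  mix-triangle β (y ∷ Y) (c ∷ cs) (a ∷ as) (d ∷ ds) = begin
      neq c x + R + (neq x d + S)               ≡⟨ e (neq c x) R (neq x d) S ⟩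
      (neq c x + neq x d) + (R + S)             ≤⟨ +-mono-≤ (≤-trans hd (neq-triangle c a d)) (mix-triangle β Y cs as ds) ⟩
      (neq c a + neq a d) + (diff cs as + diff as ds) ≡⟨ e (neq c a) (neq a d) (diff cs as) (diff as ds) ⟩
      neq c a + diff cs as + (neq a d + diff as ds) ∎
    where
    open ≤-Reasoning
    x = if β (suc (toℕ y)) then d else c
    R = diff cs (mix β Y cs ds)
    S = diff (mix β Y cs ds) ds
    e : ∀ a b c d → a + b + (c + d) ≡ (a + c) + (b + d)
    e a b c d = trans (+-assoc a b (c + d)) (trans (cong (a +_) (trans (sym (+-assoc b c d)) (trans (cong (_+ d) (+-comm b c)) (+-assoc c b d)))) (sym (+-assoc a c (b + d))))
    hd : neq c x + neq x d ≤ neq c d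
    hd with β (suc (toℕ y))
    ... | true  = ≤-reflexive (trans (cong (neq c d +_) (neq-refl d)) (+-identityʳ _))
    ... | false = ≤-reflexive (cong (_+ neq c d) (neq-refl c))

  module _ {m : ℕ} where
    -- Restricted to the positions where the arrays differ, this count is injective and below
    -- `diff`; `diff-≥` feeds it to the pigeonhole principle.
    before : ∀ {t} → Vec (Fin m) t → Vec (Fin m) t → ℕ → ℕ
    before []       []       k       = 0
    before (x ∷ xs) (y ∷ ys) zero    = 0
    before (x ∷ xs) (y ∷ ys) (suc k) = neq x y + before xs ys k

    suc-toℕ-≢ : ∀ {x y : Fin m} → suc (toℕ x) ≢ suc (toℕ y) → x ≢ y
    suc-toℕ-≢ ne refl = ne refl

    before<diff : ∀ {t} (xs ys : Vec (Fin m) t) k → nth xs k ≢ nth ys k → before xs ys k < diff xs ys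
    before<diff []       []       k       ne = contradiction refl ne
    before<diff (x ∷ xs) (y ∷ ys) zero    ne = ≤-trans (≤-reflexive (sym (neq-≢ (suc-toℕ-≢ ne)))) (m≤m+n (neq x y) (diff xs ys))
    before<diff (x ∷ xs) (y ∷ ys) (suc k) ne = +-monoʳ-< (neq x y) (before<diff xs ys k ne)

    before-mono : ∀ {t} (xs ys : Vec (Fin m) t) {j k} → nth xs j ≢ nth ys j → j < k → before xs ys j < before xs ys k
    before-mono []       []       ne _ = contradiction refl ne
    before-mono (x ∷ xs) (y ∷ ys) {zero}  {suc k} ne _ = ≤-trans (≤-reflexive (sym (neq-≢ (suc-toℕ-≢ ne)))) (m≤m+n (neq x y) _)
    before-mono (x ∷ xs) (y ∷ ys) {suc j} {suc k} ne (s≤s j<k) = +-monoʳ-< (neq x y) (before-mono xs ys ne j<k)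

    diff-≥ : ∀ {t} (xs ys : Vec (Fin m) t) c (φ : ℕ → ℕ) → (∀ {i j} → i < c → j < c → φ i ≡ φ j → i ≡ j) →
      (∀ i → i < c → nth xs (φ i) ≢ nth ys (φ i)) → c ≤ diff xs ys
    diff-≥ xs ys c φ inj ne with c ≤? diff xs ys
    ... | yes p = p
    ... | no ¬p with Finₚ.pigeonhole (≰⇒> ¬p) (λ i → fromℕ< (before<diff xs ys (φ (toℕ i)) (ne (toℕ i) (Finₚ.toℕ<n i))))
    ...   | i , j , i<j , eq = contradiction (inj (Finₚ.toℕ<n i) (Finₚ.toℕ<n j) (same (ne (toℕ i) (Finₚ.toℕ<n i)) (ne (toℕ j) (Finₚ.toℕ<n j)) beq)) (<⇒≢ i<j)
      where
      beq : before xs ys (φ (toℕ i)) ≡ before xs ys (φ (toℕ j))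
      beq = trans (sym (Finₚ.toℕ-fromℕ< _)) (trans (cong toℕ eq) (Finₚ.toℕ-fromℕ< _))
      same : ∀ {j k} → nth xs j ≢ nth ys j → nth xs k ≢ nth ys k → before xs ys j ≡ before xs ys k → j ≡ k
      same {j} {k} nj nk e with <-cmp j k
      ... | tri< j<k _ _ = contradiction e (<⇒≢ (before-mono xs ys nj j<k))
      ... | tri≈ _ j≡k _ = j≡k
      ... | tri> _ _ k<j = contradiction (sym e) (<⇒≢ (before-mono xs ys nk k<j))


  -- The keys Y in increasing order: K i is the key of rank i, between the sentinels K 0 = 0 and
  -- K (t + 1) = R + 1, and idx i is the position in Y of the key of rank i + 1.
  record Sorted (R : ℕ) {r t} (Y : Vec (Fin r) t) (K idx : ℕ → ℕ) : Set where
    field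
      K-first : K 0 ≡ 0
      K-last  : K (suc t) ≡ suc R
      K↑      : ∀ i → i ≤ t → K i < K (suc i)
      idx<    : ∀ i → i < t → idx i < t
      key     : ∀ i → i < t → nth Y (idx i) ≡ K (suc i)
      onto    : ∀ j → j < t → ∃ λ i → i < t × idx i ≡ j

    K-mono : ∀ {i j} → i < j → j ≤ suc t → K i < K j
    K-mono {i} {suc j} (s≤s i≤j) (s≤s j≤t) with m≤n⇒m<n∨m≡n i≤j
    ... | inj₁ i<j  = <-trans (K-mono i<j (m≤n⇒m≤1+n j≤t)) (K↑ j j≤t)
    ... | inj₂ refl = K↑ j j≤t

    K-cancel : ∀ {i j} → i ≤ suc t → j ≤ suc t → K i ≡ K j → i ≡ j
    K-cancel {i} {j} i≤ j≤ e with <-cmp i j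
    ... | tri< i<j _ _ = contradiction e (<⇒≢ (K-mono i<j j≤))
    ... | tri≈ _ i≡j _ = i≡j
    ... | tri> _ _ j<i = contradiction (sym e) (<⇒≢ (K-mono j<i i≤))

    K-cancel-< : ∀ {i j} → i ≤ suc t → j ≤ suc t → K i < K j → i < j
    K-cancel-< {i} {j} i≤ j≤ lt with <-cmp i j
    ... | tri< i<j _ _ = i<j
    ... | tri≈ _ refl _ = contradiction lt (<-irrefl refl)
    ... | tri> _ _ j<i = contradiction (<-trans lt (K-mono j<i i≤)) (<-irrefl refl)

    idx-injective : ∀ {i j} → i < t → j < t → idx i ≡ idx j → i ≡ j
    idx-injective i<t j<t e = suc-injective (K-cancel (s≤s (<⇒≤ i<t)) (s≤s (<⇒≤ j<t))
      (trans (sym (key _ i<t)) (trans (cong (nth Y) e) (key _ j<t))))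

  nth-fresh : ∀ {r t} (Y : Vec (Fin r) t) (y : Fin r) → (∀ k → k < t → nth Y k ≢ suc (toℕ y)) → All (y ≢_) Y
  nth-fresh []      y h = []
  nth-fresh (z ∷ Y) y h = (λ { refl → h 0 z<s refl }) ∷ nth-fresh Y y (λ k k<t → h (suc k) (s≤s k<t))

  empty-sorted : ∀ R {r} → Sorted R {r} [] (λ i → i * suc R) (λ _ → 0)
  empty-sorted R = record { K-first = refl ; K-last = +-identityʳ (suc R) ; K↑ = λ { zero _ → z<s }
    ; idx< = λ _ () ; key = λ _ () ; onto = λ _ () }

  module Insert {R r t} {Y : Vec (Fin r) t} {K idx : ℕ → ℕ} (S : Sorted R Y K idx) (g : ℕ) (g≤t : g ≤ t)
    (y : Fin r) (after : K g < suc (toℕ y)) (before : suc (toℕ y) < K (suc g)) where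
    open Sorted S

    K′ idx′ : ℕ → ℕ
    K′   = ins (suc g) (suc (toℕ y)) K
    idx′ = ins g 0 (suc ∘ idx)

    fresh : All (y ≢_) Y
    fresh = nth-fresh Y y λ k k<t e → absurd k (onto k k<t) e
      where
      absurd : ∀ k → (∃ λ i → i < t × idx i ≡ k) → nth Y k ≢ suc (toℕ y)
      absurd k (i , i<t , refl) e with <-≤-connex g i
      ... | inj₁ g<i = <-irrefl (trans (sym e) (key i i<t)) (<-≤-trans before (<⇒≤ (K-mono (s≤s g<i) (s≤s (<⇒≤ i<t)))))
      ... | inj₂ i≤g with m≤n⇒m<n∨m≡n i≤g
      ...   | inj₁ i<g = <-irrefl (sym (trans (sym e) (key i i<t))) (≤-<-trans (K≤ i<g) after)
        where
        K≤ : suc i ≤ g → K (suc i) ≤ K g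
        K≤ si≤g with m≤n⇒m<n∨m≡n si≤g
        ... | inj₁ lt = <⇒≤ (K-mono lt (m≤n⇒m≤1+n g≤t))
        ... | inj₂ refl = ≤-refl
      ...   | inj₂ refl = <-irrefl (trans (sym e) (key i i<t)) before

    K-low : ∀ {i} → i ≤ g → K′ i ≡ K i
    K-low i≤g = ins-low (suc (toℕ y)) K (s≤s i≤g)

    K-at : K′ (suc g) ≡ suc (toℕ y)
    K-at = ins-at (suc g) (suc (toℕ y)) K

    K-high : ∀ {i} → g < i → K′ (suc i) ≡ K i
    K-high g<i = ins-high (suc (toℕ y)) K g<i

    idx-low : ∀ {i} → i < g → idx′ i ≡ suc (idx i)
    idx-low i<g = ins-low 0 (suc ∘ idx) i<g

    idx-at : idx′ g ≡ 0
    idx-at = ins-at g 0 (suc ∘ idx)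

    idx-high : ∀ {i} → g ≤ i → idx′ (suc i) ≡ suc (idx i)
    idx-high g≤i = ins-high 0 (suc ∘ idx) g≤i

    sorted : Sorted R (y ∷ Y) K′ idx′
    sorted = record
      { K-first = K-first
      ; K-last = trans (K-high (s≤s g≤t)) K-last
      ; K↑ = up
      ; idx< = below
      ; key = keys
      ; onto = surj
      }
      where
      up : ∀ i → i ≤ suc t → K′ i < K′ (suc i)
      up i i≤ with place (suc g) i
      up i i≤ | low (s≤s i≤g) with m≤n⇒m<n∨m≡n i≤g
      ... | inj₁ i<g  = subst₂ _<_ (sym (K-low i≤g)) (sym (K-low i<g)) (K↑ i (≤-trans i≤g g≤t))
      ... | inj₂ refl = subst₂ _<_ (sym (K-low i≤g)) (sym K-at) after
      up _ i≤ | at = subst₂ _<_ (sym K-at) (sym (K-high ≤-refl)) before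
      up (suc i) (s≤s i≤t) | high sg≤i = subst₂ _<_ (sym (K-high sg≤i)) (sym (K-high (m≤n⇒m≤1+n sg≤i))) (K↑ i i≤t)
      below : ∀ i → i < suc t → idx′ i < suc t
      below i i<t with place g i
      ... | low i<g = subst (_< suc t) (sym (idx-low i<g)) (s≤s (idx< i (<-≤-trans i<g g≤t)))
      ... | at      = subst (_< suc t) (sym idx-at) z<s
      below (suc i) (s≤s i<t) | high g≤i = subst (_< suc t) (sym (idx-high g≤i)) (s≤s (idx< i i<t))
      keys : ∀ i → i < suc t → nth (y ∷ Y) (idx′ i) ≡ K′ (suc i)
      keys i i<t with place g i
      ... | low i<g = trans (cong (nth (y ∷ Y)) (idx-low i<g)) (trans (key i (<-≤-trans i<g g≤t)) (sym (K-low i<g)))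
      ... | at      = trans (cong (nth (y ∷ Y)) idx-at) (sym K-at)
      keys (suc i) (s≤s i<t) | high g≤i = trans (cong (nth (y ∷ Y)) (idx-high g≤i)) (trans (key i i<t) (sym (K-high (s≤s g≤i))))
      surj : ∀ j → j < suc t → ∃ λ i → i < suc t × idx′ i ≡ j
      surj zero    _ = g , s≤s g≤t , idx-at
      surj (suc j) (s≤s j<t) with onto j j<t
      ... | i , i<t , refl with <-≤-connex i g
      ...   | inj₁ i<g = i , m≤n⇒m≤1+n i<t , idx-low i<g
      ...   | inj₂ g≤i = suc i , s≤s i<t , idx-high g≤i

  -- The cell, counted from 1, of the key of rank i, with sentinels 0 at rank 0 and m + 1 at
  -- rank t + 1 and consecutive values afterwards.
  posn : ∀ {m t} → Vec (Fin m) t → (ℕ → ℕ) → ℕ → ℕ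
  posn F idx zero = 0
  posn {m} {t} F idx (suc i) with i <? t
  ... | yes _ = nth F (idx i)
  ... | no  _ = suc m + (i ∸ t)

  module _ {m t : ℕ} (F : Vec (Fin m) t) (idx : ℕ → ℕ) where
    posn-key : ∀ {i} → i < t → posn F idx (suc i) ≡ nth F (idx i)
    posn-key {i} i<t with i <? t
    ... | yes _ = refl
    ... | no ¬p = contradiction i<t ¬p

    posn-end : ∀ {i} → t ≤ i → posn F idx (suc i) ≡ suc m + (i ∸ t)
    posn-end {i} t≤i with i <? t
    ... | yes p = contradiction p (≤⇒≯ t≤i)
    ... | no _  = refl

    posn-last : posn F idx (suc t) ≡ suc m
    posn-last = trans (posn-end ≤-refl) (trans (cong (suc m +_) (n∸n≡0 t)) (+-identityʳ (suc m)))

  nth>0 : ∀ {m t} (F : Vec (Fin m) t) k → k < t → 0 < nth F k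
  nth>0 (x ∷ F) zero    _         = z<s
  nth>0 (x ∷ F) (suc k) (s≤s k<t) = nth>0 F k k<t

  posn↑ : ∀ {R m r t} {Y : Vec (Fin r) t} {K idx} → Sorted R Y K idx → (f : StorageFunction m Y) →
    ∀ i → posn (cells f) idx i < posn (cells f) idx (suc i)
  posn↑ {m = m} {t = zero}  S f zero = z<s
  posn↑ {m = m} {t = suc t} {idx = idx} S f zero = subst (0 <_) (sym (posn-key (cells f) idx z<s)) (nth>0 (cells f) (idx 0) (Sorted.idx< S 0 z<s))
  posn↑ {m = m} {t = t} {Y} {K} {idx} S f (suc i) with <-≤-connex (suc i) t
  ... | inj₂ t≤si with m≤n⇒m<n∨m≡n t≤si
  ...   | inj₁ (s≤s t≤i) = subst₂ _<_ (sym (posn-end (cells f) idx t≤i)) (sym (posn-end (cells f) idx t≤si)) (+-monoʳ-< (suc m) (∸-monoˡ-< ≤-refl t≤i))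
  ...   | inj₂ refl = subst₂ _<_ (sym (posn-key (cells f) idx ≤-refl)) (sym (posn-last (cells f) idx)) (s≤s (nth≤ (cells f) (idx i)))
  posn↑ {m = m} {t = t} {Y} {K} {idx} S f (suc i) | inj₁ si<t =
    subst₂ _<_ (sym (trans (posn-key (cells f) idx i<t) (nth-fromℕ< (cells f) a<t))) (sym (trans (posn-key (cells f) idx si<t) (nth-fromℕ< (cells f) b<t)))
      (s≤s (strict f (fromℕ< a<t) (fromℕ< b<t) (s≤s⁻¹ (subst₂ _<_ (trans (sym (key i i<t)) (nth-fromℕ< Y a<t)) (trans (sym (key (suc i) si<t)) (nth-fromℕ< Y b<t)) (K↑ (suc i) (<⇒≤ si<t))))))
    where
    open Sorted S
    i<t : i < t
    i<t = <⇒≤ si<t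
    a<t : idx i < t
    a<t = idx< i i<t
    b<t : idx (suc i) < t
    b<t = idx< (suc i) si<t

  last-below : ∀ {D : ℕ → Set} → (∀ i → Dec (D i)) → D 0 → ∀ g → ∃ λ lo → lo ≤ g × D lo × (∀ i → lo < i → i ≤ g → ¬ D i)
  last-below D? d₀ zero = 0 , z≤n , d₀ , λ i 0<i i≤0 → contradiction (<-≤-trans 0<i i≤0) (<-irrefl refl)
  last-below D? d₀ (suc g) with D? (suc g)
  ... | yes d = suc g , ≤-refl , d , λ i g<i i≤g → contradiction (<-≤-trans g<i i≤g) (<-irrefl refl)
  ... | no ¬d with last-below D? d₀ g
  ...   | lo , lo≤g , d , none = lo , m≤n⇒m≤1+n lo≤g , d , λ i lo<i i≤sg → case-≤ i lo<i (m≤n⇒m<n∨m≡n i≤sg)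
    where
    case-≤ : ∀ i → lo < i → i < suc g ⊎ i ≡ suc g → ¬ _
    case-≤ i lo<i (inj₁ (s≤s i≤g)) = none i lo<i i≤g
    case-≤ i lo<i (inj₂ refl)      = ¬d

  first-above : ∀ {D : ℕ → Set} → (∀ i → Dec (D i)) → ∀ k g → D (suc g + k) → ∃ λ hi → g < hi × hi ≤ suc g + k × D hi × (∀ i → g < i → i < hi → ¬ D i)
  first-above D? zero g d = suc g + 0 , s≤s (m≤m+n g 0) , ≤-refl , d , λ i g<i i<hi → contradiction (<-≤-trans i<hi (≤-reflexive (cong suc (+-identityʳ g)))) (≤⇒≯ g<i)
  first-above {D} D? (suc k) g d with D? (suc g)
  ... | yes d′ = suc g , ≤-refl , m≤m+n (suc g) (suc k) , d′ , λ i g<i i<hi → contradiction i<hi (≤⇒≯ g<i)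
  ... | no ¬d with first-above D? k (suc g) (subst D (+-suc (suc g) k) d)
  ...   | hi , sg<hi , hi≤ , dh , none = hi , <⇒≤ sg<hi , ≤-trans hi≤ (≤-reflexive (sym (+-suc (suc g) k))) , dh , below
    where
    below : ∀ i → g < i → i < hi → ¬ D i
    below i g<i i<hi with m≤n⇒m<n∨m≡n g<i
    ... | inj₁ sg<i = none i sg<i i<hi
    ... | inj₂ refl = ¬d

  -- The virtual cells F follow an algorithm lazily: of the relocations made by the algorithm only those
  -- in the shortest run of keys around the new key are carried out that makes room for it.
  module Lazy {R m r t} {Y : Vec (Fin r) t} {K idx : ℕ → ℕ} (S : Sorted R Y K idx) (g : ℕ) (g≤t : g ≤ t)
    (y : Fin r) (after : K g < suc (toℕ y)) (before : suc (toℕ y) < K (suc g))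
    (F : Vec (Fin m) t) (P : ℕ → ℕ) (P↑ : ∀ i → P i < P (suc i)) (P-first : P 0 ≡ 0)
    (P-key : ∀ i → i < t → P (suc i) ≡ nth F (idx i)) (P-end : ∀ i → t ≤ i → P (suc i) ≡ suc m + (i ∸ t))
    (new : StorageFunction m (y ∷ Y)) where

    open Sorted S
    open Insert S g g≤t y after before using (idx′; sorted; idx-low; idx-at; idx-high)

    Q : ℕ → ℕ
    Q = posn (cells new) idx′

    Q↑ : ∀ i → Q i < Q (suc i)
    Q↑ = posn↑ sorted new

    opaque
      -- The nearest rank at or below the gap that can keep its cell while the next rank takes the
      -- cell of the algorithm. The sentinel of rank 0 always qualifies.
      left-end : ∃ λ lo → lo ≤ g × P lo < Q (suc lo) × (∀ i → lo < i → i ≤ g → ¬ P i < Q (suc i))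
      left-end = last-below (λ i → P i <? Q (suc i)) (subst (_< Q 1) (sym P-first) (Q↑ 0)) g

      -- Ranks in `Q` include the new key: `Q hi` is the cell of the key of old rank hi - 1, or of
      -- the new key when hi = g + 1, and must stay left of the old key of rank `hi`. The right
      -- sentinel always qualifies.
      right-end : ∃ λ hi → g < hi × hi ≤ suc g + (t ∸ g) × Q hi < P hi × (∀ i → g < i → i < hi → ¬ Q i < P i)
      right-end = first-above (λ i → Q i <? P i) (t ∸ g) g (subst (λ e → Q e < P e) (cong suc (sym (m+[n∸m]≡n g≤t))) end)
        where
        end : Q (suc t) < P (suc t)
        end = subst (Q (suc t) <_) (trans (posn-last (cells new) idx′) (sym (trans (P-end t ≤-refl) (trans (cong (suc m +_) (n∸n≡0 t)) (+-identityʳ (suc m)))))) (Q↑ (suc t))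

    lo hi : ℕ
    lo = proj₁ left-end
    hi = proj₁ right-end

    lo≤g : lo ≤ g
    lo≤g = proj₁ (proj₂ left-end)

    g<hi : g < hi
    g<hi = proj₁ (proj₂ right-end)

    hi≤ : hi ≤ suc t
    hi≤ = ≤-trans (proj₁ (proj₂ (proj₂ right-end))) (≤-reflexive (cong suc (m+[n∸m]≡n g≤t)))

    lo<hi : lo < hi
    lo<hi = ≤-<-trans lo≤g g<hi

    -- The run is selected by the values of the keys, since the vectors list keys in order of
    -- arrival and not by rank.
    β : ℕ → Bool
    β κ = does (K lo <? κ) ∧ does (κ <? K hi)

    β-true : ∀ {i} → lo < i → i < hi → β (K i) ≡ true
    β-true {i} lo<i i<hi = cong₂ _∧_ (dec-true (K lo <? K i) (K-mono lo<i (≤-trans (<⇒≤ i<hi) hi≤))) (dec-true (K i <? K hi) (K-mono i<hi hi≤))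

    β-low : ∀ {i} → i ≤ lo → β (K i) ≡ false
    β-low {i} i≤lo = cong (_∧ does (K i <? K hi)) (dec-false (K lo <? K i) λ lt →
      contradiction (K-cancel-< (≤-trans (<⇒≤ lo<hi) hi≤) (≤-trans i≤lo (≤-trans (<⇒≤ lo<hi) hi≤)) lt) (≤⇒≯ i≤lo))

    β-high : ∀ {i} → i ≤ suc t → hi ≤ i → β (K i) ≡ false
    β-high {i} i≤ hi≤i = trans (cong (does (K lo <? K i) ∧_) (dec-false (K i <? K hi) λ lt →
      contradiction (K-cancel-< i≤ hi≤ lt) (≤⇒≯ hi≤i))) (∧-zeroʳ (does (K lo <? K i)))

    F-old F′ : Vec (Fin m) _
    F-old = mix β Y F (tail (cells new))
    F′ = head (cells new) ∷ F-old

    P′ : ℕ → ℕ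
    P′ i with i ≤? lo | i ≤? hi
    ... | yes _ | _     = P i
    ... | no  _ | yes _ = Q i
    ... | no  _ | no  _ = P (pred i)

    P′-low : ∀ {i} → i ≤ lo → P′ i ≡ P i
    P′-low {i} i≤lo with i ≤? lo | i ≤? hi
    ... | yes _ | _ = refl
    ... | no ¬p | _ = contradiction i≤lo ¬p

    P′-mid : ∀ {i} → lo < i → i ≤ hi → P′ i ≡ Q i
    P′-mid {i} lo<i i≤hi with i ≤? lo | i ≤? hi
    ... | yes p | _     = contradiction lo<i (≤⇒≯ p)
    ... | no  _ | yes _ = refl
    ... | no  _ | no ¬p = contradiction i≤hi ¬p

    P′-high : ∀ {i} → hi ≤ i → P′ (suc i) ≡ P i
    P′-high {i} hi≤i with suc i ≤? lo | suc i ≤? hi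
    ... | yes p | _     = contradiction (≤-trans (≤-trans p (<⇒≤ lo<hi)) hi≤i) (<⇒≱ ≤-refl)
    ... | no  _ | yes p = contradiction (≤-trans p hi≤i) (<⇒≱ ≤-refl)
    ... | no  _ | no  _ = refl

    P′↑ : ∀ i → P′ i < P′ (suc i)
    P′↑ i with <-≤-connex i lo
    ... | inj₁ i<lo = subst₂ _<_ (sym (P′-low (<⇒≤ i<lo))) (sym (P′-low i<lo)) (P↑ i)
    ... | inj₂ lo≤i with m≤n⇒m<n∨m≡n lo≤i
    ...   | inj₂ refl = subst₂ _<_ (sym (P′-low ≤-refl)) (sym (P′-mid ≤-refl lo<hi)) (proj₁ (proj₂ (proj₂ left-end)))
    ...   | inj₁ lo<i with <-≤-connex i hi
    ...     | inj₁ i<hi = subst₂ _<_ (sym (P′-mid lo<i (<⇒≤ i<hi))) (sym (P′-mid (m≤n⇒m≤1+n lo<i) i<hi)) (Q↑ i)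
    ...     | inj₂ hi≤i with m≤n⇒m<n∨m≡n hi≤i
    ...       | inj₂ refl = subst₂ _<_ (sym (P′-mid lo<i ≤-refl)) (sym (P′-high ≤-refl)) (proj₁ (proj₂ (proj₂ (proj₂ right-end))))
    P′↑ (suc i) | inj₂ _ | inj₁ _ | inj₂ _ | inj₁ (s≤s hi≤i) = subst₂ _<_ (sym (P′-high hi≤i)) (sym (P′-high (m≤n⇒m≤1+n hi≤i))) (P↑ i)

    P′-first : P′ 0 ≡ 0
    P′-first = trans (P′-low z≤n) P-first

    nth-tail : ∀ {m t} (xs : Vec (Fin m) (suc t)) k → nth xs (suc k) ≡ nth (tail xs) k
    nth-tail (x ∷ xs) k = refl

    nth-head : ∀ {m t} (xs : Vec (Fin m) (suc t)) → nth xs 0 ≡ suc (toℕ (head xs))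
    nth-head (x ∷ xs) = refl

    Q-key : ∀ {i} → i < suc t → Q (suc i) ≡ nth (cells new) (idx′ i)
    Q-key i<t = posn-key (cells new) idx′ i<t

    mix-inside : ∀ {i} → i < t → lo < suc i → suc i < hi → nth F-old (idx i) ≡ nth (cells new) (suc (idx i))
    mix-inside {i} i<t lo<i i<hi = trans (nth-mix-true β Y F (tail (cells new)) (idx i) (trans (cong β (key i i<t)) (β-true lo<i i<hi)))
      (sym (nth-tail (cells new) (idx i)))

    mix-outside : ∀ {i} → i < t → β (K (suc i)) ≡ false → nth F-old (idx i) ≡ P (suc i)
    mix-outside {i} i<t e = trans (nth-mix-false β Y F (tail (cells new)) (idx i) (trans (cong β (key i i<t)) e)) (sym (P-key i i<t))

    P′-key : ∀ i → i < suc t → P′ (suc i) ≡ nth F′ (idx′ i)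
    P′-key i i<t with place g i
    P′-key i i<t | low i<g with <-≤-connex lo (suc i)
    ... | inj₁ lo<si = trans (P′-mid lo<si (≤-trans i<g (<⇒≤ g<hi))) (trans (Q-key i<t) (trans (cong (nth (cells new)) (idx-low i<g))
            (trans (sym (mix-inside (<-≤-trans i<g g≤t) lo<si (≤-<-trans i<g g<hi))) (cong (nth F′) (sym (idx-low i<g))))))
    ... | inj₂ si≤lo = trans (P′-low si≤lo) (trans (sym (mix-outside (<-≤-trans i<g g≤t) (β-low si≤lo))) (cong (nth F′) (sym (idx-low i<g))))
    P′-key _ i<t | at = trans (P′-mid (s≤s lo≤g) g<hi) (trans (Q-key i<t) (trans (cong (nth (cells new)) idx-at) (trans (nth-head (cells new)) (cong (nth F′) (sym idx-at)))))
    P′-key (suc i) (s≤s i<t) | high g≤i with <-≤-connex (suc i) hi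
    ... | inj₁ si<hi = trans (P′-mid (≤-trans (s≤s lo≤g) (m≤n⇒m≤1+n (s≤s g≤i))) si<hi) (trans (Q-key (s≤s i<t)) (trans (cong (nth (cells new)) (idx-high g≤i))
            (trans (sym (mix-inside i<t (≤-trans (s≤s lo≤g) (s≤s g≤i)) si<hi)) (cong (nth F′) (sym (idx-high g≤i))))))
    ... | inj₂ hi≤si = trans (P′-high hi≤si) (trans (sym (mix-outside i<t (β-high (m≤n⇒m≤1+n i<t) hi≤si))) (cong (nth F′) (sym (idx-high g≤i))))

    P′-end : ∀ i → suc t ≤ i → P′ (suc i) ≡ suc m + (i ∸ suc t)
    P′-end (suc i) (s≤s t≤i) = trans (P′-high (≤-trans hi≤ (s≤s t≤i))) (P-end i t≤i)

    -- Every key strictly inside the run changes its cell: if one did not, then by strictness of `Q`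
    -- the run could have ended there. The successor accounts for the new key.
    moved : hi ∸ lo ≤ suc (diff F F-old)
    moved = ≤-trans (≤-reflexive (trans (cong (_∸ lo) (sym (m∸n+n≡m lo<hi))) (trans (+-∸-assoc (hi ∸ suc lo) (n≤1+n lo)) (trans (cong (hi ∸ suc lo +_) (m+n∸n≡m 1 lo)) (+-comm _ 1)))))
      (s≤s (diff-≥ F F-old (hi ∸ suc lo) (λ k → idx (lo + k))
        (λ {i} {j} i< j< e → +-cancelˡ-≡ lo i j (idx-injective (inside i<) (inside j<) e))
        (λ k k< → differ (lo + k) (inside k<) (s≤s (m≤m+n lo k)) (run k<))))
      where
      run : ∀ {k} → k < hi ∸ suc lo → suc (lo + k) < hi
      run {k} k< = <-≤-trans (+-monoʳ-< (suc lo) k<) (≤-reflexive (m+[n∸m]≡n lo<hi))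
      inside : ∀ {k} → k < hi ∸ suc lo → lo + k < t
      inside k< = s≤s⁻¹ (≤-trans (run k<) hi≤)
      differ : ∀ j → j < t → lo < suc j → suc j < hi → nth F (idx j) ≢ nth F-old (idx j)
      differ j j<t lo<sj sj<hi e with <-≤-connex g (suc j)
      ... | inj₁ (s≤s g≤j) = proj₂ (proj₂ (proj₂ (proj₂ right-end))) (suc j) (s≤s g≤j) sj<hi
              (<-≤-trans (Q↑ (suc j)) (≤-reflexive (trans (trans (Q-key (s≤s j<t)) (cong (nth (cells new)) (idx-high g≤j))) (trans (sym (mix-inside j<t lo<sj sj<hi)) (trans (sym e) (sym (P-key j j<t)))))))
      ... | inj₂ sj≤g = proj₂ (proj₂ (proj₂ left-end)) (suc j) lo<sj sj≤g
              (≤-<-trans (≤-reflexive (trans (P-key j j<t) (trans e (trans (mix-inside j<t lo<sj sj<hi) (sym (trans (Q-key (m≤n⇒m≤1+n j<t)) (cong (nth (cells new)) (idx-low sj≤g)))))))) (Q↑ (suc j)))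

    -- Amortisation with the number of disagreements between the lazy cells and those of the
    -- algorithm: a postponed relocation was paid for when the algorithm made it.
    lazy-cost : ∀ (A : Vec (Fin m) t) → (hi ∸ lo) + diff F′ (cells new) ≤ diff F A + relocations A (cells new)
    lazy-cost A = begin
      (hi ∸ lo) + diff F′ (cells new)                       ≤⟨ +-mono-≤ moved (≤-reflexive (split (cells new) F-old)) ⟩
      suc (diff F F-old + diff F-old (tail (cells new)))    ≤⟨ s≤s (mix-triangle β Y F A (tail (cells new))) ⟩
      suc (diff F A + diff A (tail (cells new)))            ≡⟨ sym (+-suc (diff F A) (diff A (tail (cells new)))) ⟩
      diff F A + suc (diff A (tail (cells new)))            ≡⟨ cong (diff F A +_) (sym (relocations-diff A (cells new))) ⟩
      diff F A + relocations A (cells new)                  ∎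
      where
      open ≤-Reasoning
      split : ∀ {m t} (xs : Vec (Fin m) (suc t)) G → diff (head xs ∷ G) xs ≡ diff G (tail xs)
      split (x ∷ xs) G = cong (_+ diff G xs) (neq-refl x)

-- The adversary and its bookkeeping over a whole play.

module Adversary where

  open import Data.Nat
  open import Data.Nat.Properties
  open import Data.Nat.DivMod using (m/n*n≤m; m%n<n; m≡m%n+[m/n]*n)
  open import Data.Nat.Tactic.RingSolver using (solve-∀)
  open import Data.Fin using (Fin; toℕ; fromℕ<)
  import Data.Fin.Properties as Finₚ
  open import Data.List using (List; length)
  import Data.List.Relation.Unary.All as List-All
  open import Data.Product
  open import Data.Sum using (_⊎_; inj₁; inj₂)
  open import Data.Vec using (Vec; []; _∷_)
  open import Data.Vec.Relation.Unary.All using (All)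
  open import Data.Vec.Relation.Unary.AllPairs as AllPairs using ([]; _∷_)
  open import Data.Vec.Relation.Unary.Unique.Propositional using (Unique)
  open import Function using (_∘_)
  open import Relation.Binary.PropositionalEquality hiding (J)
  open import Relation.Nullary using (Dec; yes; no; ¬_; contradiction)
  open import Relation.Nullary.Decidable using (_×-dec_)
  open LabelingGame using (cells; Algorithm; cost; relocations; χ; χ-isLeast)
  open SegmentChains
  open LazyPlay

  open ≤-Reasoning

  -- Cumulative weights after the insertion of a key of weight 1 just above rank g.
  bump : ℕ → (ℕ → ℕ) → ℕ → ℕ
  bump zero    ω zero    = ω zero
  bump zero    ω (suc i) = suc (ω i)
  bump (suc g) ω zero    = ω zero
  bump (suc g) ω (suc i) = bump g (ω ∘ suc) i

  bump-low : ∀ {g i} ω → i ≤ g → bump g ω i ≡ ω i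
  bump-low {zero}  {zero}  ω i≤g       = refl
  bump-low {suc g} {zero}  ω i≤g       = refl
  bump-low {suc g} {suc i} ω (s≤s i≤g) = bump-low (ω ∘ suc) i≤g

  bump-high : ∀ {g i} ω → g ≤ i → bump g ω (suc i) ≡ suc (ω i)
  bump-high {zero}          ω g≤i       = refl
  bump-high {suc g} {suc i} ω (s≤s g≤i) = bump-high (ω ∘ suc) g≤i

  module _ {Z} (C : Config Z) (g : ℕ) where
    open Config C

    bump↑ : ∀ i → bump g ω i < bump g ω (suc i)
    bump↑ i with <-≤-connex i g
    ... | inj₁ i<g  = subst₂ _<_ (sym (bump-low ω (<⇒≤ i<g))) (sym (bump-low ω i<g)) (ω↑ i)
    ... | inj₂ g≤i with m≤n⇒m<n∨m≡n g≤i
    ...   | inj₂ refl = subst₂ _<_ (sym (bump-low {i} ω ≤-refl)) (sym (bump-high {i} ω ≤-refl)) ≤-refl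
    bump↑ (suc i) | inj₂ _ | inj₁ (s≤s g≤i) = subst₂ _<_ (sym (bump-high ω g≤i)) (sym (bump-high ω (m≤n⇒m≤1+n g≤i))) (s≤s (ω↑ i))

    bump≤ : 1 ≤ Z → ∀ i → bump g ω (suc i) ≤ Z + bump g ω i
    bump≤ 1≤Z i with <-≤-connex i g
    ... | inj₁ i<g  = subst₂ (λ a b → a ≤ Z + b) (sym (bump-low ω i<g)) (sym (bump-low ω (<⇒≤ i<g))) (ω≤ i)
    ... | inj₂ g≤i with m≤n⇒m<n∨m≡n g≤i
    ...   | inj₂ refl = subst₂ (λ a b → a ≤ Z + b) (sym (bump-high ω ≤-refl)) (sym (bump-low ω ≤-refl)) (+-monoˡ-≤ (ω i) 1≤Z)
    bump≤ 1≤Z (suc i) | inj₂ _ | inj₁ (s≤s g≤i) = subst₂ (λ a b → a ≤ Z + b) (sym (bump-high ω (m≤n⇒m≤1+n g≤i))) (sym (bump-high ω g≤i))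
      (≤-trans (s≤s (ω≤ i)) (≤-reflexive (sym (+-suc Z (ω i)))))

  -- How the adversary finds a key to insert in a dense segment: Good k t K ω says that this
  -- remains possible for k more steps.
  record Supply (par : Params) : Set₁ where
    open Params par
    field
      Good   : ℕ → ℕ → (K ω : ℕ → ℕ) → Set
      choose : ∀ {k t K} (C : Config Z) → Good (suc k) t K (Config.ω C) → (∀ i → i ≤ t → K i < K (suc i)) →
        ∀ x y → x < y → y ≤ suc t → W₀ * Config.len C x y ≤ 3 * N * Config.wt C x y → 3 * (H * T) ≤ 4 * Config.wt C x y →
        Σ[ g ∈ ℕ ] x ≤ g × g < y × (Σ[ κ ∈ ℕ ] K g < κ × κ < K (suc g) × Good k (suc t) (ins (suc g) κ K) (bump g (Config.ω C)))

  module Driver (par : Params) (supply : Supply par) {n m r R : ℕ} (R≤r : R ≤ r) (N≡ : suc m ≡ Params.N par) (A : Algorithm n m r) where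
    open Params par
    open Levels par
    open Activity par
    open Potential par
    open Supply supply

    -- Here `j` counts the insertions since the loading phase and `k` those still to come; `κ` is
    -- the cost of the lazy moves since then. All levels are judged on the lazy cells `F`, never on
    -- those of the algorithm.
    record State (j k t : ℕ) .(t≤n : t ≤ n) (Y : Vec (Fin r) t) .(u : Unique Y) : Set where
      field
        {K idx}  : ℕ → ℕ
        sorted   : Sorted R Y K idx
        C        : Config Z
        F        : Vec (Fin m) t
        P-first  : Config.P C 0 ≡ 0
        P-key    : ∀ i → i < t → Config.P C (suc i) ≡ nth F (idx i)
        P-end    : ∀ i → t ≤ i → Config.P C (suc i) ≡ suc m + (i ∸ t)
        good     : Good k t K (Config.ω C)
        ls       : List Level
        valid    : Chains.Valid par C 0 (suc t) 0 ls
        levels   : length ls ≡ T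
        heavy    : W₀ ≤ Config.wt C 0 (suc t)
        κ        : ℕ
        lazy     : κ + diff F (cells (A t≤n Y u)) ≤ cost A t≤n Y u
        progress : 2 * total base ls + j * (T * T) ≤ 2 * total up ls + 10 * G * κ

    module _ (C : Config Z) where
      open Levels.Static par C
      open Chains par C

      root-reached : ∀ {e} → Config.P C 0 ≡ 0 → Config.P C e ≡ suc m → W₀ ≤ Config.wt C 0 e → Reached 0 0 0 e
      root-reached {e} P0 Pe W≤ = reached
        (begin
          W₀ * len 0 e * Y 0 0     ≡⟨ cong (λ l → W₀ * l * Y 0 0) (trans (cong₂ _∸_ Pe P0) N≡) ⟩
          W₀ * N * Y 0 0           ≤⟨ *-mono-≤ (*-monoˡ-≤ N W≤) (≤-reflexive (trans (cong (λ e → 1 * suc M ^ e) (*-zeroʳ J)) (sym (cong (λ e → 1 * M ^ e) (*-zeroʳ J))))) ⟩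
          wt 0 e * N * X 0 0       ∎)
        (≤-trans W≤ (≤-reflexive (sym (*-identityʳ _))))

      root-core : ∀ {e} → 0 < e → Core 0 e 0
      root-core {e} 0<e = inside , hv , dn
        where
        inside : ∀ c → c + 0 ≡ e → 0 < c
        inside c refl = subst (0 <_) (+-identityʳ c) 0<e
        hv : ∀ c → c + 0 ≡ e → 3 * wt 0 e ≤ 4 * wt 0 c
        hv c refl = *-mono-≤ (n≤1+n 3) (≤-reflexive (cong (wt 0) (+-identityʳ c)))
        dn : CoreDense 0 e 0
        dn c refl = ≤-trans (≤-reflexive (cong₂ (λ l w → l * len 0 c * w) (cong (wt 0) (+-identityʳ c)) refl))
          (*-mono-≤ (*-monoʳ-≤ (wt 0 c) (≤-reflexive (cong (len 0) (sym (+-identityʳ c))))) (n≤1+n M))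

    P-last : ∀ {j k t} .{t≤n : t ≤ n} {Y : Vec (Fin r) t} .{u : Unique Y} (s : State j k t t≤n Y u) → Config.P (State.C s) (suc t) ≡ suc m
    P-last {t = t} s = trans (State.P-end s t ≤-refl) (trans (cong (suc m +_) (n∸n≡0 t)) (+-identityʳ (suc m)))

    find-target : ∀ {j k t} .{t≤n : t ≤ n} {Y : Vec (Fin r) t} .{u : Unique Y} (s : State j k t t≤n Y u) →
      Bottom.Target par (State.C s) (suc t) (State.ls s)
    find-target {t≤n = t≤n} {u = u} s = Bottom.target par C valid levels z<s (root-reached C P-first (P-last {t≤n = t≤n} {u = u} s) heavy) (root-core C z<s)
      where open State s

    T≥8 : 8 ≤ T
    T≥8 = ≤-trans (*-monoʳ-≤ 8 μ≥1) J≤T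

    -- With act > 3 T / 4 and T ≥ 8, twice the net reward T act - T is at least T². This is why the
    -- invariant carries the potential doubled.
    pay : ∀ {ls ls′ : List Level} {j κ c act} → 2 * total base ls + j * (T * T) ≤ 2 * total up ls + 10 * G * κ → 3 * T < 4 * act →
      total up ls + total base ls′ + T * act ≤ total up ls′ + total base ls + 5 * c * G + T →
      2 * total base ls′ + suc j * (T * T) ≤ 2 * total up ls′ + 10 * G * (κ + c)
    pay {ls} {ls′} {j} {κ} {c} {act} pot busy prog = +-cancelʳ-≤ (2 * B + 2 * U + 2 * T) _ _ (begin
        2 * B′ + suc j * (T * T) + (2 * B + 2 * U + 2 * T)                     ≡⟨ e₁ B′ j T B U ⟩
        (2 * B + j * (T * T)) + (2 * U + 2 * B′ + T * (T + 2))                 ≤⟨ +-mono-≤ pot (+-monoʳ-≤ (2 * U + 2 * B′) (*-monoʳ-≤ T T+2≤)) ⟩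
        (2 * U + 10 * G * κ) + (2 * U + 2 * B′ + T * (2 * act))                ≡⟨ e₂ U G κ B′ T act ⟩
        (2 * U + 10 * G * κ) + 2 * (U + B′ + T * act)                          ≤⟨ +-monoʳ-≤ (2 * U + 10 * G * κ) (*-monoʳ-≤ 2 prog) ⟩
        (2 * U + 10 * G * κ) + 2 * (U′ + B + 5 * c * G + T)                    ≡⟨ e₃ U G κ U′ B c T ⟩
        2 * U′ + 10 * G * (κ + c) + (2 * B + 2 * U + 2 * T)                    ∎)
      where
      B  = total base ls
      B′ = total base ls′
      U  = total up ls
      U′ = total up ls′
      T+2≤ : T + 2 ≤ 2 * act
      T+2≤ = *-cancelˡ-≤ 2 (begin
        2 * (T + 2)          ≡⟨ e T ⟩
        2 * T + 4            ≤⟨ +-monoʳ-≤ (2 * T) (≤-trans (s≤s (s≤s (s≤s (s≤s (z≤n {4}))))) T≥8) ⟩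
        2 * T + T            ≡⟨ e′ T ⟩
        3 * T                ≤⟨ <⇒≤ busy ⟩
        4 * act              ≡⟨ *-assoc 2 2 act ⟩
        2 * (2 * act)        ∎)
        where
        e : ∀ T → 2 * (T + 2) ≡ 2 * T + 4
        e = solve-∀
        e′ : ∀ T → 2 * T + T ≡ 3 * T
        e′ = solve-∀
      e₁ : ∀ B′ j T B U → 2 * B′ + suc j * (T * T) + (2 * B + 2 * U + 2 * T) ≡ (2 * B + j * (T * T)) + (2 * U + 2 * B′ + T * (T + 2))
      e₁ = solve-∀
      e₂ : ∀ U G κ B′ T act → (2 * U + 10 * G * κ) + (2 * U + 2 * B′ + T * (2 * act)) ≡ (2 * U + 10 * G * κ) + 2 * (U + B′ + T * act)
      e₂ = solve-∀
      e₃ : ∀ U G κ U′ B c T → (2 * U + 10 * G * κ) + 2 * (U′ + B + 5 * c * G + T) ≡ 2 * U′ + 10 * G * (κ + c) + (2 * B + 2 * U + 2 * T)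
      e₃ = solve-∀

    Next : (j k t : ℕ) (Y : Vec (Fin r) t) .(u : Unique Y) .(t<n : suc t ≤ n) → Set
    Next j k t Y u t<n = Σ[ y ∈ Fin r ] Σ[ fr ∈ All (y ≢_) Y ] State (suc j) k (suc t) t<n (y ∷ Y) (fr ∷ u)

    play : ∀ {j k t} .{t≤n : t ≤ n} {Y : Vec (Fin r) t} .{u : Unique Y} → State j (suc k) t t≤n Y u → .(t<n : suc t ≤ n) → Next j k t Y u t<n
    play {j} {k} {t} {t≤n} {Y} {u} s t<n = insert (choose C good (Sorted.K↑ sorted) x y x<y y≤e dense heavy′)
      where
      open State s
      open Bottom.Target (find-target {t≤n = t≤n} {u = u} s) renaming (heavy to heavy′)
      insert : Σ[ g ∈ ℕ ] x ≤ g × g < y × (Σ[ v ∈ ℕ ] K g < v × v < K (suc g) × Good k (suc t) (ins (suc g) v K) (bump g (Config.ω C))) → Next j k t Y u t<n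
      insert (g , x≤g , g<y , zero , () , _)
      insert (g , x≤g , g<y , suc v , after , before , good′) = key′ , I.fresh , record
        { K = I.K′
        ; idx = I.idx′
        ; sorted = I.sorted
        ; C = C′
        ; F = L.F′
        ; P-first = L.P′-first
        ; P-key = L.P′-key
        ; P-end = L.P′-end
        ; good = subst (λ v → Good k (suc t) (ins (suc g) v K) (bump g (Config.ω C))) (sym key-v) good′
        ; ls = proj₁ moved
        ; valid = proj₁ (proj₂ moved)
        ; levels = proj₁ (proj₂ (proj₂ moved))
        ; heavy = ≤-trans heavy (∸-mono {Config.ω C (suc t)} {bump g (Config.ω C) (suc (suc t))} {Config.ω C 0} {bump g (Config.ω C) 0}
            (≤-trans (n≤1+n _) (≤-reflexive (sym (bump-high (Config.ω C) (m≤n⇒m≤1+n g≤t))))) (≤-reflexive (bump-low {g} (Config.ω C) z≤n)))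
        ; κ = κ + c
        ; lazy = begin
            κ + c + diff L.F′ (cells new)                 ≡⟨ +-assoc κ c (diff L.F′ (cells new)) ⟩
            κ + (c + diff L.F′ (cells new))               ≤⟨ +-monoʳ-≤ κ (L.lazy-cost (cells old)) ⟩
            κ + (diff F (cells old) + relocations (cells old) (cells new)) ≡⟨ sym (+-assoc κ (diff F (cells old)) (relocations (cells old) (cells new))) ⟩
            κ + diff F (cells old) + relocations (cells old) (cells new)   ≤⟨ +-monoˡ-≤ (relocations (cells old) (cells new)) lazy ⟩
            cost A t≤n Y u + relocations (cells old) (cells new)           ∎
        ; progress = pay {ls} {proj₁ moved} {j} {κ} {c} {total active ls} progress busy (proj₂ (proj₂ (proj₂ moved)))
        }
        where
        g≤t : g ≤ t
        g≤t = s≤s⁻¹ (<-≤-trans g<y y≤e)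
        v<r : v < r
        v<r = ≤-trans (s≤s⁻¹ (≤-trans before (≤-trans (K≤last (s≤s g≤t)) (≤-reflexive (Sorted.K-last sorted))))) R≤r
          where
          K≤last : ∀ {i} → i ≤ suc t → K i ≤ K (suc t)
          K≤last i≤ with m≤n⇒m<n∨m≡n i≤
          ... | inj₁ i<  = <⇒≤ (Sorted.K-mono sorted i< ≤-refl)
          ... | inj₂ refl = ≤-refl
        key′ : Fin r
        key′ = fromℕ< v<r
        key-v : suc (toℕ key′) ≡ suc v
        key-v = cong suc (Finₚ.toℕ-fromℕ< v<r)
        after′ : K g < suc (toℕ key′)
        after′ = subst (K g <_) (sym key-v) after
        before′ : suc (toℕ key′) < K (suc g)
        before′ = subst (_< K (suc g)) (sym key-v) before
        module I = Insert sorted g g≤t key′ after′ before′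
        old = A t≤n Y u
        new = A t<n (key′ ∷ Y) (I.fresh ∷ u)
        module L = Lazy sorted g g≤t key′ after′ before′ F (Config.P C) (Config.P↑ C) P-first P-key P-end new
        c : ℕ
        c = L.hi ∸ L.lo
        hi≡ : L.lo + c ≡ L.hi
        hi≡ = m+[n∸m]≡n (<⇒≤ L.lo<hi)
        C′ : Config Z
        C′ = record { P = L.P′ ; ω = bump g (Config.ω C) ; P↑ = L.P′↑ ; ω↑ = bump↑ C g ; ω≤ = bump≤ C g Z≥1 }
        moved : Σ[ ls′ ∈ List Level ] (Chains.Valid par C′ 0 (suc (suc t)) 0 ls′ × length ls′ ≡ T × total up ls + total base ls′ + T * total active ls ≤ total up ls′ + total base ls + 5 * c * G + T)
        moved = Step.step par C C′ g L.lo c L.lo≤g (subst (g <_) (sym hi≡) L.g<hi) (λ i → L.P′-low) (λ i h → L.P′-high (subst (_≤ i) hi≡ h))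
          (λ i → bump-low (Config.ω C)) (λ i g<i → bump-high (Config.ω C) (<⇒≤ g<i)) ls valid levels z<s (root-reached C P-first (P-last {t≤n = t≤n} {u = u} s) heavy) (root-core C z<s)
          (deep x≤g g<y) (≤-trans (≤-reflexive hi≡) L.hi≤)

    Result : ℕ → Set
    Result j = Σ[ Z ∈ Vec (Fin r) n ] Σ[ u ∈ Unique Z ] (j * (T * T) ≤ 4 * G * suc n + 10 * G * cost A ≤-refl Z u)

    -- The final potential is at most 2 G times the total width of the strips, and by `deep-dist`
    -- these fit side by side into the order.
    finish : ∀ {j k Y} {u : Unique Y} → State j k n ≤-refl Y u → Result j
    finish {j} {k} {Y} {u} s = Y , u , +-cancelˡ-≤ (2 * total base ls) _ _ (begin
        2 * total base ls + j * (T * T)                          ≤⟨ progress ⟩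
        2 * total up ls + 10 * G * κ                             ≤⟨ +-mono-≤ (*-monoʳ-≤ 2 (≤-trans (Bottom.up≤ par C valid) (+-monoʳ-≤ (total base ls) (*-monoʳ-≤ (2 * G) depth))))
                                                                      (*-monoʳ-≤ (10 * G) (≤-trans (m≤m+n κ _) lazy)) ⟩
        2 * (total base ls + 2 * G * suc n) + 10 * G * cost A ≤-refl Y u   ≡⟨ e (total base ls) G n (10 * G * cost A ≤-refl Y u) ⟩
        2 * total base ls + (4 * G * suc n + 10 * G * cost A ≤-refl Y u)   ∎)
      where
      open State s
      open Bottom.Target (find-target {t≤n = ≤-refl} {u = u} s) using (x; x<y; y≤e; deep)
      depth : total Level.d ls ≤ suc n
      depth = ≤-trans (proj₁ (Depth.deep-dist par C valid (deep ≤-refl x<y))) (≤-trans (<⇒≤ x<y) y≤e)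
      e : ∀ b G n c → 2 * (b + 2 * G * suc n) + c ≡ 2 * b + (4 * G * suc n + c)
      e = solve-∀

    loop : ∀ k {j t} → t + k ≡ n → .{t≤n : t ≤ n} {Y : Vec (Fin r) t} {u : Unique Y} → State j k t t≤n Y u → Result (k + j)
    loop zero    {t = t} e {u = u} s with trans (sym (+-identityʳ t)) e
    ... | refl = finish {u = u} s
    loop (suc k) {j} {t} e {Y = Y} {u} s = continue (play {u = u} s t<n)
      where
      t<n : suc t ≤ n
      t<n = ≤-trans (s≤s (m≤m+n t k)) (≤-reflexive (trans (sym (+-suc t k)) e))
      continue : Next j k t Y u t<n → Result (suc k + j)
      continue (y , fr , s′) = subst Result (+-suc k j) (loop k (trans (sym (+-suc t k)) e) {u = fr ∷ u} s′)

  -- Two ways to keep keys available in dense segments.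

  bisection : (par : Params) → Supply par
  bisection par = record { Good = λ k t K _ → ∀ i → i ≤ t → K i + 2 ^ k ≤ K (suc i)
                         ; choose = λ {k} {t} {K} C good _ x y x<y y≤ _ _ → choose {k} {t} {K} good x y x<y y≤ }
    where
    choose : ∀ {k t K} → (∀ i → i ≤ t → K i + 2 ^ suc k ≤ K (suc i)) → ∀ x y → x < y → y ≤ suc t →
      Σ[ g ∈ ℕ ] x ≤ g × g < y × (Σ[ κ ∈ ℕ ] K g < κ × κ < K (suc g) × (∀ i → i ≤ suc t → ins (suc g) κ K i + 2 ^ k ≤ ins (suc g) κ K (suc i)))
    choose {k} {t} {K} good x y x<y y≤ = x , ≤-refl , x<y , v , m<m+n (K x) 2^k>0 , <-≤-trans (m<m+n v 2^k>0) two , good′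
      where
      -- Both parts of the divided interval keep length at least 2^k, which suffices for the
      -- remaining k steps wherever they fall.
      v = K x + 2 ^ k
      2^k>0 : 0 < 2 ^ k
      2^k>0 = m^n>0 2 k
      x≤t : x ≤ t
      x≤t = s≤s⁻¹ (<-≤-trans x<y y≤)
      two : v + 2 ^ k ≤ K (suc x)
      two = ≤-trans (≤-reflexive (trans (+-assoc (K x) (2 ^ k) (2 ^ k)) (cong (λ z → K x + (2 ^ k + z)) (sym (+-identityʳ (2 ^ k)))))) (good x x≤t)
      weaken : ∀ i → i ≤ t → K i + 2 ^ k ≤ K (suc i)
      weaken i i≤t = ≤-trans (+-monoʳ-≤ (K i) (m≤m+n (2 ^ k) (2 ^ k + 0))) (good i i≤t)
      low′ : ∀ {i} → i ≤ x → ins (suc x) v K i ≡ K i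
      low′ i≤x = ins-low v K (s≤s i≤x)
      good′ : ∀ i → i ≤ suc t → ins (suc x) v K i + 2 ^ k ≤ ins (suc x) v K (suc i)
      good′ i i≤ with place (suc x) i
      ... | at = subst₂ (λ a b → a + 2 ^ k ≤ b) (sym (ins-at (suc x) v K)) (sym (ins-high v K ≤-refl)) two
      good′ i i≤ | low (s≤s i≤x) with m≤n⇒m<n∨m≡n i≤x
      ... | inj₁ i<x  = subst₂ (λ a b → a + 2 ^ k ≤ b) (sym (low′ i≤x)) (sym (low′ i<x)) (weaken i (≤-trans i≤x x≤t))
      ... | inj₂ refl = ≤-reflexive (trans (cong (_+ 2 ^ k) (low′ i≤x)) (sym (ins-at (suc x) v K)))
      good′ (suc i) (s≤s i≤t) | high sx≤i = subst₂ (λ a b → a + 2 ^ k ≤ b) (sym (ins-high v K sx≤i)) (sym (ins-high v K (m≤n⇒m≤1+n sx≤i))) (weaken i i≤t)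

  -- Originally the keys are the multiples of gap; o i counts those of rank at most i.
  record Spaced (gap Z t : ℕ) (K ω : ℕ → ℕ) : Set where
    field
      o     : ℕ → ℕ
      lower : ∀ i → i ≤ suc t → gap * o i ≤ K i
      upper : ∀ i → i ≤ suc t → K i < gap * suc (o i)
      next  : ∀ i → i ≤ t → o (suc i) ≡ o i ⊎ (o (suc i) ≡ suc (o i) × K (suc i) ≡ gap * suc (o i))
      -- Original keys weigh `Z` and all others 1, so ω i = Z · o i + (i - o i), with the
      -- subtraction moved across.
      tally : ∀ i → i ≤ suc t → ω i + o i ≡ Z * o i + i

    o-mono : ∀ {i j} → i ≤ j → j ≤ suc t → o i ≤ o j
    o-mono {i} i≤j j≤ = go (≤⇒≤′ i≤j) j≤
      where
      go : ∀ {j} → i ≤′ j → j ≤ suc t → o i ≤ o j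
      go ≤′-refl         j≤       = ≤-refl
      go (≤′-step {j} i≤j) (s≤s j≤t) with next j j≤t
      ... | inj₁ e       = ≤-trans (go i≤j (m≤n⇒m≤1+n j≤t)) (≤-reflexive (sym e))
      ... | inj₂ (e , _) = ≤-trans (go i≤j (m≤n⇒m≤1+n j≤t)) (≤-trans (n≤1+n _) (≤-reflexive (sym e)))

  -- If no key were free, the keys of ranks x to y would be consecutive integers, with D = y - x, so
  -- at most 1 + D / gap of those after x would be original and the weight w at most Z + Z D / gap +
  -- D. Each of the three terms is at most w / 4: the first because the segment is heavy, the others
  -- because it is dense.
  density-supply : (par : Params) (gap e : ℕ) → (let open Params par) → W₀ ≡ Z * e → 1 ≤ N → 12 * N ≤ gap * e → 12 * N ≤ Z * e → Supply par
  density-supply par gap e W₀≡ N≥1 gap-large Z-large = record { Good = λ _ → Spaced gap Z ; choose = λ {k} {t} {K} → choose {t} {K} }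
    where
    open Params par
    open Levels par using (T≥1; J≥1)
    choose : ∀ {t K} (C : Config Z) → Spaced gap Z t K (Config.ω C) → (∀ i → i ≤ t → K i < K (suc i)) → ∀ x y → x < y → y ≤ suc t →
      W₀ * Config.len C x y ≤ 3 * N * Config.wt C x y → 3 * (H * T) ≤ 4 * Config.wt C x y →
      Σ[ g ∈ ℕ ] x ≤ g × g < y × (Σ[ κ ∈ ℕ ] K g < κ × κ < K (suc g) × Spaced gap Z (suc t) (ins (suc g) κ K) (bump g (Config.ω C)))
    choose {t} {K} C sp K↑ x y x<y y≤ dense heavy = decide (anyUpTo? (λ i → (x ≤? i) ×-dec (suc (K i) <? K (suc i))) y)
      where
      open Spaced sp
      open Segments C
      fill : ∀ g → x ≤ g → g < y → suc (K g) < K (suc g) → Spaced gap Z (suc t) (ins (suc g) (suc (K g)) K) (bump g ω)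
      fill g x≤g g<y gapless = record { o = o′ ; lower = lower′ ; upper = upper′ ; next = next′ ; tally = tally′ }
        where
        g≤t : g ≤ t
        g≤t = s≤s⁻¹ (<-≤-trans g<y y≤)
        o′ K′ : ℕ → ℕ
        o′ = ins (suc g) (o g) o
        K′ = ins (suc g) (suc (K g)) K
        o-low : ∀ {i} → i ≤ g → o′ i ≡ o i
        o-low i≤g = ins-low (o g) o (s≤s i≤g)
        K-low : ∀ {i} → i ≤ g → K′ i ≡ K i
        K-low i≤g = ins-low (suc (K g)) K (s≤s i≤g)
        o-at : o′ (suc g) ≡ o g
        o-at = ins-at (suc g) (o g) o
        K-at : K′ (suc g) ≡ suc (K g)
        K-at = ins-at (suc g) (suc (K g)) K
        o-high : ∀ {i} → g < i → o′ (suc i) ≡ o i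
        o-high g<i = ins-high (o g) o g<i
        K-high : ∀ {i} → g < i → K′ (suc i) ≡ K i
        K-high g<i = ins-high (suc (K g)) K g<i
        lower′ : ∀ i → i ≤ suc (suc t) → gap * o′ i ≤ K′ i
        lower′ i i≤ with place (suc g) i
        ... | low (s≤s i≤g) = subst₂ (λ a b → gap * a ≤ b) (sym (o-low i≤g)) (sym (K-low i≤g)) (lower i (≤-trans i≤g (m≤n⇒m≤1+n g≤t)))
        ... | at = subst₂ (λ a b → gap * a ≤ b) (sym o-at) (sym K-at) (m≤n⇒m≤1+n (lower g (m≤n⇒m≤1+n g≤t)))
        lower′ (suc i) (s≤s i≤) | high g<i = subst₂ (λ a b → gap * a ≤ b) (sym (o-high g<i)) (sym (K-high g<i)) (lower i i≤)
        room : suc (K g) < gap * suc (o g)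
        room with next g g≤t
        ... | inj₁ e       = <-trans gapless (subst (λ a → K (suc g) < gap * suc a) e (upper (suc g) (s≤s g≤t)))
        ... | inj₂ (_ , e) = <-≤-trans gapless (≤-reflexive e)
        upper′ : ∀ i → i ≤ suc (suc t) → K′ i < gap * suc (o′ i)
        upper′ i i≤ with place (suc g) i
        ... | low (s≤s i≤g) = subst₂ (λ a b → b < gap * suc a) (sym (o-low i≤g)) (sym (K-low i≤g)) (upper i (≤-trans i≤g (m≤n⇒m≤1+n g≤t)))
        ... | at = subst₂ (λ a b → b < gap * suc a) (sym o-at) (sym K-at) room
        upper′ (suc i) (s≤s i≤) | high g<i = subst₂ (λ a b → b < gap * suc a) (sym (o-high g<i)) (sym (K-high g<i)) (upper i i≤)
        Next : (a b c : ℕ) → Set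
        Next a b c = b ≡ a ⊎ (b ≡ suc a × c ≡ gap * suc a)
        next′ : ∀ i → i ≤ suc t → Next (o′ i) (o′ (suc i)) (K′ (suc i))
        next′ i i≤ with place (suc g) i
        ... | at = subst₂ (λ a b → Next a b (K′ (suc (suc g)))) (sym o-at) (sym (o-high ≤-refl)) (subst (Next (o g) (o (suc g))) (sym (K-high ≤-refl)) (next g g≤t))
        next′ i i≤ | low (s≤s i≤g) with m≤n⇒m<n∨m≡n i≤g
        ... | inj₁ i<g  = subst₂ (λ a b → Next a b (K′ (suc i))) (sym (o-low i≤g)) (sym (o-low i<g)) (subst (Next (o i) (o (suc i))) (sym (K-low i<g)) (next i (≤-trans i≤g g≤t)))
        ... | inj₂ refl = inj₁ (trans o-at (sym (o-low ≤-refl)))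
        next′ (suc i) (s≤s i≤) | high g<i = subst₂ (λ a b → Next a b (K′ (suc (suc i)))) (sym (o-high g<i)) (sym (o-high (m≤n⇒m≤1+n g<i))) (subst (Next (o i) (o (suc i))) (sym (K-high (m≤n⇒m≤1+n g<i))) (next i i≤))
        tally′ : ∀ i → i ≤ suc (suc t) → bump g ω i + o′ i ≡ Z * o′ i + i
        tally′ i i≤ with place (suc g) i
        ... | low (s≤s i≤g) = subst₂ (λ a b → b + a ≡ Z * a + i) (sym (o-low i≤g)) (sym (bump-low ω i≤g)) (tally i (≤-trans i≤g (m≤n⇒m≤1+n g≤t)))
        ... | at = subst₂ (λ a b → b + a ≡ Z * a + suc g) (sym o-at) (sym (bump-high {g} ω ≤-refl)) (trans (cong suc (tally g (m≤n⇒m≤1+n g≤t))) (sym (+-suc (Z * o g) g)))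
        tally′ (suc i) (s≤s i≤) | high g<i = subst₂ (λ a b → b + a ≡ Z * a + suc i) (sym (o-high g<i)) (sym (bump-high ω (<⇒≤ g<i))) (trans (cong suc (tally i i≤)) (sym (+-suc (Z * o i) i)))
      Free : ℕ → Set
      Free i = x ≤ i × suc (K i) < K (suc i)
      decide : Dec (∃ λ i → i < y × Free i) →
        Σ[ g ∈ ℕ ] x ≤ g × g < y × (Σ[ κ ∈ ℕ ] K g < κ × κ < K (suc g) × Spaced gap Z (suc t) (ins (suc g) κ K) (bump g ω))
      decide (yes (g , g<y , x≤g , free)) = g , x≤g , g<y , suc (K g) , ≤-refl , free , fill g x≤g g<y free
      decide (no none) = contradiction overfull (<⇒≱ not-full)
        where
        D = y ∸ x
        xD≡y : x + D ≡ y
        xD≡y = m+[n∸m]≡n (<⇒≤ x<y)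
        tight : ∀ d → x + d ≤ y → K (x + d) ≤ K x + d
        tight zero    _ = ≤-reflexive (trans (cong K (+-identityʳ x)) (sym (+-identityʳ (K x))))
        tight (suc d) le = begin
          K (x + suc d)      ≡⟨ cong K (+-suc x d) ⟩
          K (suc (x + d))    ≤⟨ ≮⇒≥ (λ lt → none (x + d , d< , m≤m+n x d , lt)) ⟩
          suc (K (x + d))    ≤⟨ s≤s (tight d (<⇒≤ d<)) ⟩
          suc (K x + d)      ≡⟨ sym (+-suc (K x) d) ⟩
          K x + suc d        ∎
          where
          d< : x + d < y
          d< = ≤-trans (≤-reflexive (sym (+-suc x d))) le
        w = wt x y
        l = len x y
        q = o y ∸ o x
        x≤e : x ≤ suc t
        x≤e = ≤-trans (<⇒≤ x<y) y≤
        o≡ : o x + q ≡ o y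
        o≡ = m+[n∸m]≡n (o-mono (<⇒≤ x<y) y≤)
        few-originals : gap * q ≤ gap + D
        few-originals = +-cancelˡ-≤ (gap * o x) (gap * q) (gap + D) (begin
          gap * o x + gap * q       ≡⟨ sym (*-distribˡ-+ gap (o x) q) ⟩
          gap * (o x + q)           ≡⟨ cong (gap *_) o≡ ⟩
          gap * o y                 ≤⟨ lower y y≤ ⟩
          K y                       ≤⟨ subst (λ z → K z ≤ K x + D) xD≡y (tight D (≤-reflexive xD≡y)) ⟩
          K x + D                   ≤⟨ +-monoˡ-≤ D (<⇒≤ (upper x x≤e)) ⟩
          gap * suc (o x) + D       ≡⟨ e₁ gap (o x) D ⟩
          gap * o x + (gap + D)     ∎)
          where
          e₁ : ∀ a b d → a * suc b + d ≡ a * b + (a + d)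
          e₁ = solve-∀
        w≤ : w ≤ Z * q + D
        w≤ = m≤n+o⇒m∸n≤o (ω y) (ω x) (+-cancelʳ-≤ (o y) (ω y) (ω x + (Z * q + D)) (begin
          ω y + o y                           ≡⟨ tally y y≤ ⟩
          Z * o y + y                         ≡⟨ cong₂ (λ a b → Z * a + b) (sym o≡) (sym xD≡y) ⟩
          Z * (o x + q) + (x + D)             ≡⟨ e₁ Z (o x) q x D ⟩
          (Z * o x + x) + (Z * q + D)         ≡⟨ cong (_+ (Z * q + D)) (sym (tally x x≤e)) ⟩
          (ω x + o x) + (Z * q + D)           ≤⟨ +-monoˡ-≤ (Z * q + D) (+-monoʳ-≤ (ω x) (o-mono (<⇒≤ x<y) y≤)) ⟩
          (ω x + o y) + (Z * q + D)           ≡⟨ e₂ (ω x) (o y) (Z * q + D) ⟩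
          ω x + (Z * q + D) + o y             ∎))
          where
          e₁ : ∀ Z a q x D → Z * (a + q) + (x + D) ≡ (Z * a + x) + (Z * q + D)
          e₁ = solve-∀
          e₂ : ∀ a b c → (a + b) + c ≡ a + c + b
          e₂ = solve-∀
        D≤l : D ≤ l
        D≤l = width≤len x y
        4Z≤w : 4 * Z ≤ w
        4Z≤w = *-cancelˡ-≤ 4 (begin
          4 * (4 * Z)        ≡⟨ e₁ Z ⟩
          4 * Z * 2 * 2      ≤⟨ *-mono-≤ (*-monoʳ-≤ (4 * Z) (s≤s J≥1)) (≤-trans (s≤s (s≤s z≤n)) (*-monoʳ-≤ 3 T≥1)) ⟩
          4 * Z * suc J * (3 * T) ≡⟨ e₂ (4 * Z * suc J) T ⟩
          3 * (H * T)        ≤⟨ heavy ⟩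
          4 * w              ∎)
          where
          e₁ : ∀ Z → 4 * (4 * Z) ≡ 4 * Z * 2 * 2
          e₁ = solve-∀
          e₂ : ∀ h T → h * (3 * T) ≡ 3 * (h * T)
          e₂ = solve-∀
        4D≤w : 4 * D ≤ w
        4D≤w = *-cancelˡ-≤ (3 * N) {{m*n≢0 3 N {{_}} {{>-nonZero N≥1}}}} (begin
          3 * N * (4 * D)     ≡⟨ e₁ N D ⟩
          12 * N * D          ≤⟨ *-mono-≤ (≤-trans Z-large (≤-reflexive (sym W₀≡))) D≤l ⟩
          W₀ * l              ≤⟨ dense ⟩
          3 * N * w           ∎)
          where
          e₁ : ∀ N D → 3 * N * (4 * D) ≡ 12 * N * D
          e₁ = solve-∀
        e≥1 : 1 ≤ e
        e≥1 = n≢0⇒n>0 λ { refl → contradiction (≤-trans (≤-trans N≥1 (m≤n*m N 12)) (≤-trans gap-large (≤-reflexive (*-zeroʳ gap)))) λ () }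
        4ZD≤ : 4 * (Z * D) ≤ gap * w
        4ZD≤ = *-cancelʳ-≤ _ _ e {{>-nonZero e≥1}} (begin
          4 * (Z * D) * e         ≡⟨ e₁ Z D e ⟩
          4 * (Z * e * D)         ≤⟨ *-monoʳ-≤ 4 (*-mono-≤ (≤-reflexive (sym W₀≡)) D≤l) ⟩
          4 * (W₀ * l)            ≤⟨ *-monoʳ-≤ 4 dense ⟩
          4 * (3 * N * w)         ≡⟨ e₂ N w ⟩
          12 * N * w              ≤⟨ *-monoˡ-≤ w gap-large ⟩
          gap * e * w             ≡⟨ e₃ gap e w ⟩
          gap * w * e             ∎)
          where
          e₁ : ∀ Z D e → 4 * (Z * D) * e ≡ 4 * (Z * e * D)
          e₁ = solve-∀
          e₂ : ∀ N w → 4 * (3 * N * w) ≡ 12 * N * w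
          e₂ = solve-∀
          e₃ : ∀ a e w → a * e * w ≡ a * w * e
          e₃ = solve-∀
        overfull : 4 * (gap * w) ≤ 3 * (gap * w)
        overfull = begin
          4 * (gap * w)                                      ≤⟨ *-monoʳ-≤ 4 (*-monoʳ-≤ gap w≤) ⟩
          4 * (gap * (Z * q + D))                            ≡⟨ e₁ gap Z q D ⟩
          4 * Z * (gap * q) + gap * (4 * D)                  ≤⟨ +-mono-≤ (*-monoʳ-≤ (4 * Z) few-originals) (*-monoʳ-≤ gap 4D≤w) ⟩
          4 * Z * (gap + D) + gap * w                        ≡⟨ e₂ Z gap D w ⟩
          gap * (4 * Z) + 4 * (Z * D) + gap * w              ≤⟨ +-monoˡ-≤ (gap * w) (+-mono-≤ (*-monoʳ-≤ gap 4Z≤w) 4ZD≤) ⟩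
          gap * w + gap * w + gap * w                        ≡⟨ e₃ (gap * w) ⟩
          3 * (gap * w)                                      ∎
          where
          e₁ : ∀ g Z q D → 4 * (g * (Z * q + D)) ≡ 4 * Z * (g * q) + g * (4 * D)
          e₁ = solve-∀
          e₂ : ∀ Z g D w → 4 * Z * (g + D) + g * w ≡ g * (4 * Z) + 4 * (Z * D) + g * w
          e₂ = solve-∀
          e₃ : ∀ a → a + a + a ≡ 3 * a
          e₃ = solve-∀
        gap≥1 : 1 ≤ gap
        gap≥1 = n≢0⇒n>0 λ { refl → contradiction (≤-trans (≤-trans N≥1 (m≤n*m N 12)) gap-large) λ () }
        not-full : 3 * (gap * w) < 4 * (gap * w)
        not-full = *-monoˡ-< (gap * w) {{m*n≢0 gap w {{>-nonZero gap≥1}} {{>-nonZero (wt>0 x<y)}}}} {3} {4} ≤-refl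

  module _ {n m r : ℕ} (A : Algorithm n m r) where
    cost-≥ : ∀ {t} .(t≤n : t ≤ n) (Y : Vec (Fin r) t) .(u : Unique Y) → t ≤ cost A t≤n Y u
    cost-≥ t≤n []      u = z≤n
    cost-≥ t≤n (y ∷ Y) u = ≤-trans (≤-trans (s≤s (cost-≥ (<⇒≤ t≤n) Y (AllPairs.tail u))) (≤-reflexive (+-comm 1 _))) (+-monoʳ-≤ (cost A (<⇒≤ t≤n) Y (AllPairs.tail u)) (s≤s z≤n))

  -- Each step relocates at least the new key. The sequence of distinct keys needed to apply this is
  -- borrowed from the lower half of the minimax argument.
  χ-≥ : ∀ n m r (n≤m : n ≤ m) (m<r : m < r) → n ≤ χ n m r n≤m m<r
  χ-≥ n m r n≤m m<r with χ-isLeast n m r n≤m m<r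
  ... | (A , all≤χ) , _ with LabelingGame.Existence.lower m r n n≤m m<r A n (+-identityʳ n) z≤n [] []
  ...   | Y , u , _ = ≤-trans (cost-≥ A ≤-refl Y u) (all≤χ Y u)

  -- The right sentinel `suc R` is the next multiple of `gap` and is weighed like an original key;
  -- hence `suc n₀` in both `R≡` and `W₀≡`.
  module Start (par : Params) (supply : Supply par) {n m r R : ℕ} (R≤r : R ≤ r) (N≡ : suc m ≡ Params.N par) (A : Algorithm n m r)
    (n₀ gap : ℕ) (n₀≤n : n₀ ≤ n) (gap≥1 : 1 ≤ gap) (R≡ : suc R ≡ gap * suc n₀) (W₀≡ : Params.W₀ par ≡ Params.Z par * suc n₀)
    (good : ∀ K → (∀ i → i ≤ suc n₀ → K i ≡ gap * i) → Supply.Good supply (n ∸ n₀) n₀ K (Params.Z par *_)) where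

    open Params par
    open Levels par hiding (X; Y)
    open Potential par
    open Driver par supply R≤r N≡ A

    record Initial (t : ℕ) : Set where
      field
        Y       : Vec (Fin r) t
        unique  : Unique Y
        {K idx} : ℕ → ℕ
        sorted  : Sorted R Y K idx
        K≡      : ∀ i → i ≤ t → K i ≡ gap * i

    initial : ∀ t → t ≤ n₀ → Initial t
    initial zero    _ = record { Y = [] ; unique = [] ; sorted = empty-sorted R ; K≡ = λ { zero z≤n → sym (*-zeroʳ gap) } }
    initial (suc t) t<n₀ = add (initial t (<⇒≤ t<n₀))
      where
      v = gap * suc t
      v>0 : 0 < v
      v>0 = *-mono-≤ gap≥1 (s≤s z≤n)
      v<R : v < suc R
      v<R = <-≤-trans (*-monoʳ-< gap {{>-nonZero gap≥1}} (s≤s t<n₀)) (≤-reflexive (sym R≡))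
      pv<r : pred v < r
      pv<r = ≤-trans (≤-reflexive (suc-pred v {{>-nonZero v>0}})) (≤-trans (s≤s⁻¹ v<R) R≤r)
      y : Fin r
      y = fromℕ< pv<r
      y≡ : suc (toℕ y) ≡ v
      y≡ = trans (cong suc (Finₚ.toℕ-fromℕ< pv<r)) (suc-pred v {{>-nonZero v>0}})
      add : Initial t → Initial (suc t)
      add I₀ = record { Y = y ∷ Y ; unique = Ins.fresh ∷ unique ; sorted = Ins.sorted ; K≡ = eqs }
        where
        open Initial I₀
        module Ins = Insert sorted t ≤-refl y
          (subst₂ _<_ (sym (K≡ t ≤-refl)) (sym y≡) (*-monoʳ-< gap {{>-nonZero gap≥1}} ≤-refl))
          (subst₂ _<_ (sym y≡) (sym (Sorted.K-last sorted)) v<R)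
        eqs : ∀ i → i ≤ suc t → Ins.K′ i ≡ gap * i
        eqs i i≤ with m≤n⇒m<n∨m≡n i≤
        ... | inj₁ (s≤s i≤t) = trans (Ins.K-low i≤t) (K≡ i i≤t)
        ... | inj₂ refl      = trans Ins.K-at y≡

    opening : (I₀ : Initial n₀) → State 0 (n ∸ n₀) n₀ n₀≤n (Initial.Y I₀) (Initial.unique I₀)
    opening I₀ = begin-chain (Chains.fresh-chain par C T refl z≤n z<s (root-reached C refl (posn-last F idx) heavy) (root-core C z<s))
      where
      open Initial I₀
      F = cells (A n₀≤n Y unique)
      C : Config Z
      C = record { P = posn F idx ; ω = Z *_ ; P↑ = posn↑ sorted (A n₀≤n Y unique)
                 ; ω↑ = λ i → *-monoʳ-< Z ≤-refl ; ω≤ = λ i → ≤-reflexive (*-suc Z i) }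
      heavy : W₀ ≤ Config.wt C 0 (suc n₀)
      heavy = ≤-reflexive (trans W₀≡ (sym (cong (Z * suc n₀ ∸_) (*-zeroʳ Z))))
      begin-chain : Σ[ ls ∈ List Level ] (Chains.Valid par C 0 (suc n₀) 0 ls × length ls ≡ T × List-All.All (Chains.Fresh par C) ls) → State 0 (n ∸ n₀) n₀ n₀≤n Y unique
      begin-chain (ls , valid , len≡ , fr) = record
        { sorted = sorted ; C = C ; F = F ; P-first = refl
        ; P-key = λ i i<t → posn-key F idx i<t
        ; P-end = λ i t≤i → posn-end F idx t≤i
        ; good = good K eqs
        -- The loading phase is not charged: κ starts at 0, with the lazy cells equal to those of
        -- the algorithm.
        ; ls = ls ; valid = valid ; levels = len≡ ; heavy = heavy ; κ = 0
        ; lazy = ≤-trans (≤-reflexive (diff-refl F)) z≤n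
        ; progress = ≤-trans (≤-reflexive (trans (+-identityʳ _) (cong (2 *_) (sym (fresh-up fr))))) (m≤m+n _ _)
        }
        where
        eqs : ∀ i → i ≤ suc n₀ → K i ≡ gap * i
        eqs i i≤ with m≤n⇒m<n∨m≡n i≤
        ... | inj₁ (s≤s i≤t) = K≡ i i≤t
        ... | inj₂ refl      = trans (Sorted.K-last sorted) R≡

    result : Result (n ∸ n₀)
    result = subst Result (+-identityʳ (n ∸ n₀)) (loop (n ∸ n₀) (m+[n∸m]≡n n₀≤n) {u = Initial.unique I₀} (opening I₀))
      where I₀ = initial n₀ ≤-refl

  -- Choice of the parameters and of the constants.

  log-ratio : ∀ n m → 1 ≤ n → n ≤ m → ∃ λ k → 2 ^ k * n ≤ m × m < 2 ^ suc k * n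
  log-ratio n m n≥1 n≤m = found (crossing (λ k → 2 ^ k * n ≤? m) m (≤-trans (≤-reflexive (+-identityʳ n)) n≤m)
      (<⇒≱ (<-≤-trans (n<2^n m) (m≤m*n (2 ^ m) n {{>-nonZero n≥1}}))))
    where
    found : (∃ λ j → j < m × 2 ^ j * n ≤ m × ¬ 2 ^ suc j * n ≤ m) → ∃ λ k → 2 ^ k * n ≤ m × m < 2 ^ suc k * n
    found (j , _ , lo , ¬hi) = j , lo , ≰⇒> ¬hi

  odd≤2^ : ∀ k → 2 * k + 1 ≤ 2 * 2 ^ k
  odd≤2^ zero = s≤s z≤n
  odd≤2^ (suc k) = begin
    2 * suc k + 1          ≡⟨ e k ⟩
    (2 * k + 1) + 2        ≤⟨ +-mono-≤ (odd≤2^ k) (*-monoʳ-≤ 2 (m^n>0 2 k)) ⟩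
    2 * 2 ^ k + 2 * 2 ^ k  ≡⟨ e′ (2 ^ k) ⟩
    2 * 2 ^ suc k          ∎
    where
    e : ∀ k → 2 * suc k + 1 ≡ (2 * k + 1) + 2
    e = solve-∀
    e′ : ∀ a → 2 * a + 2 * a ≡ 2 * (2 * a)
    e′ = solve-∀

  square≤2^ : ∀ k → k * k ≤ 2 * 2 ^ k
  square≤2^ zero    = z≤n
  square≤2^ (suc k) = begin
    suc k * suc k              ≡⟨ e k ⟩
    k * k + (2 * k + 1)        ≤⟨ +-mono-≤ (square≤2^ k) (odd≤2^ k) ⟩
    2 * 2 ^ k + 2 * 2 ^ k      ≡⟨ e′ (2 ^ k) ⟩
    2 * 2 ^ suc k              ∎
    where
    e : ∀ k → suc k * suc k ≡ k * k + (2 * k + 1)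
    e = solve-∀
    e′ : ∀ a → 2 * a + 2 * a ≡ 2 * (2 * a)
    e′ = solve-∀

  -- The factor 2 comes from n ≤ 2 (n - n₀), each 7 from comparing p + 1 with ν T, and 18 = 4 · 2 +
  -- 10 from bounding n + 1 by 2 c and the cost by c.
  total-bound : ∀ {n n₀ p G T ν z c} → 2 ≤ n → 2 * n₀ ≤ n → n₀ ≤ n → n ≤ c → z ≤ c → suc p ≤ 7 * (ν * T) →
    (n ∸ n₀) * (T * T) ≤ 4 * G * suc n + 10 * G * z → n * (suc p * suc p) ≤ 2 * (7 * 7) * 18 * (ν * ν) * G * c
  total-bound {n} {n₀} {p} {G} {T} {ν} {z} {c} n≥2 n₀-low n₀≤n n≤c z≤c suc-p≤ le = begin
      n * (suc p * suc p)                            ≤⟨ *-mono-≤ half (*-mono-≤ suc-p≤ suc-p≤) ⟩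
      2 * (n ∸ n₀) * (7 * (ν * T) * (7 * (ν * T)))   ≡⟨ e₁ 2 7 (n ∸ n₀) ν T ⟩
      2 * (7 * 7) * (ν * ν) * ((n ∸ n₀) * (T * T))   ≤⟨ *-monoʳ-≤ (2 * (7 * 7) * (ν * ν)) game ⟩
      2 * (7 * 7) * (ν * ν) * (18 * (G * c))         ≡⟨ e₂ (2 * (7 * 7)) (ν * ν) 18 G c ⟩
      2 * (7 * 7) * 18 * (ν * ν) * G * c             ∎
    where
    e₁ : ∀ a b d ν T → a * d * (b * (ν * T) * (b * (ν * T))) ≡ a * (b * b) * (ν * ν) * (d * (T * T))
    e₁ = solve-∀
    e₂ : ∀ x a y G c → x * a * (y * (G * c)) ≡ x * y * a * G * c
    e₂ = solve-∀
    half : n ≤ 2 * (n ∸ n₀)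
    half = +-cancelʳ-≤ (2 * n₀) n (2 * (n ∸ n₀)) (begin
      n + 2 * n₀                  ≤⟨ +-monoʳ-≤ n n₀-low ⟩
      n + n                       ≡⟨ cong (n +_) (sym (+-identityʳ n)) ⟩
      2 * n                       ≡⟨ cong (2 *_) (sym (m∸n+n≡m n₀≤n)) ⟩
      2 * (n ∸ n₀ + n₀)           ≡⟨ *-distribˡ-+ 2 (n ∸ n₀) n₀ ⟩
      2 * (n ∸ n₀) + 2 * n₀       ∎)
    game : (n ∸ n₀) * (T * T) ≤ 18 * (G * c)
    game = begin
      (n ∸ n₀) * (T * T)               ≤⟨ le ⟩
      4 * G * suc n + 10 * G * z       ≤⟨ +-mono-≤ (*-monoʳ-≤ (4 * G) (≤-trans (+-monoˡ-≤ n (<⇒≤ n≥2)) (+-mono-≤ n≤c n≤c))) (*-monoʳ-≤ (10 * G) z≤c) ⟩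
      4 * G * (c + c) + 10 * G * c     ≡⟨ e G c ⟩
      18 * (G * c)                     ∎
      where
      e : ∀ G c → 4 * G * (c + c) + 10 * G * c ≡ 18 * (G * c)
      e = solve-∀

  opaque
    -- The constants of `total-bound` with ν ≤ 19 k, J + 1 ≤ 41 k and J ≤ 40 k inserted into G = 8 ·
    -- 4 Z (J + 1) · J.
    c₁ : ℕ
    c₁ = 2 * (7 * 7) * 18 * (19 * 19) * (8 * 4 * 41 * 40)

    c₁-game : c₁ ≡ 2 * (7 * 7) * 18 * (19 * 19) * (8 * 4 * 41 * 40)
    c₁-game = refl

    c₁-short : suc (5 * 40 * (3 * 19)) * suc (5 * 40 * (3 * 19)) ≤ c₁
    c₁-short = ≤ᵇ⇒≤ (suc (5 * 40 * (3 * 19)) * suc (5 * 40 * (3 * 19))) _ _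

  active-bound : ∀ {lhs ν k G Z c} → ν ≤ 19 * k → G ≤ 8 * (4 * Z * (41 * k)) * (40 * k) → lhs ≤ 2 * (7 * 7) * 18 * (ν * ν) * G * c →
    lhs ≤ c₁ * (k * k * (k * k)) * Z * c
  active-bound {lhs} {ν} {k} {G} {Z} {c} ν≤ G≤ h = ≤-trans h (≤-trans
      (*-monoˡ-≤ c (*-mono-≤ (*-monoʳ-≤ (2 * (7 * 7) * 18) (*-mono-≤ ν≤ ν≤)) G≤))
      (≤-reflexive (trans (e (2 * (7 * 7) * 18) 19 8 4 41 40 k Z c) (cong (λ a → a * (k * k * (k * k)) * Z * c) (sym c₁-game)))))
    where
    e : ∀ a b c d f g k Z y → a * (b * k * (b * k)) * (c * (d * Z * (f * k)) * (g * k)) * y ≡ a * (b * b) * (c * d * f * g) * (k * k * (k * k)) * Z * y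
    e = solve-∀

  G-bound : (par : Params) → ∀ {a b} → suc (Params.J par) ≤ a → Params.J par ≤ b → Params.G par ≤ 8 * (4 * Params.Z par * a) * b
  G-bound par sJ≤ J≤ = *-mono-≤ (*-monoʳ-≤ 8 (*-monoʳ-≤ (4 * Params.Z par) sJ≤)) J≤

  -- If n is too small for the required number of levels, then log n is of order at most k², and the
  -- trivial bound n ≤ c is already enough.
  short-bound : ∀ {n p ν k Z c S} → n ≤ c → 1 ≤ k → 1 ≤ Z → suc p ≤ suc (S * (3 * ν)) → S ≤ 5 * (40 * k) → ν ≤ 19 * k →
    n * (suc p * suc p) ≤ c₁ * (k * k * (k * k)) * Z * c
  short-bound {n} {p} {ν} {k} {Z} {c} {S} n≤c k≥1 Z≥1 p< S≤ ν≤ =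
      ≤-trans (*-mono-≤ n≤c (*-mono-≤ p≤ p≤)) (≤-trans (≤-reflexive (e a (k * k) c))
        (*-monoˡ-≤ c (≤-trans (*-monoˡ-≤ (k * k * (k * k)) c₁-short) (m≤m*n (c₁ * (k * k * (k * k))) Z {{>-nonZero Z≥1}}))))
    where
    a = suc (5 * 40 * (3 * 19))
    e : ∀ a b c → c * (a * b * (a * b)) ≡ a * a * (b * b) * c
    e = solve-∀
    scale : ∀ a b c d k → 1 ≤ k → suc (a * (b * k) * (c * (d * k))) ≤ suc (a * b * (c * d)) * (k * k)
    scale a b c d k k≥1 = +-mono-≤ (*-mono-≤ k≥1 k≥1) (≤-reflexive (e′ a b c d k))
      where
      e′ : ∀ a b c d k → a * (b * k) * (c * (d * k)) ≡ a * b * (c * d) * (k * k)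
      e′ = solve-∀
    p≤ : suc p ≤ a * (k * k)
    p≤ = ≤-trans p< (≤-trans (s≤s (*-mono-≤ S≤ (*-monoʳ-≤ 3 ν≤))) (scale 5 40 3 19 k k≥1))

  -- ν is chosen so that 8 H ≤ 2^ν; then W-large holds for (p − 1) / 3ν levels.
  module Choice (n m r k p : ℕ) (k≥1 : 1 ≤ k) (m≥ : 2 ^ k * n ≤ m) (m< : m < 2 ^ suc k * n) (n≥ : 2 ^ p ≤ n) (n< : n < 2 ^ suc p)
    (n≥2 : 2 ≤ n) (n≤m : n ≤ m) (A : Algorithm n m r) (c : ℕ) (all≤c : ∀ Y (u : Unique Y) → cost A ≤-refl Y u ≤ c) (n≤c : n ≤ c) where

    n₀ ν μ′ : ℕ
    n₀ = n / 2
    -- 8 H = 8 · 4 · Z · (J + 1) is at most 2^5 · 2^(6+k) · 2^(6+k), where 2^(6+k) is the largest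
    -- `Z` in use.
    ν = 2 * k + 17
    -- As m + 1 ≤ 2^(k+2) (n₀ + 1), 2 Z N is at most 2^(k+3) W₀; one more makes `W-dense` strict.
    μ′ = k + 4

    ν≥1 : 1 ≤ ν
    ν≥1 = ≤-trans (s≤s z≤n) (m≤n+m 17 (2 * k))

    instance
      3ν≢0 : NonZero (3 * ν)
      3ν≢0 = m*n≢0 3 ν {{_}} {{>-nonZero ν≥1}}

    levels : ℕ
    levels = (p ∸ 1) / (3 * ν)

    levels-low : levels * (3 * ν) ≤ p ∸ 1
    levels-low = m/n*n≤m (p ∸ 1) (3 * ν)

    levels-high : p ∸ 1 < suc levels * (3 * ν)
    levels-high = begin-strict
      p ∸ 1                                             ≡⟨ m≡m%n+[m/n]*n (p ∸ 1) (3 * ν) ⟩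
      (p ∸ 1) % (3 * ν) + levels * (3 * ν)              <⟨ +-monoˡ-< (levels * (3 * ν)) (m%n<n (p ∸ 1) (3 * ν)) ⟩
      3 * ν + levels * (3 * ν)                          ∎

    p≥1 : 1 ≤ p
    p≥1 = n≢0⇒n>0 λ { refl → contradiction (≤-trans n≥2 (≤-refl {n})) (<⇒≱ n<) }

    p< : suc p ≤ suc (suc levels * (3 * ν))
    p< = s≤s (≤-trans (≤-reflexive (sym (m+[n∸m]≡n p≥1))) levels-high)

    n₀-low : 2 * n₀ ≤ n
    n₀-low = ≤-trans (≤-reflexive (*-comm 2 n₀)) (m/n*n≤m n 2)

    n₀-high : n < 2 * suc n₀
    n₀-high = begin-strict
      n                     ≡⟨ m≡m%n+[m/n]*n n 2 ⟩
      n % 2 + n₀ * 2        <⟨ +-monoˡ-< (n₀ * 2) (m%n<n n 2) ⟩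
      2 + n₀ * 2            ≡⟨ *-comm (suc n₀) 2 ⟩
      2 * suc n₀            ∎

    n₀≥1 : 1 ≤ n₀
    n₀≥1 = n≢0⇒n>0 λ e → contradiction (<-≤-trans n₀-high (≤-reflexive (cong (λ z → 2 * suc z) e))) (≤⇒≯ n≥2)

    n₀<n : suc n₀ ≤ n
    n₀<n = ≤-trans (≤-trans (+-monoˡ-≤ n₀ n₀≥1) (≤-reflexive (cong (n₀ +_) (sym (+-identityʳ n₀))))) n₀-low

    n₀≤n : n₀ ≤ n
    n₀≤n = <⇒≤ n₀<n

    N≤ : suc m ≤ 2 ^ (2 + k) * suc n₀
    N≤ = begin
      suc m                          ≤⟨ m< ⟩
      2 ^ suc k * n                  ≤⟨ *-monoʳ-≤ (2 ^ suc k) (<⇒≤ n₀-high) ⟩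
      2 ^ suc k * (2 * suc n₀)       ≡⟨ e (2 ^ suc k) (suc n₀) ⟩
      2 ^ (2 + k) * suc n₀           ∎
      where
      e : ∀ a b → a * (2 * b) ≡ 2 * a * b
      e = solve-∀

    fill-4 : ∀ c → c ≤ c * k
    fill-4 c = m≤m*n c k {{>-nonZero k≥1}}

    ν≤ : ν ≤ 19 * k
    ν≤ = ≤-trans (+-monoʳ-≤ (2 * k) (fill-4 17)) (≤-reflexive (sym (*-distribʳ-+ k 2 17)))

    μ≤ : μ′ ≤ 5 * k
    μ≤ = +-monoʳ-≤ k (fill-4 4)

    J≤ : 8 * μ′ ≤ 40 * k
    J≤ = ≤-trans (*-monoʳ-≤ 8 μ≤) (≤-reflexive (sym (*-assoc 8 5 k)))

    sJ≤ : suc (8 * μ′) ≤ 41 * k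
    sJ≤ = +-mono-≤ k≥1 J≤

    module Game (Z : ℕ) (Z≥1 : 1 ≤ Z) (Z≤ : Z ≤ 2 ^ (6 + k)) (T-large : 5 * (8 * μ′) ≤ suc levels) where

      T≥1 : 1 ≤ levels
      T≥1 = s≤s⁻¹ (≤-trans (≤-trans (s≤s (s≤s (z≤n {38}))) (*-monoʳ-≤ 5 (*-monoʳ-≤ 8 (≤-trans k≥1 (m≤m+n k 4))))) T-large)

      8H≤ : 8 * (4 * Z * suc (8 * μ′)) ≤ 2 ^ ν
      8H≤ = begin
        8 * (4 * Z * suc (8 * μ′))          ≤⟨ *-monoʳ-≤ 8 (*-mono-≤ (*-monoʳ-≤ 4 Z≤) small) ⟩
        8 * (4 * 2 ^ (6 + k) * 2 ^ (6 + k)) ≡⟨ e (2 ^ (6 + k)) ⟩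
        2 ^ 5 * (2 ^ (6 + k) * 2 ^ (6 + k)) ≡⟨ cong (2 ^ 5 *_) (sym (^-distribˡ-+-* 2 (6 + k) (6 + k))) ⟩
        2 ^ 5 * 2 ^ ((6 + k) + (6 + k))     ≡⟨ sym (^-distribˡ-+-* 2 5 ((6 + k) + (6 + k))) ⟩
        2 ^ (5 + ((6 + k) + (6 + k)))       ≡⟨ cong (2 ^_) (e′ k) ⟩
        2 ^ ν                               ∎
        where
        e : ∀ a → 8 * (4 * a * a) ≡ 32 * (a * a)
        e = solve-∀
        e′ : ∀ k → 5 + ((6 + k) + (6 + k)) ≡ 2 * k + 17
        e′ = solve-∀
        small : suc (8 * μ′) ≤ 2 ^ (6 + k)
        small = begin
          suc (8 * μ′)           ≡⟨ e₁ k ⟩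
          8 * k + 33             ≤⟨ +-mono-≤ (*-monoʳ-≤ 8 (<⇒≤ (n<2^n k))) (*-monoʳ-≤ 33 (m^n>0 2 k)) ⟩
          8 * 2 ^ k + 33 * 2 ^ k ≡⟨ sym (*-distribʳ-+ (2 ^ k) 8 33) ⟩
          41 * 2 ^ k             ≤⟨ *-monoˡ-≤ (2 ^ k) (m≤m+n 41 23) ⟩
          64 * 2 ^ k             ≡⟨ sym (^-distribˡ-+-* 2 6 k) ⟩
          2 ^ (6 + k)            ∎
          where
          e₁ : ∀ k → suc (8 * (k + 4)) ≡ 8 * k + 33
          e₁ = solve-∀

      W-large′ : 4 * Z * suc (8 * μ′) * levels * (8 * (4 * Z * suc (8 * μ′))) ^ levels ≤ Z * suc n₀
      W-large′ = begin
          -- Each of the three factors `H`, `T` and (8 H)^T is at most 2^(ν T); hence the divisor 3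
          -- ν in `levels`.
          H * T * (8 * H) ^ T                   ≤⟨ *-mono-≤ (*-mono-≤ (≤-trans (m≤n*m H 8) 8H≤) T≤2^ν) (^-monoˡ-≤ T 8H≤) ⟩
          2 ^ ν * (2 ^ ν) ^ T * (2 ^ ν) ^ T     ≤⟨ *-monoˡ-≤ ((2 ^ ν) ^ T) (*-monoˡ-≤ ((2 ^ ν) ^ T) first) ⟩
          (2 ^ ν) ^ T * (2 ^ ν) ^ T * (2 ^ ν) ^ T  ≡⟨ cong (λ a → a * a * a) (^-*-assoc 2 ν T) ⟩
          2 ^ (ν * T) * 2 ^ (ν * T) * 2 ^ (ν * T)  ≡⟨ trans (cong (_* 2 ^ (ν * T)) (sym (^-distribˡ-+-* 2 (ν * T) (ν * T)))) (sym (^-distribˡ-+-* 2 (ν * T + ν * T) (ν * T))) ⟩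
          2 ^ (ν * T + ν * T + ν * T)           ≤⟨ ^-monoʳ-≤ 2 (≤-trans (≤-reflexive (e ν T)) levels-low) ⟩
          2 ^ (p ∸ 1)                           ≤⟨ *-cancelˡ-≤ 2 (≤-trans (≤-reflexive (cong (2 ^_) (m+[n∸m]≡n p≥1))) (≤-trans n≥ (<⇒≤ n₀-high))) ⟩
          suc n₀                                ≤⟨ m≤n*m (suc n₀) Z {{>-nonZero Z≥1}} ⟩
          Z * suc n₀                            ∎
        where
        H = 4 * Z * suc (8 * μ′)
        T = levels
        T≤2^ν : T ≤ (2 ^ ν) ^ T
        T≤2^ν = ≤-trans (<⇒≤ (n<2^n T)) (^-monoˡ-≤ T (≤-trans (≤-reflexive (sym (*-identityʳ 2))) (^-monoʳ-≤ 2 ν≥1)))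
        first : 2 ^ ν ≤ (2 ^ ν) ^ T
        first = ≤-trans (≤-reflexive (sym (^-identityʳ (2 ^ ν)))) (^-monoʳ-≤ (2 ^ ν) {{m^n≢0 2 ν}} T≥1)
        e : ∀ ν T → ν * T + ν * T + ν * T ≡ T * (3 * ν)
        e = solve-∀

      par : Params
      par = record
        { Z = Z ; μ = μ′ ; T = levels ; N = suc m ; W₀ = Z * suc n₀ ; Z≥1 = Z≥1 ; μ≥1 = ≤-trans k≥1 (m≤m+n k 4) ; T-large = T-large
        ; W-dense = begin-strict
            2 * Z * suc m                         ≤⟨ *-monoʳ-≤ (2 * Z) N≤ ⟩
            2 * Z * (2 ^ (2 + k) * suc n₀)        ≡⟨ e Z (2 ^ (2 + k)) (suc n₀) ⟩
            2 ^ (3 + k) * (Z * suc n₀)            <⟨ *-monoˡ-< (Z * suc n₀) {{m*n≢0 Z (suc n₀) {{>-nonZero Z≥1}}}} (^-monoʳ-< 2 ≤-refl {3 + k} {k + 4} (≤-reflexive (+-comm 4 k))) ⟩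
            2 ^ μ′ * (Z * suc n₀)                 ∎
        ; W-large = W-large′ }
        where
        e : ∀ Z a b → 2 * Z * (a * b) ≡ 2 * a * (Z * b)
        e = solve-∀

      open Params par using (G)

      suc-p≤ : suc p ≤ 7 * (ν * levels)
      suc-p≤ = begin
        suc p                                     ≤⟨ p< ⟩
        suc (suc levels * (3 * ν))                ≤⟨ +-mono-≤ (*-mono-≤ ν≥1 T≥1) (*-monoˡ-≤ (3 * ν) (≤-trans (+-monoˡ-≤ levels T≥1) (≤-reflexive refl))) ⟩
        ν * levels + (levels + levels) * (3 * ν)  ≡⟨ e ν levels ⟩
        7 * (ν * levels)                          ∎
        where
        e : ∀ ν T → ν * T + (T + T) * (3 * ν) ≡ 7 * (ν * T)
        e = solve-∀

      bound : (supply : Supply par) (R gap : ℕ) → R ≤ r → 1 ≤ gap → suc R ≡ gap * suc n₀ →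
        (∀ K → (∀ i → i ≤ suc n₀ → K i ≡ gap * i) → Supply.Good supply (n ∸ n₀) n₀ K (Z *_)) →
        n * (suc p * suc p) ≤ c₁ * (k * k * (k * k)) * Z * c
      bound supply R gap R≤r gap≥1 R≡ good = combine (Start.result par supply R≤r refl A n₀ gap n₀≤n gap≥1 R≡ refl good)
        where
        G≤ : G ≤ 8 * (4 * Z * (41 * k)) * (40 * k)
        G≤ = G-bound par {41 * k} {40 * k} sJ≤ J≤
        combine : Driver.Result par supply R≤r refl A (n ∸ n₀) → n * (suc p * suc p) ≤ c₁ * (k * k * (k * k)) * Z * c
        combine (Y , u , le) = active-bound {n * (suc p * suc p)} {ν} {k} {G} {Z} {c} ν≤ G≤ (total-bound {n} {n₀} {p} {G} {Params.T par} {ν} {cost A ≤-refl Y u} {c} n≥2 n₀-low n₀≤n n≤c (all≤c Y u) suc-p≤ le)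

    bound : (Z : ℕ) (Z≥1 : 1 ≤ Z) (Z≤ : Z ≤ 2 ^ (6 + k))
      (supply : (T-large : 5 * (8 * μ′) ≤ suc levels) → Supply (Game.par Z Z≥1 Z≤ T-large)) (R gap : ℕ) → R ≤ r → 1 ≤ gap → suc R ≡ gap * suc n₀ →
      (∀ T-large K → (∀ i → i ≤ suc n₀ → K i ≡ gap * i) → Supply.Good (supply T-large) (n ∸ n₀) n₀ K (Z *_)) →
      n * (suc p * suc p) ≤ c₁ * (k * k * (k * k)) * Z * c
    bound Z Z≥1 Z≤ supply R gap R≤r gap≥1 R≡ good = decide (5 * (8 * μ′) ≤? suc levels)
      where
      decide : Dec (5 * (8 * μ′) ≤ suc levels) → n * (suc p * suc p) ≤ c₁ * (k * k * (k * k)) * Z * c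
      decide (yes large) = Game.bound Z Z≥1 Z≤ large (supply large) R gap R≤r gap≥1 R≡ (good large)
      decide (no ¬large) = short-bound {n} {p} {ν} {k} {Z} {c} {suc levels} n≤c k≥1 Z≥1 p< (≤-trans (<⇒≤ (≰⇒> ¬large)) (*-monoʳ-≤ 5 J≤)) ν≤

  opaque
    unfolding c₁

    C₀ : ℕ
    C₀ = c₁ * (2 * 64)

    C₀≡ : C₀ ≡ c₁ * (2 * 64)
    C₀≡ = refl

    26≤C₀ : 26 ≤ C₀
    26≤C₀ = ≤ᵇ⇒≤ 26 C₀ _

  -- The game loses a factor k⁴. Two powers of k match ln(1/δ)²; the other two are absorbed by 2^k,
  -- which is of order 1/δ.
  rate-2^ : ∀ k {lhs c} → lhs ≤ c₁ * (k * k * (k * k)) * 1 * c → lhs ≤ C₀ * (k * k) * 2 ^ k * c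
  rate-2^ k {lhs} {c} h = ≤-trans h (*-monoˡ-≤ c (begin
      c₁ * (k * k * (k * k)) * 1           ≡⟨ *-identityʳ (c₁ * (k * k * (k * k))) ⟩
      c₁ * (k * k * (k * k))               ≤⟨ *-monoʳ-≤ c₁ (*-monoʳ-≤ (k * k) (square≤2^ k)) ⟩
      c₁ * (k * k * (2 * 2 ^ k))           ≡⟨ e c₁ (k * k) 2 (2 ^ k) ⟩
      c₁ * 2 * (k * k) * 2 ^ k             ≤⟨ *-monoˡ-≤ (2 ^ k) (*-monoˡ-≤ (k * k) (*-monoʳ-≤ c₁ (m≤m*n 2 64))) ⟩
      c₁ * (2 * 64) * (k * k) * 2 ^ k      ≡⟨ cong (λ a → a * (k * k) * 2 ^ k) (sym C₀≡) ⟩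
      C₀ * (k * k) * 2 ^ k                 ∎))
    where
    e : ∀ c a t b → c * (a * (t * b)) ≡ c * t * a * b
    e = solve-∀

  -- The weight Z = 2^(6+k) costs a further factor of order 1/δ; this is where δ² in the second
  -- bound comes from.
  rate-4^ : ∀ k {lhs c} → lhs ≤ c₁ * (k * k * (k * k)) * 2 ^ (6 + k) * c → lhs ≤ C₀ * (k * k) * (2 ^ k * 2 ^ k) * c
  rate-4^ k {lhs} {c} h = ≤-trans h (*-monoˡ-≤ c (begin
      c₁ * (k * k * (k * k)) * 2 ^ (6 + k)        ≤⟨ *-mono-≤ (*-monoʳ-≤ c₁ (*-monoʳ-≤ (k * k) (square≤2^ k))) (≤-reflexive (^-distribˡ-+-* 2 6 k)) ⟩
      c₁ * (k * k * (2 * 2 ^ k)) * (2 ^ 6 * 2 ^ k)   ≡⟨ e c₁ (k * k) 2 (2 ^ k) (2 ^ 6) ⟩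
      c₁ * (2 * 2 ^ 6) * (k * k) * (2 ^ k * 2 ^ k)   ≡⟨ cong (λ a → a * (k * k) * (2 ^ k * 2 ^ k)) (sym C₀≡) ⟩
      C₀ * (k * k) * (2 ^ k * 2 ^ k)              ∎))
    where
    e : ∀ c a t b s → c * (a * (t * b)) * (s * b) ≡ c * (t * s) * a * (b * b)
    e = solve-∀

  module Combine (n m r k p : ℕ) (k≥1 : 1 ≤ k) (m≥ : 2 ^ k * n ≤ m) (m< : m < 2 ^ suc k * n) (n≥ : 2 ^ p ≤ n) (n< : n < 2 ^ suc p)
    (n≥2 : 2 ≤ n) (n≤m : n ≤ m) (A : Algorithm n m r) (c : ℕ) (all≤c : ∀ Y (u : Unique Y) → cost A ≤-refl Y u ≤ c) (n≤c : n ≤ c) where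
    open Choice n m r k p k≥1 m≥ m< n≥ n< n≥2 n≤m A c all≤c n≤c

    many-keys : n * 2 ^ (n ∸ 1) ≤ r → n * (suc p * suc p) ≤ C₀ * (k * k) * 2 ^ k * c
    many-keys r-large = rate-2^ k (bound 1 ≤-refl (m^n>0 2 (6 + k)) (λ T-large → bisection (Game.par 1 ≤-refl (m^n>0 2 (6 + k)) T-large)) (pred (gap * suc n₀)) gap
        R≤r (m^n>0 2 (n ∸ n₀)) (suc-pred (gap * suc n₀) {{m*n≢0 gap (suc n₀) {{m^n≢0 2 (n ∸ n₀)}}}}) good)
      where
      -- Room for one bisection per remaining insertion.
      gap = 2 ^ (n ∸ n₀)
      R≤r : pred (gap * suc n₀) ≤ r
      R≤r = begin
        pred (gap * suc n₀)        ≤⟨ pred[n]≤n ⟩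
        gap * suc n₀               ≤⟨ *-mono-≤ (^-monoʳ-≤ 2 (∸-monoʳ-≤ n n₀≥1)) n₀<n ⟩
        2 ^ (n ∸ 1) * n            ≡⟨ *-comm (2 ^ (n ∸ 1)) n ⟩
        n * 2 ^ (n ∸ 1)            ≤⟨ r-large ⟩
        r                          ∎
      good : (T-large : 5 * (8 * μ′) ≤ suc levels) → ∀ K → (∀ i → i ≤ suc n₀ → K i ≡ gap * i) → ∀ i → i ≤ n₀ → K i + 2 ^ (n ∸ n₀) ≤ K (suc i)
      good _ K K≡ i i≤ = ≤-reflexive (trans (cong (_+ gap) (K≡ i (m≤n⇒m≤1+n i≤))) (trans (+-comm (gap * i) gap) (trans (sym (*-suc gap i)) (sym (K≡ (suc i) (s≤s i≤))))))

    few-keys : 26 * m ≤ r → n * (suc p * suc p) ≤ C₀ * (k * k) * (2 ^ k * 2 ^ k) * c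
    few-keys r-large = rate-4^ k (bound Z Z≥1 ≤-refl (λ T-large → density-supply (Game.par Z Z≥1 ≤-refl T-large) gap (suc n₀) refl (s≤s z≤n) gap-large Z-large) (pred (gap * suc n₀)) gap
        (≤-trans pred[n]≤n gap-low) gap≥1 (suc-pred (gap * suc n₀) {{m*n≢0 gap (suc n₀) {{>-nonZero gap≥1}}}}) (λ _ → good))
      where
      Z = 2 ^ (6 + k)
      Z≥1 : 1 ≤ Z
      Z≥1 = m^n>0 2 (6 + k)
      gap = r / suc n₀
      gap-low : gap * suc n₀ ≤ r
      gap-low = m/n*n≤m r (suc n₀)
      -- Rounding r / (n₀ + 1) down loses at most n₀ + 1 ≤ m, and 12 (m + 1) ≤ 24 m; the factor 26
      -- covers both.
      gap-large : 12 * suc m ≤ gap * suc n₀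
      gap-large = +-cancelˡ-≤ (suc n₀) _ _ (begin
        suc n₀ + 12 * suc m                         ≤⟨ +-mono-≤ (≤-trans n₀<n n≤m) (*-monoʳ-≤ 12 (+-monoˡ-≤ m (≤-trans (<⇒≤ n≥2) n≤m))) ⟩
        m + 12 * (m + m)                            ≤⟨ ≤-trans (m≤n+m _ m) (≤-reflexive (e′ m)) ⟩
        26 * m                                      ≤⟨ r-large ⟩
        r                                           ≡⟨ m≡m%n+[m/n]*n r (suc n₀) ⟩
        r % suc n₀ + gap * suc n₀                   ≤⟨ +-monoˡ-≤ (gap * suc n₀) (<⇒≤ (m%n<n r (suc n₀))) ⟩
        suc n₀ + gap * suc n₀                       ∎)
        where
        e′ : ∀ m → m + (m + 12 * (m + m)) ≡ 26 * m
        e′ = solve-∀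
      gap≥1 : 1 ≤ gap
      gap≥1 = n≢0⇒n>0 λ z → contradiction (≤-trans gap-large (≤-reflexive (cong (_* suc n₀) z))) λ ()
      Z-large : 12 * suc m ≤ Z * suc n₀
      Z-large = begin
        12 * suc m                         ≤⟨ *-mono-≤ (≤ᵇ⇒≤ 12 16 _) N≤ ⟩
        16 * (2 ^ (2 + k) * suc n₀)        ≡⟨ sym (*-assoc 16 (2 ^ (2 + k)) (suc n₀)) ⟩
        16 * 2 ^ (2 + k) * suc n₀          ≡⟨ cong (_* suc n₀) (sym (^-distribˡ-+-* 2 4 (2 + k))) ⟩
        Z * suc n₀                         ∎
      good : ∀ K → (∀ i → i ≤ suc n₀ → K i ≡ gap * i) → Spaced gap Z n₀ K (Z *_)
      good K K≡ = record
        { o = λ i → i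
        ; lower = λ i i≤ → ≤-reflexive (sym (K≡ i i≤))
        ; upper = λ i i≤ → ≤-<-trans (≤-reflexive (K≡ i i≤)) (*-monoʳ-< gap {{>-nonZero gap≥1}} ≤-refl)
        ; next = λ i i≤ → inj₂ (refl , K≡ (suc i) (s≤s i≤))
        ; tally = λ i _ → refl }

-- Riemann sums of the logarithm against dyadic logarithms.

module Logarithm where

  open import Data.Nat as ℕ using (ℕ; zero; suc)
  import Data.Nat.Properties as ℕₚ
  open import Data.Nat.Tactic.RingSolver using (solve-∀)
  open import Data.Product
  open import Data.Sum using (_⊎_; inj₁; inj₂; [_,_]′)
  open import Data.Rational using (1ℚ; ½)
  import Data.Rational.Properties as ℚₚ
  open import Relation.Binary.PropositionalEquality using (_≡_; refl; sym; trans; cong; cong₂; subst; subst₂)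
  open import Relation.Binary.Bundles using (Poset)
  open import Relation.Nullary.Decidable using (dec⇒maybe)
  import Data.Maybe
  import Algebra.Bundles as AB
  import Algebra.Solver.Ring as RingSolver
  open SegmentChains using (n<2^n)

  module LnBounds (O : OrderedField.Ops) (laws : OrderedField.Laws O) (total : ∀ a b → OrderedField.Ops._≤_ O a b ⊎ OrderedField.Ops._≤_ O b a) where

    open OrderedField.Ops O
    open OrderedField.Laws laws
    open OrderedField.Generic O laws
    open AB.CommutativeRing ring using (*-assoc; *-comm; *-identityˡ; *-identityʳ; +-identityˡ; +-identityʳ; zeroˡ; distribʳ; distribˡ)
    open RingSolver _ acr morphism (λ p q → Data.Maybe.map (cong ⟦_⟧) (dec⇒maybe (p ℚₚ.≟ q)))
      using (solve; _:+_; _:*_; _:-_; :-_; _:=_; con)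
    open import Relation.Binary.Reasoning.PartialOrder poset
    open Poset poset using () renaming (refl to ≤-refl′; trans to ≤-trans′; reflexive to ≤-reflexive′)

    +-cancelʳ : ∀ {a b} c → a + c ≤ b + c → a ≤ b
    +-cancelʳ {a} {b} c h = subst₂ _≤_ (e a c) (e b c) (+-mono-≤′ h (≤-refl′ { - c }))
      where
      e : ∀ a c → a + c + - c ≡ a
      e = solve 2 (λ a c → a :+ c :+ :- c := a) refl

    *-cancelʳ : ∀ {a b} c → 0# < c → a * c ≤ b * c → a ≤ b
    *-cancelʳ {a} {b} c 0<c h = subst₂ _≤_ (e a) (e b) (*-monoʳ (rec c) (rec-≥0 0<c) h)
      where
      e : ∀ a → a * c * rec c ≡ a
      e a = trans (*-assoc a c (rec c)) (trans (cong (a *_) (rec-inv 0<c)) (*-identityʳ a))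

    +-≥ : ∀ a {b} → 0# ≤ b → a ≤ a + b
    +-≥ a {b} 0≤b = subst (_≤ a + b) (+-identityʳ a) (+-mono-≤′ (≤-refl′ {a}) 0≤b)

    two^ r : ℕ → F
    two^ j = num (2 ℕ.^ j)
    r j = rec (two^ j)

    two^>0 : ∀ j → 0# < two^ j
    two^>0 j = subst (λ z → 0# < num z) (ℕₚ.suc-pred (2 ℕ.^ j) {{ℕₚ.m^n≢0 2 j}}) (num-pos (ℕ.pred (2 ℕ.^ j)))

    two^-suc : ∀ j → two^ (suc j) ≡ two^ j + two^ j
    two^-suc j = trans (cong num (cong (2 ℕ.^ j ℕ.+_) (ℕₚ.+-identityʳ (2 ℕ.^ j)))) (num-+ (2 ℕ.^ j) (2 ℕ.^ j))

    r≥0 : ∀ j → 0# ≤ r j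
    r≥0 j = rec-≥0 (two^>0 j)

    r-halves : ∀ j → r j ≡ r (suc j) + r (suc j)
    r-halves j = trans (sym (*-identityʳ (r j))) (trans (cong (r j *_) (sym (rec-inv (two^>0 (suc j)))))
      (trans (cong (λ z → r j * (z * r (suc j))) (two^-suc j))
        (trans (solve 3 (λ a b c → a :* ((b :+ b) :* c) := (b :* a) :* (c :+ c)) refl (r j) (two^ j) (r (suc j)))
          (trans (cong (_* (r (suc j) + r (suc j))) (rec-inv (two^>0 j))) (*-identityˡ _)))))

    rec-≤ : ∀ {t} j → 0# < t → two^ j ≤ t + t → rec t ≤ r j + r j
    rec-≤ {t} j 0<t le = begin
      rec t                            ≡⟨ trans (sym (*-identityʳ (rec t))) (cong (rec t *_) (sym (rec-inv (two^>0 j)))) ⟩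
      rec t * (two^ j * r j)           ≡⟨ solve 3 (λ a b c → a :* (b :* c) := b :* (a :* c)) refl (rec t) (two^ j) (r j) ⟩
      two^ j * (rec t * r j)           ≤⟨ *-monoʳ (rec t * r j) (mul-nonneg (rec-≥0 0<t) (r≥0 j)) le ⟩
      (t + t) * (rec t * r j)          ≡⟨ solve 3 (λ t a c → (t :+ t) :* (a :* c) := (t :* a) :* (c :+ c)) refl t (rec t) (r j) ⟩
      t * rec t * (r j + r j)          ≡⟨ trans (cong (_* (r j + r j)) (rec-inv 0<t)) (*-identityˡ _) ⟩
      r j + r j                        ∎

    rec-≥ : ∀ {t} j → 0# < t → t ≤ two^ (suc j) → r j ≤ rec t + rec t
    rec-≥ {t} j 0<t le = subst (_≤ rec t + rec t) (sym (r-halves j)) (+-mono-≤′ (rec-anti 0<t le) (rec-anti 0<t le))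

    module Riemann (x : F) (N : ℕ) (1≤x : 1# ≤ x) where
      h : F
      h = (x - 1#) ⟋# num (suc N)

      0≤h : 0# ≤ h
      0≤h = mul-nonneg (0≤b-a 1≤x) (rec-≥0 (num-pos N))

      t : ℕ → F
      t i = 1# + num i * h

      S : ℕ → F
      S i = sum i (λ i → h * rec (t i))

      t≥1 : ∀ i → 1# ≤ t i
      t≥1 i = +-≥ 1# (mul-nonneg (num-≥0 i) 0≤h)

      t>0 : ∀ i → 0# < t i
      t>0 i = <-≤-trans′ 0<1′ (t≥1 i)

      t-suc : ∀ i → t (suc i) ≡ t i + h
      t-suc i = trans (cong (λ z → 1# + z * h) (num-suc i)) (solve 2 (λ n h → con 1ℚ :+ (con 1ℚ :+ n) :* h := con 1ℚ :+ n :* h :+ h) refl (num i) h)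

      t-0 : t 0 ≡ 1#
      t-0 = trans (cong (λ z → 1# + z * h) num-0) (trans (cong (1# +_) (zeroˡ h)) (+-identityʳ 1#))

      t-end : t (suc N) ≡ x
      t-end = trans (cong (1# +_) (trans (solve 3 (λ n y r → n :* (y :* r) := y :* (n :* r)) refl (num (suc N)) (x - 1#) (rec (num (suc N))))
        (trans (cong ((x - 1#) *_) (rec-inv (num-pos N))) (*-identityʳ (x - 1#))))) (solve 1 (λ x → con 1ℚ :+ (x :- con 1ℚ) := x) refl x)

      S≥0 : ∀ i → 0# ≤ S i
      S≥0 zero    = ≤-reflexive′ (sym (sum-0 _))
      S≥0 (suc i) = begin
        0#                          ≡⟨ sym (+-identityʳ 0#) ⟩
        0# + 0#                     ≤⟨ +-mono-≤′ (S≥0 i) (mul-nonneg 0≤h (rec-≥0 (t>0 i))) ⟩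
        S i + h * rec (t i)         ≡⟨ sym (sum-suc i _) ⟩
        S (suc i)                   ∎

      -- S i stays below the minimum over j of the lines 2 j − 2 + 2 t / 2^j: these are concave, and
      -- the slope at t + h is still at least 1 / t.
      module Upper (h≤1 : h ≤ 1#) where
        below : ∀ i j → S i + (1# + 1#) ≤ num j + num j + (t i + t i) * r j
        below zero zero = ≤-reflexive′ (trans (cong (_+ (1# + 1#)) (sum-0 _)) (trans (+-identityˡ _) (sym (trans (cong₂ _+_ (trans (cong₂ _+_ num-0 num-0) (+-identityʳ 0#))
          (trans (cong₂ (λ a b → (a + a) * b) t-0 r-0) (*-identityʳ _))) (+-identityˡ _)))))
          where
          r-0 : r 0 ≡ 1#
          r-0 = trans (cong rec num-1) (trans (sym (*-identityˡ (rec 1#))) (rec-inv 0<1′))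
        below zero (suc j) = begin
          S 0 + (1# + 1#)                             ≡⟨ trans (cong (_+ (1# + 1#)) (sum-0 _)) (+-identityˡ _) ⟩
          1# + 1#                                     ≤⟨ +-mono-≤′ one one ⟩
          num (suc j) + num (suc j)                   ≤⟨ +-≥ (num (suc j) + num (suc j)) (mul-nonneg (<⇒≤′ (add-pos (t>0 0) (<⇒≤′ (t>0 0)))) (r≥0 (suc j))) ⟩
          num (suc j) + num (suc j) + (t 0 + t 0) * r (suc j) ∎
          where
          one : 1# ≤ num (suc j)
          one = subst (1# ≤_) (sym (num-suc j)) (+-≥ 1# (num-≥0 j))
        below (suc i) j = subst₂ (λ s τ → s + (1# + 1#) ≤ num j + num j + (τ + τ) * r j) (sym (sum-suc i _)) (sym (t-suc i)) (go j)
          where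
          τ = t i
          Goal : ℕ → Set
          Goal j = S i + h * rec τ + (1# + 1#) ≤ num j + num j + (τ + h + (τ + h)) * r j
          flat : ∀ j → two^ j ≤ τ + τ → Goal j
          flat j le = begin
            S i + h * rec τ + (1# + 1#)                            ≡⟨ solve 3 (λ s a b → s :+ a :+ b := s :+ b :+ a) refl (S i) (h * rec τ) (1# + 1#) ⟩
            S i + (1# + 1#) + h * rec τ                            ≤⟨ +-mono-≤′ (below i j) (*-monoˡ h 0≤h (rec-≤ j (t>0 i) le)) ⟩
            num j + num j + (τ + τ) * r j + h * (r j + r j)        ≡⟨ solve 4 (λ n τ r h → n :+ (τ :+ τ) :* r :+ h :* (r :+ r) := n :+ (τ :+ h :+ (τ :+ h)) :* r) refl (num j + num j) τ (r j) h ⟩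
            num j + num j + (τ + h + (τ + h)) * r j                ∎
          go : ∀ j → Goal j
          go zero = flat zero (≤-trans′ (≤-reflexive′ num-1) (≤-trans′ (t≥1 i) (+-≥ τ (<⇒≤′ (t>0 i)))))
          go (suc j) = [ flat (suc j) , steep ]′ (total (two^ (suc j)) (τ + τ))
            where
            -- Here the line of index j + 1 may be too flat for the step, but up to 2^(j+1), where
            -- the two lines cross, it lies above the line of index j. That τ + h stays in this
            -- range is due to h ≤ 1 ≤ τ.
            steep : τ + τ ≤ two^ (suc j) → Goal (suc j)
            steep le = begin
              S i + h * rec τ + (1# + 1#)                                          ≤⟨ go j ⟩
              num j + num j + (τ + h + (τ + h)) * r j                              ≡⟨ cong (λ z → num j + num j + (τ + h + (τ + h)) * z) (r-halves j) ⟩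
              num j + num j + (τ + h + (τ + h)) * (r (suc j) + r (suc j))          ≡⟨ solve 3 (λ n τ r → n :+ (τ :+ τ) :* (r :+ r) := n :+ (τ :* r :+ τ :* r) :+ (τ :+ τ) :* r) refl (num j + num j) (τ + h) (r (suc j)) ⟩
              num j + num j + ((τ + h) * r (suc j) + (τ + h) * r (suc j)) + (τ + h + (τ + h)) * r (suc j) ≤⟨ +-mono-≤′ (+-mono-≤′ (≤-refl′ {num j + num j}) (+-mono-≤′ small small)) ≤-refl′ ⟩
              num j + num j + (1# + 1#) + (τ + h + (τ + h)) * r (suc j)            ≡⟨ cong (_+ (τ + h + (τ + h)) * r (suc j)) (trans (solve 1 (λ n → n :+ n :+ (con 1ℚ :+ con 1ℚ) := (con 1ℚ :+ n) :+ (con 1ℚ :+ n)) refl (num j)) (sym (cong₂ _+_ (num-suc j) (num-suc j)))) ⟩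
              num (suc j) + num (suc j) + (τ + h + (τ + h)) * r (suc j)            ∎
              where
              small : (τ + h) * r (suc j) ≤ 1#
              small = begin
                (τ + h) * r (suc j)          ≤⟨ *-monoʳ (r (suc j)) (r≥0 (suc j)) (≤-trans′ (+-mono-≤′ (≤-refl′ {τ}) (≤-trans′ h≤1 (t≥1 i))) le) ⟩
                two^ (suc j) * r (suc j)     ≡⟨ rec-inv (two^>0 (suc j)) ⟩
                1#                           ∎

        upper : ∀ k → x ≤ two^ k → lnSum# x (suc N) ≤ num (k ℕ.+ k)
        upper k x≤ = subst (lnSum# x (suc N) ≤_) (sym (num-+ k k)) (+-cancelʳ (1# + 1#) (begin
          S (suc N) + (1# + 1#)                              ≤⟨ below (suc N) k ⟩
          num k + num k + (t (suc N) + t (suc N)) * r k      ≡⟨ cong (λ z → num k + num k + z) (trans (cong (λ z → (z + z) * r k) t-end) (distribʳ (r k) x x)) ⟩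
          num k + num k + (x * r k + x * r k)                ≤⟨ +-mono-≤′ (≤-refl′ {num k + num k}) (+-mono-≤′ xr xr) ⟩
          num k + num k + (1# + 1#)                          ∎))
          where
          xr : x * r k ≤ 1#
          xr = ≤-trans′ (*-monoʳ (r k) (r≥0 k) x≤) (≤-reflexive′ (rec-inv (two^>0 k)))

      -- Twice S i is at least the minimum over j of the lines j − 1 + t / 2^j.
      Above : ℕ → ℕ → Set
      Above i j = num j + t i * r j ≤ S i + S i + 1#

      -- Beyond 2^(j+1) the next line is the lower one, so the index may be raised until t i ≤
      -- 2^(j+1); there the slope 2^-j is at most 2 / t i, and the step can be absorbed.
      reach : ∀ i fuel j → t i ≤ two^ (suc j ℕ.+ fuel) → Above i j → ∃ λ j → Above i j × t i ≤ two^ (suc j)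
      reach i zero j le a = j , a , subst (λ e → t i ≤ two^ e) (ℕₚ.+-identityʳ (suc j)) le
      reach i (suc fuel) j le a = [ (λ le → j , a , le) , (λ ge → reach i fuel (suc j) (subst (λ e → t i ≤ two^ e) (ℕₚ.+-suc (suc j) fuel) le) (next ge)) ]′ (total (t i) (two^ (suc j)))
        where
        next : two^ (suc j) ≤ t i → Above i (suc j)
        next ge = begin
          num (suc j) + t i * r (suc j)                       ≡⟨ trans (cong (_+ t i * r (suc j)) (num-suc j)) (solve 2 (λ n y → con 1ℚ :+ n :+ y := n :+ (con 1ℚ :+ y)) refl (num j) (t i * r (suc j))) ⟩
          num j + (1# + t i * r (suc j))                      ≤⟨ +-mono-≤′ (≤-refl′ {num j}) (+-mono-≤′ (≤-trans′ (≤-reflexive′ (sym (rec-inv (two^>0 (suc j))))) (*-monoʳ (r (suc j)) (r≥0 (suc j)) ge)) ≤-refl′) ⟩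
          num j + (t i * r (suc j) + t i * r (suc j))         ≡⟨ cong (num j +_) (trans (sym (distribˡ (t i) (r (suc j)) (r (suc j)))) (cong (t i *_) (sym (r-halves j)))) ⟩
          num j + t i * r j                                   ≤⟨ a ⟩
          S i + S i + 1#                                      ∎

      above : ∀ i → i ℕ.≤ suc N → ∃ (Above i)
      above zero _ = 0 , ≤-reflexive′ (trans (cong₂ _+_ num-0 (trans (cong₂ _*_ t-0 (trans (cong rec num-1) refl)) (rec-inv 0<1′)))
        (sym (trans (cong (λ s → s + s + 1#) (sum-0 _)) (cong (_+ 1#) (+-identityʳ 0#)))))
      above (suc i) i<N = step (above i (ℕₚ.<⇒≤ i<N))
        where
        step : ∃ (Above i) → ∃ (Above (suc i))
        step (j , a) = advance (reach i X j t≤ a)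
          where
          X = proj₁ (archimedean x)
          t≤ : t i ≤ two^ (suc j ℕ.+ X)
          t≤ = begin
            t i                      ≤⟨ point-upper (ℕₚ.<⇒≤ i<N) 1≤x ⟩
            x                        ≤⟨ proj₂ (archimedean x) ⟩
            num X                    ≤⟨ num-mono (ℕₚ.≤-trans (ℕₚ.<⇒≤ (n<2^n X)) (ℕₚ.^-monoʳ-≤ 2 (ℕₚ.m≤n+m X (suc j)))) ⟩
            two^ (suc j ℕ.+ X)       ∎
          advance : (∃ λ j → Above i j × t i ≤ two^ (suc j)) → ∃ (Above (suc i))
          advance (j , a , le) = j , (begin
            num j + t (suc i) * r j                            ≡⟨ trans (cong (λ z → num j + z * r j) (t-suc i)) (solve 4 (λ n t h r → n :+ (t :+ h) :* r := n :+ t :* r :+ h :* r) refl (num j) (t i) h (r j)) ⟩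
            num j + t i * r j + h * r j                        ≤⟨ +-mono-≤′ a (*-monoˡ h 0≤h (rec-≥ j (t>0 i) le)) ⟩
            S i + S i + 1# + h * (rec (t i) + rec (t i))       ≡⟨ solve 3 (λ s h r → s :+ s :+ con 1ℚ :+ h :* (r :+ r) := (s :+ h :* r) :+ (s :+ h :* r) :+ con 1ℚ) refl (S i) h (rec (t i)) ⟩
            (S i + h * rec (t i)) + (S i + h * rec (t i)) + 1# ≡⟨ cong (λ s → s + s + 1#) (sym (sum-suc i _)) ⟩
            S (suc i) + S (suc i) + 1#                         ∎)

      lower : ∀ k → two^ k ≤ x → num k ≤ lnSum# x (suc N) + lnSum# x (suc N)
      lower k ≤x = finish (above (suc N) ℕₚ.≤-refl)
        where
        finish : ∃ (Above (suc N)) → num k ≤ S (suc N) + S (suc N)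
        finish (j , a) = +-cancelʳ 1# (begin
          num k + 1#                    ≤⟨ line ⟩
          num j + two^ k * r j          ≤⟨ +-mono-≤′ (≤-refl′ {num j}) (*-monoʳ (r j) (r≥0 j) ≤x) ⟩
          num j + x * r j               ≡⟨ cong (λ z → num j + z * r j) (sym t-end) ⟩
          num j + t (suc N) * r j       ≤⟨ a ⟩
          S (suc N) + S (suc N) + 1#    ∎)
          where
          num+1 : ∀ a → num a + 1# ≡ num (a ℕ.+ 1)
          num+1 a = trans (cong (num a +_) (sym num-1)) (sym (num-+ a 1))
          -- For j ≤ k this is 2^(k-j) ≥ k - j + 1, so every line is at least k at the point 2^k.
          line : num k + 1# ≤ num j + two^ k * r j
          line with ℕₚ.≤-total j k
          ... | inj₁ j≤k = begin
                  num k + 1#                                ≡⟨ trans (num+1 k) (cong num (trans (ℕₚ.+-comm k 1) (cong suc (sym (ℕₚ.m+[n∸m]≡n j≤k))))) ⟩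
                  num (suc (j ℕ.+ d))                       ≤⟨ num-mono (subst (ℕ._≤ j ℕ.+ 2 ℕ.^ d) (ℕₚ.+-suc j d) (ℕₚ.+-monoʳ-≤ j (n<2^n d))) ⟩
                  num (j ℕ.+ 2 ℕ.^ d)                       ≡⟨ num-+ j (2 ℕ.^ d) ⟩
                  num j + two^ d                            ≡⟨ cong (num j +_) (sym (trans (cong (_* r j) split) (trans (solve 3 (λ a b c → a :* b :* c := b :* (a :* c)) refl (two^ j) (two^ d) (r j)) (trans (cong (two^ d *_) (rec-inv (two^>0 j))) (*-identityʳ _))))) ⟩
                  num j + two^ k * r j                      ∎
            where
            d = k ℕ.∸ j
            split : two^ k ≡ two^ j * two^ d
            split = trans (cong two^ (sym (ℕₚ.m+[n∸m]≡n j≤k))) (trans (cong num (ℕₚ.^-distribˡ-+-* 2 j d)) (num-* (2 ℕ.^ j) (2 ℕ.^ d)))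
          ... | inj₂ k≤j with ℕₚ.m≤n⇒m<n∨m≡n k≤j
          ...   | inj₁ k<j  = ≤-trans′ (≤-reflexive′ (num+1 k)) (≤-trans′ (num-mono (ℕₚ.≤-trans (ℕₚ.≤-reflexive (ℕₚ.+-comm k 1)) k<j)) (+-≥ (num j) (mul-nonneg (num-≥0 _) (r≥0 j))))
          ...   | inj₂ refl = ≤-reflexive′ (cong (num k +_) (sym (rec-inv (two^>0 k))))

    -- The 16 is 4 · 4: the sum for ln n is at most 2 K, the one for ln(1/δ) at least k / 2, and
    -- both are squared.
    quotient-bound : ∀ (n K k c χ E : ℕ) {S s δ} → 1 ℕ.≤ E → 0# ≤ S → S ≤ num (K ℕ.+ K) → num k ≤ s + s → 0# < num c * (s * s) → 0# ≤ δ → δ * num E ≤ 1# →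
      16 ℕ.* (n ℕ.* (K ℕ.* K)) ℕ.≤ c ℕ.* (k ℕ.* k) ℕ.* E ℕ.* χ → num n * (S * S) * (δ * rec (num c * (s * s))) ≤ num χ
    quotient-bound n K k c χ E {S} {s} {δ} E≥1 0≤S S≤ k≤ 0<D 0≤δ δE nat = *-cancelʳ D 0<D (begin
        num n * (S * S) * (δ * rec D) * D              ≡⟨ trans (solve 4 (λ a b r d → a :* (b :* r) :* d := a :* b :* (d :* r)) refl (num n * (S * S)) δ (rec D) D) (trans (cong (num n * (S * S) * δ *_) (rec-inv 0<D)) (*-identityʳ _)) ⟩
        num n * (S * S) * δ                            ≤⟨ *-cancelʳ four·E 0<4E scaled ⟩
        num χ * D                                      ∎)
      where
      D = num c * (s * s)
      four·E = num (4 ℕ.* E)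
      0<4E : 0# < four·E
      0<4E = subst (λ z → 0# < num z) (ℕₚ.suc-pred (4 ℕ.* E) {{ℕₚ.m*n≢0 4 E {{_}} {{ℕ.>-nonZero E≥1}}}}) (num-pos _)
      num-4 : ∀ z → num (4 ℕ.* z) ≡ (1# + 1# + (1# + 1#)) * num z
      num-4 z = trans (num-* 4 z) (cong (_* num z) (trans (num-+ 2 2) (cong₂ _+_ two two)))
        where
        two : num 2 ≡ 1# + 1#
        two = trans (num-+ 1 1) (cong₂ _+_ num-1 num-1)
      scaled : num n * (S * S) * δ * four·E ≤ num χ * D * four·E
      scaled = begin
        num n * (S * S) * δ * four·E                             ≡⟨ trans (cong (num n * (S * S) * δ *_) (num-4 E)) (solve 4 (λ a b e o → a :* b :* (o :* e) := a :* o :* (b :* e)) refl (num n * (S * S)) δ (num E) (1# + 1# + (1# + 1#))) ⟩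
        num n * (S * S) * (1# + 1# + (1# + 1#)) * (δ * num E)    ≤⟨ *-monoˡ (num n * (S * S) * (1# + 1# + (1# + 1#))) nn δE ⟩
        num n * (S * S) * (1# + 1# + (1# + 1#)) * 1#             ≡⟨ *-identityʳ _ ⟩
        num n * (S * S) * (1# + 1# + (1# + 1#))                  ≤⟨ *-monoʳ (1# + 1# + (1# + 1#)) 4≥0 (*-monoˡ (num n) (num-≥0 n) (mul-mono 0≤S S≤ 0≤S S≤)) ⟩
        num n * (num (K ℕ.+ K) * num (K ℕ.+ K)) * (1# + 1# + (1# + 1#)) ≡⟨ sym lhs ⟩
        num (16 ℕ.* (n ℕ.* (K ℕ.* K)))                           ≤⟨ num-mono nat ⟩
        num (c ℕ.* (k ℕ.* k) ℕ.* E ℕ.* χ)                        ≡⟨ trans (num-* _ χ) (cong (_* num χ) (trans (num-* _ E) (cong (_* num E) (trans (num-* c _) (cong (num c *_) (num-* k k)))))) ⟩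
        num c * (num k * num k) * num E * num χ                  ≤⟨ *-monoʳ (num χ) (num-≥0 χ) (*-monoʳ (num E) (num-≥0 E) (*-monoˡ (num c) (num-≥0 c) (mul-mono (num-≥0 k) k≤ (num-≥0 k) k≤))) ⟩
        num c * ((s + s) * (s + s)) * num E * num χ              ≡⟨ solve 4 (λ c s e x → c :* ((s :+ s) :* (s :+ s)) :* e :* x := x :* (c :* (s :* s)) :* ((con 1ℚ :+ con 1ℚ :+ (con 1ℚ :+ con 1ℚ)) :* e)) refl (num c) s (num E) (num χ) ⟩
        num χ * D * ((1# + 1# + (1# + 1#)) * num E)              ≡⟨ cong (num χ * D *_) (sym (num-4 E)) ⟩
        num χ * D * four·E                                       ∎
        where
        4≥0 : 0# ≤ 1# + 1# + (1# + 1#)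
        4≥0 = <⇒≤′ (add-pos (add-pos 0<1′ (<⇒≤′ 0<1′)) (<⇒≤′ (add-pos 0<1′ (<⇒≤′ 0<1′))))
        nn : 0# ≤ num n * (S * S) * (1# + 1# + (1# + 1#))
        nn = mul-nonneg (mul-nonneg (num-≥0 n) (mul-nonneg 0≤S 0≤S)) 4≥0
        lhs : num (16 ℕ.* (n ℕ.* (K ℕ.* K))) ≡ num n * (num (K ℕ.+ K) * num (K ℕ.+ K)) * (1# + 1# + (1# + 1#))
        lhs = trans (cong num (e n K)) (trans (num-4 _) (trans (*-comm _ _) (cong (_* (1# + 1# + (1# + 1#))) (trans (num-* n _) (cong (num n *_) (num-* (K ℕ.+ K) (K ℕ.+ K)))))))
          where

          e : ∀ n K → 16 ℕ.* (n ℕ.* (K ℕ.* K)) ≡ 4 ℕ.* (n ℕ.* ((K ℕ.+ K) ℕ.* (K ℕ.+ K)))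
          e = solve-∀

    module Ratio (n m k : ℕ) (n≥1 : 1 ℕ.≤ n) (2^kn≤m : 2 ℕ.^ k ℕ.* n ℕ.≤ m) where
      δ : F
      δ = num n * rec (num m)

      pos : ∀ {a} → 1 ℕ.≤ a → 0# < num a
      pos {suc a} _ = num-pos a

      m>0 : 0# < num m
      m>0 = pos (ℕₚ.≤-trans (ℕₚ.*-mono-≤ (ℕₚ.m^n>0 2 k) n≥1) 2^kn≤m)

      δ>0 : 0# < δ
      δ>0 = mul-pos (pos n≥1) (rec-pos m>0)

      δ2^k : δ * two^ k ≤ 1#
      δ2^k = begin
        num n * rec (num m) * two^ k         ≡⟨ solve 3 (λ a b c → a :* b :* c := (c :* a) :* b) refl (num n) (rec (num m)) (two^ k) ⟩
        two^ k * num n * rec (num m)         ≡⟨ cong (_* rec (num m)) (sym (num-* (2 ℕ.^ k) n)) ⟩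
        num (2 ℕ.^ k ℕ.* n) * rec (num m)    ≤⟨ *-monoʳ (rec (num m)) (rec-≥0 m>0) (num-mono 2^kn≤m) ⟩
        num m * rec (num m)                  ≡⟨ rec-inv m>0 ⟩
        1#                                   ∎

      δ²4^k : δ * δ * num (2 ℕ.^ k ℕ.* 2 ℕ.^ k) ≤ 1#
      δ²4^k = begin
        δ * δ * num (2 ℕ.^ k ℕ.* 2 ℕ.^ k)    ≡⟨ trans (cong (δ * δ *_) (num-* (2 ℕ.^ k) (2 ℕ.^ k))) (solve 2 (λ d e → d :* d :* (e :* e) := (d :* e) :* (d :* e)) refl δ (two^ k)) ⟩
        (δ * two^ k) * (δ * two^ k)          ≤⟨ mul-mono δ2≥0 δ2^k δ2≥0 δ2^k ⟩
        1# * 1#                              ≡⟨ *-identityˡ 1# ⟩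
        1#                                   ∎
        where
        δ2≥0 : 0# ≤ δ * two^ k
        δ2≥0 = mul-nonneg (<⇒≤′ δ>0) (num-≥0 _)

      2^k≤δ⁻¹ : two^ k ≤ rec δ
      2^k≤δ⁻¹ = begin
        two^ k                     ≡⟨ trans (sym (*-identityʳ _)) (cong (two^ k *_) (sym (rec-inv δ>0))) ⟩
        two^ k * (δ * rec δ)       ≡⟨ solve 3 (λ a b c → a :* (b :* c) := (b :* a) :* c) refl (two^ k) δ (rec δ) ⟩
        δ * two^ k * rec δ         ≤⟨ *-monoʳ (rec δ) (rec-≥0 δ>0) δ2^k ⟩
        1# * rec δ                 ≡⟨ *-identityˡ (rec δ) ⟩
        rec δ                      ∎

      log-bound : ∀ K c χ E {δ′} i → 1 ℕ.≤ k → 1 ℕ.≤ c → n ℕ.≤ 2 ℕ.^ K → n ℕ.≤ suc i → 1 ℕ.≤ E → 0# ≤ δ′ → δ′ * num E ≤ 1# →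
        16 ℕ.* (n ℕ.* (K ℕ.* K)) ℕ.≤ c ℕ.* (k ℕ.* k) ℕ.* E ℕ.* χ →
        num n * (lnSum# (num n) (suc i) * lnSum# (num n) (suc i)) * (δ′ * rec (num c * (lnSum# (rec δ) (suc i) * lnSum# (rec δ) (suc i)))) ≤ num χ
      log-bound K c χ E {δ′} i k≥1 c≥1 n≤2^K n≤i E≥1 0≤δ′ δ′E nat =
        quotient-bound n K k c χ E E≥1 (Rn.S≥0 (suc i)) (Rn.Upper.upper h≤1 K (num-mono n≤2^K)) k≤ (mul-pos (pos c≥1) (mul-pos s>0 s>0)) 0≤δ′ δ′E nat
        where
        1≤num : ∀ {a} → 1 ℕ.≤ a → 1# ≤ num a
        1≤num a≥1 = subst (_≤ num _) num-1 (num-mono a≥1)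
        module Rn = Riemann (num n) i (1≤num n≥1)
        module Rδ = Riemann (rec δ) i (≤-trans′ (1≤num (ℕₚ.m^n>0 2 k)) 2^k≤δ⁻¹)
        s : F
        s = lnSum# (rec δ) (suc i)
        k≤ : num k ≤ s + s
        k≤ = Rδ.lower k 2^k≤δ⁻¹
        s>0 : 0# < s
        s>0 = <-≤-trans′ 0<½ (begin
          ½#                     ≡⟨ sym (*-identityˡ ½#) ⟩
          1# * ½#                ≤⟨ *-monoʳ ½# (<⇒≤′ 0<½) (≤-trans′ (1≤num k≥1) k≤) ⟩
          (s + s) * ½#           ≡⟨ solve 2 (λ s h → (s :+ s) :* h := s :* (h :+ h)) refl s ½# ⟩
          s * (½# + ½#)          ≡⟨ trans (cong (s *_) (sym (⟦⟧-+ ½ ½))) (*-identityʳ s) ⟩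
          s                      ∎)
        -- The subdivision must be at least as fine as n - 1 intervals for `Upper` to apply, so the
        -- comparison holds from index n on only.
        h≤1 : Rn.h ≤ 1#
        h≤1 = begin
          (num n - 1#) * rec (num (suc i))    ≤⟨ *-monoʳ (rec (num (suc i))) (rec-≥0 (num-pos i)) le ⟩
          num (suc i) * rec (num (suc i))     ≡⟨ rec-inv (num-pos i) ⟩
          1#                                  ∎
          where
          le : num n - 1# ≤ num (suc i)
          le = ≤-trans′ (+-cancelʳ 1# (subst (_≤ num n + 1#) (solve 1 (λ a → a := a :- con 1ℚ :+ con 1ℚ) refl (num n)) (+-≥ (num n) (<⇒≤′ 0<1′)))) (num-mono n≤i)

-- Passage from naturals to the reals of the statement.

module Conclusion where

  open import Data.Nat as ℕ using (ℕ; suc)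
  import Data.Nat.Properties as ℕₚ
  open import Data.Nat.Tactic.RingSolver using (solve-∀)
  open import Data.Product
  open import Data.Rational using (ℚ; 0ℚ; 1ℚ; ½; _+_; _*_; -_; ∣_∣; _≤_; _<_)
  import Data.Rational.Properties as ℚₚ
  open import Relation.Binary.PropositionalEquality
  open import Relation.Nullary using (yes; no; contradiction)
  open import Relation.Nullary.Decidable using (toWitness)
  open Reals using (ι; _⁻¹; sumTo; laws; ℝ; _≤ℝ_; _<ℝ_; fromℕ; fromℚ; 0ℝ; _*ℝ_; _²; _/ℝ_[_]; ln; ι-pos; ι-+; module ℚ-Facts; module Density; _÷_; 0<x≤n⇒0<n)
  open LabelingGame using (χ; χ-isLeast)
  open Adversary using (log-ratio; C₀; 26≤C₀; χ-≥; module Combine)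
  open Logarithm using (module LnBounds)

  module ℚ-Ln = LnBounds (OrderedField.mkOps ℚ _+_ _*_ -_ _⁻¹ ∣_∣ _≤_ _<_ ι (λ q → q) sumTo) laws ℚₚ.≤-total

  -- A single ε = ½ decides, since a > b would mean a ≥ b + 1.
  ι-cancel-≤ : ∀ {a b} → (∀ ε → 0ℚ < ε → ι a ≤ ι b + ε) → a ℕ.≤ b
  ι-cancel-≤ {a} {b} h with a ℕ.≤? b
  ... | yes p = p
  ... | no ¬p = contradiction (ℚₚ.≤-<-trans (ℚₚ.≤-trans (ℚ-Facts.num-mono (ℕₚ.≰⇒> ¬p)) (h ½ Reals.0<½))
    (subst (ι b + ½ <_) (trans (ℚₚ.+-comm (ι b) 1ℚ) (sym (ι-+ 1 b))) (ℚₚ.+-monoʳ-< (ι b) ½<1))) (ℚₚ.<-irrefl refl)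
    where
    ½<1 : ½ < 1ℚ
    ½<1 = toWitness {a? = ½ ℚₚ.<? 1ℚ} _

  eventually-const : ∀ {P : Set} → Reals.Eventually (λ _ → P) → P
  eventually-const (N , h) = h N ℕₚ.≤-refl

  opaque
    -- One constant serves the denominators, which need 16 `C₀`, and the condition r ≥ C m, which
    -- needs 26.
    C : ℕ
    C = 16 ℕ.* C₀

    C≡ : C ≡ 16 ℕ.* C₀
    C≡ = refl

    26≤C : 26 ℕ.≤ C
    26≤C = ℕₚ.≤-trans 26≤C₀ (ℕₚ.m≤n*m C₀ 16)

  0<C : 0ℝ <ℝ fromℕ C
  0<C = 1ℚ , Reals.0<1 , 0 , λ _ _ → ℚ-Facts.num-mono (ℕₚ.≤-trans (ℕ.s≤s ℕ.z≤n) 26≤C)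

  C≤n⇒ : ∀ n → fromℕ C ≤ℝ fromℕ n → C ℕ.≤ n
  C≤n⇒ n h = ι-cancel-≤ λ ε 0<ε → eventually-const (h ε 0<ε)

  Cm≤r⇒ : ∀ m r → fromℕ C *ℝ fromℕ m ≤ℝ fromℕ r → C ℕ.* m ℕ.≤ r
  Cm≤r⇒ m r h = ι-cancel-≤ λ ε 0<ε → subst (_≤ ι r + ε) (sym (ℚ-Facts.num-* C m)) (eventually-const (h ε 0<ε))

  module Final (n m r : ℕ) (C₁≤n : fromℕ C ≤ℝ fromℕ n) (2n≤m : 2 ℕ.* n ℕ.≤ m) (m<r : m ℕ.< r) where
    0<n : 0 ℕ.< n
    0<n = 0<x≤n⇒0<n (fromℕ C) n 0<C C₁≤n

    open Density 0<n 2n≤m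

    δ : ℚ
    δ = ι n ÷ ι m

    D : ℝ
    D = fromℕ C *ℝ ln (δ ⁻¹) 0<δ⁻¹ ²

    0<D : 0ℝ <ℝ D
    0<D = 0<C[ln[1/δ]]² (fromℕ C) 0<C

    C≤n : C ℕ.≤ n
    C≤n = C≤n⇒ n C₁≤n

    n≥2 : 2 ℕ.≤ n
    n≥2 = ℕₚ.≤-trans (ℕ.s≤s (ℕ.s≤s ℕ.z≤n)) (ℕₚ.≤-trans 26≤C C≤n)

    χ′ : ℕ
    χ′ = χ n m r n≤m m<r

    module Scales (k p : ℕ) (m≥ : 2 ℕ.^ k ℕ.* n ℕ.≤ m) (m< : m ℕ.< 2 ℕ.^ suc k ℕ.* n) (n≥ : 2 ℕ.^ p ℕ.* 1 ℕ.≤ n) (n< : n ℕ.< 2 ℕ.^ suc p ℕ.* 1) where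
      k≥1 : 1 ℕ.≤ k
      k≥1 = ℕₚ.n≢0⇒n>0 λ { refl → contradiction 2n≤m (ℕₚ.<⇒≱ m<) }

      n<′ : n ℕ.< 2 ℕ.^ suc p
      n<′ = subst (n ℕ.<_) (ℕₚ.*-identityʳ (2 ℕ.^ suc p)) n<

      module Nat = Combine n m r k p k≥1 m≥ m< (subst (ℕ._≤ n) (ℕₚ.*-identityʳ (2 ℕ.^ p)) n≥) n<′ n≥2 n≤m
        (proj₁ (proj₁ (χ-isLeast n m r n≤m m<r))) χ′ (proj₂ (proj₁ (χ-isLeast n m r n≤m m<r))) (χ-≥ n m r n≤m m<r)
      module Rat = ℚ-Ln.Ratio n m k 0<n m≥

      -- The natural number `E` is a lower bound for 1 / δ′: 2^k when δ′ is δ, and 4^k when it is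
      -- δ².
      convert : ∀ E {δ′} → 1 ℕ.≤ E → 0ℚ ≤ δ′ → δ′ * ι E ≤ 1ℚ → n ℕ.* (suc p ℕ.* suc p) ℕ.≤ C₀ ℕ.* (k ℕ.* k) ℕ.* E ℕ.* χ′ →
        fromℕ n *ℝ ln (ι n) (ι-pos 0<n) ² *ℝ (fromℚ δ′ /ℝ D [ 0<D ]) ≤ℝ fromℕ χ′
      convert E {δ′} E≥1 0≤δ′ δ′E nat ε 0<ε = n , λ i n≤i → ℚₚ.≤-trans
        (Rat.log-bound (suc p) C χ′ E {δ′} i k≥1 (ℕₚ.≤-trans (ℕ.s≤s ℕ.z≤n) 26≤C) (ℕₚ.<⇒≤ n<′) (ℕₚ.m≤n⇒m≤1+n n≤i) E≥1 0≤δ′ δ′E nat′)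
        (ℚ-Ln.+-≥ (ι χ′) (ℚₚ.<⇒≤ 0<ε))
        where
        nat′ : 16 ℕ.* (n ℕ.* (suc p ℕ.* suc p)) ℕ.≤ C ℕ.* (k ℕ.* k) ℕ.* E ℕ.* χ′
        nat′ = ℕₚ.≤-trans (ℕₚ.*-monoʳ-≤ 16 nat) (ℕₚ.≤-reflexive (trans (e 16 C₀ (k ℕ.* k) E χ′) (cong (λ c → c ℕ.* (k ℕ.* k) ℕ.* E ℕ.* χ′) (sym C≡))))
          where
          e : ∀ s c a b d → s ℕ.* (c ℕ.* a ℕ.* b ℕ.* d) ≡ s ℕ.* c ℕ.* a ℕ.* b ℕ.* d
          e = solve-∀

      many : n ℕ.* 2 ℕ.^ (n ℕ.∸ 1) ℕ.≤ r → fromℕ n *ℝ ln (ι n) (ι-pos 0<n) ² *ℝ (fromℚ δ /ℝ D [ 0<D ]) ≤ℝ fromℕ χ′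
      many h = convert (2 ℕ.^ k) (ℕₚ.m^n>0 2 k) (ℚₚ.<⇒≤ 0<δ) Rat.δ2^k (Nat.many-keys h)

      few : fromℕ C *ℝ fromℕ m ≤ℝ fromℕ r → fromℕ n *ℝ ln (ι n) (ι-pos 0<n) ² *ℝ (fromℚ δ ² /ℝ D [ 0<D ]) ≤ℝ fromℕ χ′
      few h = convert (2 ℕ.^ k ℕ.* 2 ℕ.^ k) {δ * δ} (ℕₚ.*-mono-≤ (ℕₚ.m^n>0 2 k) (ℕₚ.m^n>0 2 k)) (ℚ-Facts.mul-nonneg (ℚₚ.<⇒≤ 0<δ) (ℚₚ.<⇒≤ 0<δ)) Rat.δ²4^k
        (Nat.few-keys (ℕₚ.≤-trans (ℕₚ.*-monoˡ-≤ m 26≤C) (Cm≤r⇒ m r h)))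

    result : (n ℕ.* 2 ℕ.^ (n ℕ.∸ 1) ℕ.≤ r → fromℕ n *ℝ ln (ι n) (ι-pos 0<n) ² *ℝ (fromℚ δ /ℝ D [ 0<D ]) ≤ℝ fromℕ χ′)
           × (fromℕ C *ℝ fromℕ m ≤ℝ fromℕ r → fromℕ n *ℝ ln (ι n) (ι-pos 0<n) ² *ℝ (fromℚ δ ² /ℝ D [ 0<D ]) ≤ℝ fromℕ χ′)
    -- The dyadic logarithm of n is that of the ratio of n to 1; hence the factors 1 in the bounds
    -- for p.
    result = at (log-ratio n m 0<n n≤m) (log-ratio 1 n ℕₚ.≤-refl 0<n)
      where
      at : (∃ λ k → 2 ℕ.^ k ℕ.* n ℕ.≤ m × m ℕ.< 2 ℕ.^ suc k ℕ.* n) → (∃ λ p → 2 ℕ.^ p ℕ.* 1 ℕ.≤ n × n ℕ.< 2 ℕ.^ suc p ℕ.* 1) → _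
      at (k , m≥ , m<) (p , n≥ , n<) = Scales.many k p m≥ m< n≥ n< , Scales.few k p m≥ m< n≥ n<

open import Data.Nat using (ℕ; _*_; _∸_; _^_; _≤_; _<_)
open import Data.Product using (Σ-syntax; _×_; _,_)
open LabelingGame
open Reals

theorem1 :
  Σ[ C₁ ∈ ℝ ] Σ[ 0<C₁ ∈ 0ℝ <ℝ C₁ ]
    (∀ (n m r : ℕ) (C₁≤n : C₁ ≤ℝ fromℕ n) (2n≤m : 2 * n ≤ m) (m<r : m < r) →
      let 0<n = 0<x≤n⇒0<n C₁ n 0<C₁ C₁≤n
          open Density 0<n 2n≤m
          δ = ι n ÷ ι m
          D = C₁ *ℝ ln (δ ⁻¹) 0<δ⁻¹ ²
          0<D = 0<C[ln[1/δ]]² C₁ 0<C₁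
      in
        (n * 2 ^ (n ∸ 1) ≤ r →
           fromℕ n *ℝ ln (ι n) (ι-pos 0<n) ² *ℝ (fromℚ δ /ℝ D [ 0<D ]) ≤ℝ fromℕ (χ n m r n≤m m<r))
      × (C₁ *ℝ fromℕ m ≤ℝ fromℕ r →
           fromℕ n *ℝ ln (ι n) (ι-pos 0<n) ² *ℝ (fromℚ δ ² /ℝ D [ 0<D ]) ≤ℝ fromℕ (χ n m r n≤m m<r)))
theorem1 = fromℕ Conclusion.C , Conclusion.0<C , Conclusion.Final.result
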